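{- Every generalized Halin graph $G$ has a permanent-non-singular $(0,2)$-matrix.
   Context: Graphs are finite and simple. A generalized Halin graph is a graph obtained from a tree $T$ embedded in the plane (vertices of degree $2$ are allowed) by adding a cycle through all the leaves of $T$ in the cyclic order in which they appear in the plane embedding. For a graph $G$, fix an orientation $D$ of $G$. Let $A_G$ be the matrix whose rows are indexed by $E(G)$ and whose columns are indexed by $V(G)\cup E(G)$. For an edge $e$ oriented from $u$ to $v$ and $z\in V(G)\cup E(G)$: $A_G[e,z]=1$ if $z=v$ or $z\neq e$ is an edge incident to $v$; $A_G[e,z]=-1$ if $z=u$ or $z\neq e$ is an edge incident to $u$; and $A_G[e,z]=0$ otherwise. Write $A_G(z)$ for the column of $A_G$ indexed by $z$. An index function is a map $\eta:V(G)\cup E(G)\to\{0,1,2,\dots\}$; $A_G(\eta)$ denotes the matrix whose columns are columns of $A_G$, with each column $A_G(z)$ occurring exactly $\eta(z)$ times. When $\sum_z\eta(z)=|E(G)|$ this is a square matrix. An $(a,b)$-matrix of $G$ is a square matrix $A_G(\eta)$ with $\eta(v)\le a$ for every vertex $v$ and $\eta(e)\le b$ for every edge $e$. A square matrix is permanent-non-singular if its permanent is nonzero. (Reversing the orientation of an edge negates one row of $A_G$, so these notions do not depend on the chosen orientation.) -}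

module Defs where

open import Data.Nat using (ℕ; zero; suc; _+_; _≤_; _<_)
open import Data.Fin using (Fin; zero; suc; punchIn)
open import Data.Fin.Properties using (_≟_)
open import Data.Integer using (ℤ; 0ℤ; 1ℤ; _-_) renaming (_+_ to _+ℤ_; _*_ to _*ℤ_)
open import Data.Bool using (Bool; true; false; if_then_else_; _∨_)
open import Data.Sum using (_⊎_; inj₁; inj₂)
import Data.Sum.Properties as SumP
open import Data.Product using (Σ; _×_; _,_; proj₁; proj₂; ∃)
open import Data.List using (List; []; _∷_; _++_; length)
open import Data.List.Membership.Propositional using (_∈_)
open import Relation.Nullary using (¬_)
open import Relation.Nullary.Decidable using (⌊_⌋)
open import Relation.Binary.PropositionalEquality using (_≡_; _≢_)
open import Function.Bundles using (_⇔_)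
open import Function.Definitions using (Injective)

-- Finite simple graphs, with a fixed orientation of each edge.
-- Vertices: Fin nV.  Edges: Fin nE; edge e is oriented from
-- proj₁ (ends e) (tail u) to proj₂ (ends e) (head v).

SameEnds : ∀ {n} → Fin n × Fin n → Fin n × Fin n → Set
SameEnds (a , b) (c , d) = (a ≡ c × b ≡ d) ⊎ (a ≡ d × b ≡ c)

record Graph : Set where
  field
    nV nE     : ℕ
    ends      : Fin nE → Fin nV × Fin nV
    loopless  : ∀ e → proj₁ (ends e) ≢ proj₂ (ends e)
    noMulti   : ∀ e f → SameEnds (ends e) (ends f) → e ≡ f

open Graph public

Adj : (G : Graph) → Fin (nV G) → Fin (nV G) → Set
Adj G u v = ∃ λ e → SameEnds (ends G e) (u , v)

-- Plane trees, represented as rooted ordered trees (children ordered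
-- according to the rotation of the plane embedding).

mutual
  data Tree : Set where
    node : Forest → Tree

  data Forest : Set where
    []  : Forest
    _∷_ : Tree → Forest → Forest

mutual
  size : Tree → ℕ
  size (node f) = suc (sizeF f)

  sizeF : Forest → ℕ
  sizeF [] = 0
  sizeF (t ∷ f) = size t + sizeF f

-- Vertices are labelled 0 .. size t - 1 in preorder (root = 0).
mutual
  edgesT : ℕ → Tree → List (ℕ × ℕ)
  edgesT k (node f) = edgesF k (suc k) f

  edgesF : ℕ → ℕ → Forest → List (ℕ × ℕ)
  edgesF p k [] = []
  edgesF p k (t ∷ f) = (p , k) ∷ (edgesT k t ++ edgesF p (k + size t) f)

-- Non-root leaves in preorder (= order of appearance in the plane).
mutual
  leavesT : ℕ → Tree → List ℕ
  leavesT k (node []) = k ∷ []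
  leavesT k (node (t ∷ f)) = leavesF (suc k) (t ∷ f)

  leavesF : ℕ → Forest → List ℕ
  leavesF k [] = []
  leavesF k (t ∷ f) = leavesT k t ++ leavesF (k + size t) f

-- All leaves (vertices of degree 1) of the tree, in the cyclic order
-- of the plane embedding; the root (label 0) is a leaf iff it has
-- exactly one child.
treeLeaves : Tree → List ℕ
treeLeaves (node (t ∷ [])) = 0 ∷ leavesF 1 (t ∷ [])
treeLeaves (node f) = leavesF 1 f

treeEdges : Tree → List (ℕ × ℕ)
treeEdges t = edgesT 0 t

pathEdges : List ℕ → List (ℕ × ℕ)
pathEdges [] = []
pathEdges (x ∷ []) = []
pathEdges (x ∷ y ∷ xs) = (x , y) ∷ pathEdges (y ∷ xs)

lastOr : ℕ → List ℕ → ℕ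
lastOr d [] = d
lastOr d (x ∷ xs) = lastOr x xs

cycleEdges : List ℕ → List (ℕ × ℕ)
cycleEdges [] = []
cycleEdges (x ∷ xs) = pathEdges (x ∷ xs) ++ ((lastOr x xs , x) ∷ [])

halinEdges : Tree → List (ℕ × ℕ)
halinEdges t = treeEdges t ++ cycleEdges (treeLeaves t)

HalinAdj : Tree → ℕ → ℕ → Set
HalinAdj t a b = ((a , b) ∈ halinEdges t) ⊎ ((b , a) ∈ halinEdges t)

-- G is a generalized Halin graph: G is isomorphic to the graph obtained
-- from a plane tree t (with at least 3 leaves, so the added cycle is a
-- genuine cycle of a simple graph) by adding the cycle through its
-- leaves in plane order.  φ is the vertex bijection onto {0..size t-1}.
IsGenHalin : Graph → Set
IsGenHalin G =
  Σ Tree λ t →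
    3 ≤ length (treeLeaves t) ×
    Σ (Fin (nV G) → ℕ) λ φ →
      nV G ≡ size t × Injective _≡_ _≡_ φ × (∀ u → φ u < size t) ×
      (∀ u v → Adj G u v ⇔ HalinAdj t (φ u) (φ v))

Col : Graph → Set
Col G = Fin (nV G) ⊎ Fin (nE G)

ind : Bool → ℤ
ind true = 1ℤ
ind false = 0ℤ

incident : (G : Graph) → Fin (nE G) → Fin (nV G) → Bool
incident G f w = ⌊ w ≟ proj₁ (ends G f) ⌋ ∨ ⌊ w ≟ proj₂ (ends G f) ⌋

A : (G : Graph) → Fin (nE G) → Col G → ℤ
A G e (inj₁ w) = ind ⌊ w ≟ proj₂ (ends G e) ⌋ - ind ⌊ w ≟ proj₁ (ends G e) ⌋
A G e (inj₂ f) =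
  if ⌊ f ≟ e ⌋ then 0ℤ
  else (ind (incident G f (proj₂ (ends G e))) - ind (incident G f (proj₁ (ends G e))))

sumFin : ∀ {k} → (Fin k → ℤ) → ℤ
sumFin {zero} g = 0ℤ
sumFin {suc k} g = g zero +ℤ sumFin (λ i → g (suc i))

countFin : ∀ {k} → (Fin k → Bool) → ℕ
countFin {zero} p = 0
countFin {suc k} p = (if p zero then 1 else 0) + countFin (λ i → p (suc i))

perm : ∀ {k} → (Fin k → Fin k → ℤ) → ℤ
perm {zero} M = 1ℤ
perm {suc k} M = sumFin (λ j → M zero j *ℤ perm (λ i j' → M (suc i) (punchIn j j')))

_≟C_ : {G : Graph} → (x y : Col G) → _
_≟C_ = SumP.≡-dec _≟_ _≟_

-- A_G(η) (up to the order of its columns, irrelevant for the permanent):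
-- the column A_G(c j) is the j-th column, where c hits each z exactly
-- η z times.  Square since it has nE G columns.
IsColumnChoice : (G : Graph) → (Col G → ℕ) → (Fin (nE G) → Col G) → Set
IsColumnChoice G η c = ∀ z → countFin (λ j → ⌊ _≟C_ {G} (c j) z ⌋) ≡ η z

Aη : (G : Graph) → (Fin (nE G) → Col G) → Fin (nE G) → Fin (nE G) → ℤ
Aη G c i j = A G i (c j)

HasPNSMatrix : ℕ → ℕ → Graph → Set
HasPNSMatrix a b G =
  Σ (Col G → ℕ) λ η →
    (∀ v → η (inj₁ v) ≤ a) × (∀ e → η (inj₂ e) ≤ b) ×
    Σ (Fin (nE G) → Col G) λ c →
      IsColumnChoice G η c × perm (Aη G c) ≢ 0ℤ

{-# OPTIONS --safe #-}
-- The column of an edge uv is y_u + y_v, where y_w is the column of the vertex w, so A_G(η)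
-- pairs products of linear forms in the y_w with ∏ (y_v - y_u).  By multilinearity it is
-- enough to find linear combinations of edge columns, every edge being used in at most
-- two of them, whose matrix has nonzero permanent.
--
-- Root the tree at a leaf 0 and list the other leaves as x_1, …, x_n.  An internal vertex v
-- takes the edge to its first child: this column vanishes on the rows of the smaller
-- internal vertices, so the internal part is triangular and splits off.  What is left is
-- the path x_1 … x_n with every path edge taken twice, the combination
-- y_{x_1} - y_{x_n} of the two cycle edges at 0, also taken twice, and one combination
-- ± y_{x_i} ± y_{x_{i+1}} of tree edges, the signs being those of a 2-colouring of the tree.
-- Eliminating x_1, x_2, … in turn evaluates this block by 2 × 2 transfer matrices M with
-- M³ = ± 8, so its vanishing depends only on n modulo 6 and on the two colours.  For
-- n ≡ 0, 1 (mod 6) the block can vanish for every choice of i, and x_1 is left out of the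
-- path as well: its branch is then traversed downwards and y_{x_2} + y_{x_n} replaces
-- y_{x_1} - y_{x_n}.  For three leaves the root leaf is chosen so that the other two have
-- equal colours.

module Submission where

import Algebra.Solver.CommutativeMonoid as CommutativeMonoidSolver
open import Data.Bool using (Bool; true; false; not; if_then_else_; _∨_)
import Data.Bool.Properties as Bool
open import Data.Empty using (⊥)
open import Data.Fin using (Fin; zero; suc; toℕ; fromℕ<; punchIn; punchOut)
import Data.Fin.Properties as Fin
open import Data.Integer using (ℤ; 0ℤ; 1ℤ; -[1+_]; _+_; _*_; _-_; -_) renaming (+_ to pos)
import Data.Integer.Properties as ℤ
open import Data.Integer.Tactic.RingSolver using (solve-∀)
open import Data.List using (List; []; _∷_; _++_; map; replicate; length; concatMap; tabulate; allFin)
import Data.List.Properties as List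
open import Data.List.Membership.Propositional using (_∈_; _∉_)
open import Data.List.Membership.Propositional.Properties using (∈-++⁻; ∈-++⁺ˡ; ∈-++⁺ʳ; ∈-map⁺; ∈-map⁻; ∈-∃++; ∈-allFin)
open import Data.List.Relation.Binary.Permutation.Propositional using (_↭_; refl; prep; swap; trans; ↭-sym; ↭-reflexive; module PermutationReasoning)
open import Data.List.Relation.Binary.Permutation.Propositional.Properties using (shift; shifts; ∷↭∷ʳ; ++⁺; ++⁺ˡ; ++⁺ʳ; map⁺; ++-comm; ∈-resp-↭; All-resp-↭; ↭-map-inv; ++-commutativeMonoid)
open import Data.List.Relation.Binary.Pointwise as Pointwise using (Pointwise; []; _∷_)
open import Data.List.Relation.Binary.Sublist.Propositional using (_⊆_; []; _∷_; _∷ʳ_; ⊆-refl)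
import Data.List.Relation.Binary.Sublist.Propositional.Properties as Sublist
open import Data.List.Relation.Unary.All as All using (All; []; _∷_)
import Data.List.Relation.Unary.All.Properties as All
open import Data.List.Relation.Unary.AllPairs as AllPairs using (AllPairs; []; _∷_)
import Data.List.Relation.Unary.AllPairs.Properties as AllPairs
open import Data.List.Relation.Unary.Any using (here; there)
open import Data.List.Relation.Unary.Unique.Propositional using (Unique)
import Data.List.Relation.Unary.Unique.Propositional.Properties as Unique
open import Data.Nat as ℕ using (ℕ; zero; suc; _≤_; _<_; s≤s; z≤n)
import Data.Nat.Properties as ℕ
open import Data.Product using (_×_; _,_; proj₁; proj₂; ∃)
open import Data.Sum using (_⊎_; inj₁; inj₂; [_,_]′)
open import Data.Unit using (⊤; tt)
open import Function using (_∘_)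
open import Function.Bundles using (Equivalence)
open import Function.Definitions using (Injective)
open import Relation.Binary.PropositionalEquality using (_≡_; _≢_; refl; sym; cong; cong₂; subst; module ≡-Reasoning) renaming (trans to infixr 4 _∙_)
open import Relation.Nullary using (yes; no; contradiction)
open import Relation.Nullary.Decidable using (⌊_⌋)

open import Defs

-- The row of a tree edge belongs to its lower end. Once the internal vertices are split off, the
-- block has n rows from leaf edges, n - 1 from path edges and 2 from the cycle edges at 0, hence 2n
-- + 1 columns: 2n - 2 path columns and three more. The bound of two uses per edge decides what
-- these three can be: the path edges are spent, the edges at 0 give one combination twice, and each
-- tree edge has one use left, since the triangular part may have taken the other. The tree being
-- bipartite, a combination of its edge columns has alternating sum zero over the colour classes, so
-- a single leaf variable is out of reach. The colours of the chosen leaves cannot be controlled: a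
-- base case has to be nonzero for all four pairs of signs, that is, the values for the two single
-- variables must differ in absolute value. This decides which i serves each residue of n. When x_1
-- is left out, the edge from the fork to its second branch is spent twice in the triangular part,
-- so the combination must avoid it; hence two consecutive values of i are required.

-- Permanents by expansion over the positions of a list.

private variable
  Elt Elt′ : Set

-- ex k xs = Σ k x (xs without x), over the positions of xs.
ex : (Elt → List Elt → ℤ) → List Elt → ℤ
ex k []       = 0ℤ
ex k (x ∷ xs) = k x xs + ex (λ y ys → k y (x ∷ ys)) xs

ex-cong-All : ∀ {P : Elt → Set} {k k′ : Elt → List Elt → ℤ} →
              (∀ x xs → P x → All P xs → k x xs ≡ k′ x xs) →
              ∀ {xs} → All P xs → ex k xs ≡ ex k′ xs
ex-cong-All h []         = refl
ex-cong-All h (px ∷ pxs) =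
  cong₂ _+_ (h _ _ px pxs) (ex-cong-All (λ y ys py pys → h y _ py (px ∷ pys)) pxs)

ex-cong : {k k′ : Elt → List Elt → ℤ} → (∀ x xs → k x xs ≡ k′ x xs) → ∀ xs → ex k xs ≡ ex k′ xs
ex-cong h []       = refl
ex-cong h (x ∷ xs) = cong₂ _+_ (h x xs) (ex-cong (λ y ys → h y (x ∷ ys)) xs)

ex-0 : ∀ (xs : List Elt) → ex (λ _ _ → 0ℤ) xs ≡ 0ℤ
ex-0 []       = refl
ex-0 (x ∷ xs) = ℤ.+-identityˡ _ ∙ ex-0 xs

ex-+ : ∀ (k k′ : Elt → List Elt → ℤ) xs → ex (λ x ys → k x ys + k′ x ys) xs ≡ ex k xs + ex k′ xs
ex-+ k k′ []       = refl
ex-+ k k′ (x ∷ xs) = cong ((k x xs + k′ x xs) +_) (ex-+ _ _ xs) ∙ lemma (k x xs) (k′ x xs) _ _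
  where
  lemma : ∀ a b c d → a + b + (c + d) ≡ a + c + (b + d)
  lemma = solve-∀

ex-* : ∀ c (k : Elt → List Elt → ℤ) xs → ex (λ x ys → c * k x ys) xs ≡ c * ex k xs
ex-* c k []       = sym (ℤ.*-zeroʳ c)
ex-* c k (x ∷ xs) = cong (c * k x xs +_) (ex-* c _ xs) ∙ sym (ℤ.*-distribˡ-+ c (k x xs) _)

ex-comm : ∀ (k : Elt → List Elt → Elt′ → List Elt′ → ℤ) xs ys →
          ex (λ x xs′ → ex (k x xs′) ys) xs ≡ ex (λ y ys′ → ex (λ x xs′ → k x xs′ y ys′) xs) ys
ex-comm k []       ys = sym (ex-0 ys)
ex-comm k (x ∷ xs) ys =
  cong (ex (k x xs) ys +_) (ex-comm (λ x′ xs′ → k x′ (x ∷ xs′)) xs ys) ∙ sym (ex-+ _ _ ys)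

-- Removing two positions in either order leaves the same list, so only the roles of the two removed
-- entries are exchanged. This is the symmetry of a permanent under swapping two lines.
ex-swap : ∀ (k : Elt → Elt → List Elt → ℤ) xs →
          ex (λ x xs′ → ex (k x) xs′) xs ≡ ex (λ x xs′ → ex (λ y → k y x) xs′) xs
ex-swap k []       = refl
ex-swap k (z ∷ zs) = begin
  ex (k z) zs + ex (λ x xs′ → k x z xs′ + ex (λ y ys → k x y (z ∷ ys)) xs′) zs
    ≡⟨ cong (ex (k z) zs +_) (ex-+ _ _ zs) ⟩
  ex (k z) zs + (ex (λ x → k x z) zs + ex (λ x xs′ → ex (λ y ys → k x y (z ∷ ys)) xs′) zs)
    ≡⟨ cong (λ e → ex (k z) zs + (ex (λ x → k x z) zs + e)) (ex-swap (λ x y ys → k x y (z ∷ ys)) zs) ⟩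
  ex (k z) zs + (ex (λ x → k x z) zs + ex (λ x xs′ → ex (λ y ys → k y x (z ∷ ys)) xs′) zs)
    ≡⟨ lemma (ex (k z) zs) (ex (λ x → k x z) zs) (ex (λ x xs′ → ex (λ y ys → k y x (z ∷ ys)) xs′) zs) ⟩
  ex (λ x → k x z) zs + (ex (k z) zs + ex (λ x xs′ → ex (λ y ys → k y x (z ∷ ys)) xs′) zs)
    ≡⟨ cong (ex (λ x → k x z) zs +_) (sym (ex-+ _ _ zs)) ⟩
  ex (λ x → k x z) zs + ex (λ x xs′ → k z x xs′ + ex (λ y ys → k y x (z ∷ ys)) xs′) zs ∎
  where
  open ≡-Reasoning
  lemma : ∀ a b c → a + (b + c) ≡ b + (a + c)
  lemma = solve-∀

-- Removing any one of the equal entries leaves the same list, so their terms coincide. The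
-- hypothesis covers every remainder `zs` because the remainder grows along the induction.
ex-replicate : ∀ (k : Elt → List Elt → ℤ) n x {ys} → (∀ zs → All (λ y → k y zs ≡ 0ℤ) ys) →
               ex k (replicate (suc n) x ++ ys) ≡ pos (suc n) * k x (replicate n x ++ ys)
ex-replicate k zero x {ys} h =
  cong (k x ys +_) (vanish ys _ (λ zs → h (x ∷ zs))) ∙ lemma (k x ys)
  where
  vanish : ∀ ys (k : _ → List _ → ℤ) → (∀ zs → All (λ y → k y zs ≡ 0ℤ) ys) → ex k ys ≡ 0ℤ
  vanish []       k h = refl
  vanish (y ∷ ys) k h =
    cong₂ _+_ (All.head (h ys)) (vanish ys _ (λ zs → All.tail (h (y ∷ zs))))
  lemma : ∀ a → a + 0ℤ ≡ 1ℤ * a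
  lemma = solve-∀
ex-replicate k (suc n) x {ys} h =
  cong (k x (replicate (suc n) x ++ ys) +_) (ex-replicate _ n x (λ zs → h (x ∷ zs))) ∙
  lemma (k x (replicate (suc n) x ++ ys)) (pos (suc n))
  where
  lemma : ∀ a m → a + m * a ≡ (1ℤ + m) * a
  lemma = solve-∀

-- fe p q = p! if p = q, and 0 otherwise.
fe : ℕ → ℕ → ℤ
fe zero    zero    = 1ℤ
fe zero    (suc q) = 0ℤ
fe (suc p) zero    = 0ℤ
fe (suc p) (suc q) = pos (suc p) * fe p q

-- The permanent of the matrix with rows rs, columns cs and entries a r c;
-- it is 0 when the matrix is not square.
module Permanent {R C : Set} (a : R → C → ℤ) where

  opaque
    per : List R → List C → ℤ
    per []       []      = 1ℤ
    per []       (_ ∷ _) = 0ℤ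
    per (r ∷ rs) cs      = ex (λ c cs′ → a r c * per rs cs′) cs

    per-[] : per [] [] ≡ 1ℤ
    per-[] = refl

    per-row : ∀ r rs cs → per (r ∷ rs) cs ≡ ex (λ c cs′ → a r c * per rs cs′) cs
    per-row r rs cs = refl

    -- `per` expands along rows only; exchanging the two summations gives the expansion along a
    -- column, the source of linearity and symmetry in the columns.
    per-column : ∀ rs c cs → per rs (c ∷ cs) ≡ ex (λ r rs′ → a r c * per rs′ cs) rs
    per-column []       c cs = refl
    per-column (r ∷ rs) c cs = cong (a r c * per rs cs +_) (begin
      ex (λ d ds → a r d * per rs (c ∷ ds)) cs
        ≡⟨ ex-cong (λ d ds → cong (a r d *_) (per-column rs c ds) ∙ sym (ex-* (a r d) _ rs)) cs ⟩
      ex (λ d ds → ex (λ r′ rs′ → a r d * (a r′ c * per rs′ ds)) rs) cs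
        ≡⟨ ex-comm (λ d ds r′ rs′ → a r d * (a r′ c * per rs′ ds)) cs rs ⟩
      ex (λ r′ rs′ → ex (λ d ds → a r d * (a r′ c * per rs′ ds)) cs) rs
        ≡⟨ ex-cong (λ r′ rs′ → ex-cong (λ d ds → lemma (a r d) (a r′ c) (per rs′ ds)) cs ∙ ex-* (a r′ c) _ cs) rs ⟩
      ex (λ r′ rs′ → a r′ c * per (r ∷ rs′) cs) rs ∎)
      where
      open ≡-Reasoning
      lemma : ∀ x y z → x * (y * z) ≡ y * (x * z)
      lemma = solve-∀

    private
      lemma₂ : ∀ (x y z : ℤ) → x * (y * z) ≡ y * (x * z)
      lemma₂ = solve-∀

    per-rows-↭ : ∀ {rs rs′} → rs ↭ rs′ → ∀ cs → per rs cs ≡ per rs′ cs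
    per-rows-↭ refl cs = refl
    per-rows-↭ (prep r p) cs = ex-cong (λ c cs′ → cong (a r c *_) (per-rows-↭ p cs′)) cs
    per-rows-↭ (swap {xs = rs} {ys = rs′} r s p) cs = begin
      ex (λ c cs′ → a r c * ex (λ d ds → a s d * per rs ds) cs′) cs
        ≡⟨ ex-cong (λ c cs′ → sym (ex-* (a r c) _ cs′)) cs ⟩
      ex (λ c cs′ → ex (λ d ds → a r c * (a s d * per rs ds)) cs′) cs
        ≡⟨ ex-swap (λ c d ds → a r c * (a s d * per rs ds)) cs ⟩
      ex (λ c cs′ → ex (λ d ds → a r d * (a s c * per rs ds)) cs′) cs
        ≡⟨ ex-cong (λ c cs′ → ex-cong (λ d ds → lemma₂ (a r d) (a s c) (per rs ds) ∙
             cong (λ v → a s c * (a r d * v)) (per-rows-↭ p ds)) cs′ ∙ ex-* (a s c) _ cs′) cs ⟩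
      ex (λ c cs′ → a s c * ex (λ d ds → a r d * per rs′ ds) cs′) cs ∎
      where open ≡-Reasoning
    per-rows-↭ (trans p q) cs = per-rows-↭ p cs ∙ per-rows-↭ q cs

    per-cols-↭ : ∀ {cs cs′} → cs ↭ cs′ → ∀ rs → per rs cs ≡ per rs cs′
    per-cols-↭ refl rs = refl
    per-cols-↭ (prep {xs = cs} {ys = cs′} c p) rs =
      per-column rs c cs ∙ ex-cong (λ r rs′ → cong (a r c *_) (per-cols-↭ p rs′)) rs ∙ sym (per-column rs c cs′)
    per-cols-↭ (swap {xs = cs} {ys = cs′} c d p) rs = begin
      per rs (c ∷ d ∷ cs)
        ≡⟨ double c d cs ⟩
      ex (λ r rs′ → ex (λ s ss → a r c * (a s d * per ss cs)) rs′) rs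
        ≡⟨ ex-swap (λ r s ss → a r c * (a s d * per ss cs)) rs ⟩
      ex (λ r rs′ → ex (λ s ss → a s c * (a r d * per ss cs)) rs′) rs
        ≡⟨ ex-cong (λ r rs′ → ex-cong (λ s ss → lemma₂ (a s c) (a r d) (per ss cs) ∙
             cong (λ v → a r d * (a s c * v)) (per-cols-↭ p ss)) rs′) rs ⟩
      ex (λ r rs′ → ex (λ s ss → a r d * (a s c * per ss cs′)) rs′) rs
        ≡⟨ sym (double d c cs′) ⟩
      per rs (d ∷ c ∷ cs′) ∎
      where
      open ≡-Reasoning
      double : ∀ c d cs → per rs (c ∷ d ∷ cs) ≡ ex (λ r rs′ → ex (λ s ss → a r c * (a s d * per ss cs)) rs′) rs
      double c d cs = per-column rs c (d ∷ cs) ∙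
        ex-cong (λ r rs′ → cong (a r c *_) (per-column rs′ d cs) ∙ sym (ex-* (a r c) _ rs′)) rs
    per-cols-↭ (trans p q) rs = per-cols-↭ p rs ∙ per-cols-↭ q rs

    per-rows-cong : ∀ {P : C → Set} {rs rs′ cs} → All P cs →
                    Pointwise (λ r r′ → ∀ {c} → P c → a r c ≡ a r′ c) rs rs′ → per rs cs ≡ per rs′ cs
    per-rows-cong h []       = refl
    per-rows-cong h (eq ∷ p) = ex-cong-All (λ c cs pc pcs → cong₂ _*_ (eq pc) (per-rows-cong pcs p)) h

    per-cols-cong : ∀ {cs cs′} → Pointwise (λ c c′ → ∀ r → a r c ≡ a r c′) cs cs′ → ∀ rs → per rs cs ≡ per rs cs′
    per-cols-cong [] rs = refl
    per-cols-cong (_∷_ {x = c} {y = c′} {xs = cs} {ys = cs′} eq p) rs = per-column rs c cs ∙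
      ex-cong (λ r rs′ → cong₂ _*_ (eq r) (per-cols-cong p rs′)) rs ∙ sym (per-column rs c′ cs′)

    per-col-linear : ∀ {c c₁ c₂} m n → (∀ r → a r c ≡ m * a r c₁ + n * a r c₂) → ∀ rs cs →
                     per rs (c ∷ cs) ≡ m * per rs (c₁ ∷ cs) + n * per rs (c₂ ∷ cs)
    per-col-linear {c} {c₁} {c₂} m n h rs cs = begin
      per rs (c ∷ cs)
        ≡⟨ per-column rs c cs ⟩
      ex (λ r rs′ → a r c * per rs′ cs) rs
        ≡⟨ ex-cong (λ r rs′ → cong (_* per rs′ cs) (h r) ∙ lemma m n (a r c₁) (a r c₂) (per rs′ cs)) rs ⟩
      ex (λ r rs′ → m * (a r c₁ * per rs′ cs) + n * (a r c₂ * per rs′ cs)) rs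
        ≡⟨ ex-+ _ _ rs ∙ cong₂ _+_ (ex-* m _ rs) (ex-* n _ rs) ⟩
      m * ex (λ r rs′ → a r c₁ * per rs′ cs) rs + n * ex (λ r rs′ → a r c₂ * per rs′ cs) rs
        ≡⟨ cong₂ (λ x y → m * x + n * y) (sym (per-column rs c₁ cs)) (sym (per-column rs c₂ cs)) ⟩
      m * per rs (c₁ ∷ cs) + n * per rs (c₂ ∷ cs) ∎
      where
      open ≡-Reasoning
      lemma : ∀ m n x y p → (m * x + n * y) * p ≡ m * (x * p) + n * (y * p)
      lemma = solve-∀

    per-row-linear : ∀ {r r₁ r₂} → (∀ c → a r c ≡ a r₁ c - a r₂ c) → ∀ rs cs →
                     per (r ∷ rs) cs ≡ per (r₁ ∷ rs) cs - per (r₂ ∷ rs) cs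
    per-row-linear {r} {r₁} {r₂} h rs cs = begin
      ex (λ c cs′ → a r c * per rs cs′) cs
        ≡⟨ ex-cong (λ c cs′ → cong (_* per rs cs′) (h c) ∙ lemma (a r₁ c) (a r₂ c) (per rs cs′)) cs ⟩
      ex (λ c cs′ → a r₁ c * per rs cs′ + - 1ℤ * (a r₂ c * per rs cs′)) cs
        ≡⟨ ex-+ _ _ cs ∙ cong (per (r₁ ∷ rs) cs +_) (ex-* (- 1ℤ) _ cs ∙ ℤ.-1*i≡-i (per (r₂ ∷ rs) cs)) ⟩
      per (r₁ ∷ rs) cs - per (r₂ ∷ rs) cs ∎
      where
      open ≡-Reasoning
      lemma : ∀ x y p → (x - y) * p ≡ x * p + - 1ℤ * (y * p)
      lemma = solve-∀

    per-zero-row : ∀ r rs {cs} → All (λ c → a r c ≡ 0ℤ) cs → per (r ∷ rs) cs ≡ 0ℤ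
    per-zero-row r rs {cs} h = ex-cong-All (λ c cs′ eq _ → cong (_* per rs cs′) eq) h ∙ ex-0 cs

    per-zero-col : ∀ c cs {rs} → All (λ r → a r c ≡ 0ℤ) rs → per rs (c ∷ cs) ≡ 0ℤ
    per-zero-col c cs {rs} h =
      per-column rs c cs ∙ ex-cong-All (λ r rs′ eq _ → cong (_* per rs′ cs) eq) h ∙ ex-0 rs

    per-corner : ∀ r rs c {cs} → All (λ d → a r d ≡ 0ℤ) cs → per (r ∷ rs) (c ∷ cs) ≡ a r c * per rs cs
    per-corner r rs c {cs} h = cong (a r c * per rs cs +_)
      (ex-cong-All (λ d ds eq _ → cong (_* per rs (c ∷ ds)) eq) h ∙ ex-0 cs) ∙ ℤ.+-identityʳ _

    per-corner₂ : ∀ r s rs c {cs} → All (λ d → a r d ≡ 0ℤ) cs → All (λ d → a s d ≡ 0ℤ) cs →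
                  per (r ∷ s ∷ rs) (c ∷ c ∷ cs) ≡ pos 2 * (a r c * (a s c * per rs cs))
    per-corner₂ r s rs c {cs} hr hs =
      cong₂ _+_ (cong (a r c *_) (per-corner s rs c hs))
        (cong₂ _+_ (cong (a r c *_) (per-corner s rs c hs))
          (ex-cong-All (λ d ds eq _ → cong (_* per (s ∷ rs) (c ∷ c ∷ ds)) eq) hr ∙ ex-0 cs)) ∙
      lemma (a r c * (a s c * per rs cs))
      where
      lemma : ∀ x → x + (x + 0ℤ) ≡ pos 2 * x
      lemma = solve-∀

    -- The copies of `r` and `c` meet only each other, so the matrix is block diagonal. The first
    -- block is all ones, with permanent p! when it is square; otherwise the lines left over are
    -- zero.
    per-block : ∀ p q r c {rs cs} → a r c ≡ 1ℤ → All (λ s → a s c ≡ 0ℤ) rs → All (λ d → a r d ≡ 0ℤ) cs →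
                per (replicate p r ++ rs) (replicate q c ++ cs) ≡ fe p q * per rs cs
    per-block zero    zero    r c rc hr hc = sym (ℤ.*-identityˡ _)
    per-block zero    (suc q) r c rc hr hc = per-zero-col c _ hr
    per-block (suc p) zero    r c {rs} rc hr hc = per-zero-row r (replicate p r ++ rs) hc
    per-block (suc p) (suc q) r c {rs} {cs} rc hr hc = begin
      per (replicate (suc p) r ++ rs) (c ∷ replicate q c ++ cs)
        ≡⟨ per-column (replicate (suc p) r ++ rs) c _ ⟩
      ex (λ s ss → a s c * per ss (replicate q c ++ cs)) (replicate (suc p) r ++ rs)
        ≡⟨ ex-replicate _ p r (λ zs → All.map (λ eq → cong (_* per zs (replicate q c ++ cs)) eq) hr) ⟩
      pos (suc p) * (a r c * per (replicate p r ++ rs) (replicate q c ++ cs))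
        ≡⟨ cong (pos (suc p) *_) (cong₂ _*_ rc (per-block p q r c rc hr hc) ∙ ℤ.*-identityˡ _) ⟩
      pos (suc p) * (fe p q * per rs cs)
        ≡⟨ sym (ℤ.*-assoc (pos (suc p)) (fe p q) _) ⟩
      fe (suc p) (suc q) * per rs cs ∎
      where open ≡-Reasoning

-- Columns as linear forms in the vertex variables, rows as functionals.

Edge : Set
Edge = ℕ × ℕ

-- Columns are linear forms in the vertex variables, given by their coefficients;
-- rows are functionals on them.
Column : Set
Column = ℕ → ℤ

data Row : Set where
  δ : ℕ → Row
  ∂ : Edge → Row

val : Row → Column → ℤ
val (δ x)       f = f x
val (∂ (u , v)) f = f v - f u

open Permanent val public

opaque
  ι : ℕ → Column
  ι x y = ind ⌊ y ℕ.≟ x ⌋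

  ι-refl : ∀ x → ι x x ≡ 1ℤ
  ι-refl x with x ℕ.≟ x
  ... | yes _ = refl
  ... | no ¬p = contradiction refl ¬p

  ι-≢ : ∀ {x y} → y ≢ x → ι x y ≡ 0ℤ
  ι-≢ {x} {y} ne with y ℕ.≟ x
  ... | yes p = contradiction p ne
  ... | no _  = refl

ε : Edge → Column
ε (x , y) w = ι x w + ι y w

val-cong : ∀ r {f g} → (∀ x → f x ≡ g x) → val r f ≡ val r g
val-cong (δ x)       h = h x
val-cong (∂ (u , v)) h = cong₂ _-_ (h v) (h u)

val-linear : ∀ r m n (f g : Column) → val r (λ x → m * f x + n * g x) ≡ m * val r f + n * val r g
val-linear (δ x)       m n f g = refl
val-linear (∂ (u , v)) m n f g = lemma m n (f v) (g v) (f u) (g u)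
  where
  lemma : ∀ m n a b c d → m * a + n * b - (m * c + n * d) ≡ m * (a - c) + n * (b - d)
  lemma = solve-∀

per-combination : ∀ {f g h} m n → (∀ x → f x ≡ m * g x + n * h x) → ∀ rs cs →
                  per rs (f ∷ cs) ≡ m * per rs (g ∷ cs) + n * per rs (h ∷ cs)
per-combination {f} {g} {h} m n eq = per-col-linear m n (λ r → val-cong r eq ∙ val-linear r m n g h)

per-ε : ∀ x y rs cs → per rs (ε (x , y) ∷ cs) ≡ per rs (ι x ∷ cs) + per rs (ι y ∷ cs)
per-ε x y rs cs =
  per-combination {ε (x , y)} {ι x} {ι y} 1ℤ 1ℤ (λ w → sym (cong₂ _+_ (ℤ.*-identityˡ (ι x w)) (ℤ.*-identityˡ (ι y w)))) rs cs ∙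
  cong₂ _+_ (ℤ.*-identityˡ (per rs (ι x ∷ cs))) (ℤ.*-identityˡ (per rs (ι y ∷ cs)))

-- The square of `ι x + ι y`, multiplied out; the two mixed terms agree because the order of columns
-- is irrelevant.
per-εε : ∀ x y q rs cs → per rs (replicate q (ι x) ++ ε (x , y) ∷ ε (x , y) ∷ cs) ≡
         per rs (replicate (2 ℕ.+ q) (ι x) ++ cs) +
         (pos 2 * per rs (replicate (1 ℕ.+ q) (ι x) ++ ι y ∷ cs) + per rs (replicate q (ι x) ++ ι y ∷ ι y ∷ cs))
per-εε x y q rs cs = begin
  per rs (X ++ e ∷ e ∷ cs)
    ≡⟨ per-cols-↭ (trans (shift e X (e ∷ cs)) (prep e (shift e X cs))) rs ⟩
  per rs (e ∷ e ∷ X ++ cs)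
    ≡⟨ per-ε x y rs _ ⟩
  per rs (ι x ∷ e ∷ X ++ cs) + per rs (ι y ∷ e ∷ X ++ cs)
    ≡⟨ cong₂ _+_ (front (ι x)) (front (ι y)) ⟩
  (per rs (ι x ∷ ι x ∷ X ++ cs) + per rs (ι y ∷ ι x ∷ X ++ cs)) + (per rs (ι x ∷ ι y ∷ X ++ cs) + per rs (ι y ∷ ι y ∷ X ++ cs))
    ≡⟨ cong₂ _+_ (cong (per rs (ι x ∷ ι x ∷ X ++ cs) +_) (per-cols-↭ xy rs))
         (cong₂ _+_ (per-cols-↭ (trans (swap _ _ refl) xy) rs) (per-cols-↭ yy rs)) ⟩
  (per rs (ι x ∷ ι x ∷ X ++ cs) + per rs (ι x ∷ X ++ ι y ∷ cs)) + (per rs (ι x ∷ X ++ ι y ∷ cs) + per rs (X ++ ι y ∷ ι y ∷ cs))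
    ≡⟨ lemma (per rs (ι x ∷ ι x ∷ X ++ cs)) (per rs (ι x ∷ X ++ ι y ∷ cs)) (per rs (X ++ ι y ∷ ι y ∷ cs)) ⟩
  per rs (ι x ∷ ι x ∷ X ++ cs) + (pos 2 * per rs (ι x ∷ X ++ ι y ∷ cs) + per rs (X ++ ι y ∷ ι y ∷ cs)) ∎
  where
  open ≡-Reasoning
  e = ε (x , y)
  X = replicate q (ι x)
  front : ∀ f → per rs (f ∷ e ∷ X ++ cs) ≡ per rs (ι x ∷ f ∷ X ++ cs) + per rs (ι y ∷ f ∷ X ++ cs)
  front f = per-cols-↭ (swap f e refl) rs ∙ per-ε x y rs _
  xy : ι y ∷ ι x ∷ X ++ cs ↭ ι x ∷ X ++ ι y ∷ cs
  xy = ↭-sym (shift (ι y) (ι x ∷ X) cs)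
  yy : ι y ∷ ι y ∷ X ++ cs ↭ X ++ ι y ∷ ι y ∷ cs
  yy = ↭-sym (trans (shift (ι y) X (ι y ∷ cs)) (prep (ι y) (shift (ι y) X cs)))
  lemma : ∀ a b c → (a + b) + (b + c) ≡ a + (pos 2 * b + c)
  lemma = solve-∀

per-δ-∂ : ∀ x y p rs cs → per (replicate p (δ x) ++ ∂ (x , y) ∷ rs) cs ≡
          per (replicate p (δ x) ++ δ y ∷ rs) cs - per (replicate (suc p) (δ x) ++ rs) cs
per-δ-∂ x y p rs cs =
  per-rows-↭ (shift (∂ (x , y)) X rs) cs ∙
  per-row-linear {∂ (x , y)} {δ y} {δ x} (λ c → refl) (X ++ rs) cs ∙
  cong (_- per (δ x ∷ X ++ rs) cs) (per-rows-↭ (↭-sym (shift (δ y) X rs)) cs)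
  where X = replicate p (δ x)

-- Elimination along the path of leaves.

-- The permanent of the block of a path of cycle vertices, all of whose edges occur
-- twice as columns, with n_i extra columns ι x_i.  Eliminating the first vertex x₁
-- leaves the same problem for x₂; p and q count the rows δ x₁ and the columns ι x₁.
opaque
  W : ℕ → ℕ → List ℕ → ℤ
  W p q []       = fe (suc p) q
  W p q (n ∷ ns) =
    (fe p (2 ℕ.+ q) * W 2 n ns + (pos 2 * (fe p (1 ℕ.+ q) * W 2 (1 ℕ.+ n) ns) + fe p q * W 2 (2 ℕ.+ n) ns)) -
    (fe (suc p) (2 ℕ.+ q) * W 1 n ns + (pos 2 * (fe (suc p) (1 ℕ.+ q) * W 1 (1 ℕ.+ n) ns) + fe (suc p) q * W 1 (2 ℕ.+ n) ns))

  W-[] : ∀ p q → W p q [] ≡ fe (suc p) q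
  W-[] p q = refl

  W-∷ : ∀ p q n ns → W p q (n ∷ ns) ≡
    (fe p (2 ℕ.+ q) * W 2 n ns + (pos 2 * (fe p (1 ℕ.+ q) * W 2 (1 ℕ.+ n) ns) + fe p q * W 2 (2 ℕ.+ n) ns)) -
    (fe (suc p) (2 ℕ.+ q) * W 1 n ns + (pos 2 * (fe (suc p) (1 ℕ.+ q) * W 1 (1 ℕ.+ n) ns) + fe (suc p) q * W 1 (2 ℕ.+ n) ns))
  W-∷ p q n ns = refl

-- `δ y` is what remains of the tree edge at the leaf `y`, and the closing `δ x` is what remains of
-- the cycle edge that leaves the path at its end.
tailRows : ℕ → List ℕ → List Row
tailRows x []       = δ x ∷ []
tailRows x (y ∷ ys) = ∂ (x , y) ∷ δ y ∷ tailRows y ys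

tailCols : ℕ → List (ℕ × ℕ) → List Column
tailCols x []             = []
tailCols x ((y , n) ∷ ps) = ε (x , y) ∷ ε (x , y) ∷ replicate n (ι y) ++ tailCols y ps

tailRows-vanish : ∀ {x} y ys → All (x ≢_) (y ∷ ys) → All (λ r → val r (ι x) ≡ 0ℤ) (tailRows y ys)
tailRows-vanish y []       (x≢y ∷ _) = ι-≢ (λ eq → x≢y (sym eq)) ∷ []
tailRows-vanish y (z ∷ ys) (x≢y ∷ h@(x≢z ∷ _)) =
  cong₂ _-_ (ι-≢ (λ eq → x≢z (sym eq))) (ι-≢ (λ eq → x≢y (sym eq))) ∷ ι-≢ (λ eq → x≢z (sym eq)) ∷ tailRows-vanish z ys h

tailCols-vanish : ∀ {x} y ps → All (x ≢_) (y ∷ map proj₁ ps) → All (λ f → f x ≡ 0ℤ) (tailCols y ps)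
tailCols-vanish y []             _ = []
tailCols-vanish y ((z , n) ∷ ps) (x≢y ∷ h@(x≢z ∷ _)) =
  cong₂ _+_ (ι-≢ x≢y) (ι-≢ x≢z) ∷ cong₂ _+_ (ι-≢ x≢y) (ι-≢ x≢z) ∷
  All.++⁺ (All.replicate⁺ n (ι-≢ x≢z)) (tailCols-vanish z ps h)

-- Split the row `∂ (x , y)` into `δ y` minus `δ x` and multiply out the two columns `ε (x , y)`. In
-- every term the lines at `x` then form a block of their own, and the remainder starts at `y` with
-- one or two rows in front and up to two additional columns.
per-path : ∀ p q x ps → Unique (x ∷ map proj₁ ps) →
           per (replicate p (δ x) ++ tailRows x (map proj₁ ps)) (replicate q (ι x) ++ tailCols x ps) ≡ W p q (map proj₂ ps)
per-path p q x [] u =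
  per-rows-↭ (trans (shift (δ x) (replicate p (δ x)) []) refl) (replicate q (ι x) ++ []) ∙
  per-block (suc p) q (δ x) (ι x) (ι-refl x) [] [] ∙ cong (fe (suc p) q *_) per-[] ∙ ℤ.*-identityʳ _ ∙ sym (W-[] p q)
per-path p q x ((y , n) ∷ ps) (hx@(x≢y ∷ _) ∷ u) = begin
  per (replicate p (δ x) ++ ∂ (x , y) ∷ R) (replicate q (ι x) ++ ε (x , y) ∷ ε (x , y) ∷ C)
    ≡⟨ per-δ-∂ x y p R (replicate q (ι x) ++ ε (x , y) ∷ ε (x , y) ∷ C) ⟩
  per (replicate p (δ x) ++ δ y ∷ R) (replicate q (ι x) ++ ε (x , y) ∷ ε (x , y) ∷ C) -
  per (replicate (suc p) (δ x) ++ R) (replicate q (ι x) ++ ε (x , y) ∷ ε (x , y) ∷ C)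
    ≡⟨ cong₂ _-_ (side p (δ y ∷ R) (y-vanish ∷ R-vanish)) (side (suc p) R R-vanish) ⟩
  (fe p (2 ℕ.+ q) * per (δ y ∷ R) C + (pos 2 * (fe p (1 ℕ.+ q) * per (δ y ∷ R) (ι y ∷ C)) + fe p q * per (δ y ∷ R) (ι y ∷ ι y ∷ C))) -
  (fe (suc p) (2 ℕ.+ q) * per R C + (pos 2 * (fe (suc p) (1 ℕ.+ q) * per R (ι y ∷ C)) + fe (suc p) q * per R (ι y ∷ ι y ∷ C)))
    ≡⟨ cong₂ _-_ (rest p 2) (rest (suc p) 1) ∙ sym (W-∷ p q n (map proj₂ ps)) ⟩
  W p q (n ∷ map proj₂ ps) ∎
  where
  open ≡-Reasoning
  R = δ y ∷ tailRows y (map proj₁ ps)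
  C = replicate n (ι y) ++ tailCols y ps
  y-vanish : ι x y ≡ 0ℤ
  y-vanish = ι-≢ (λ eq → x≢y (sym eq))
  R-vanish : All (λ r → val r (ι x) ≡ 0ℤ) R
  R-vanish = y-vanish ∷ tailRows-vanish y (map proj₁ ps) hx
  C-vanish : All (λ f → f x ≡ 0ℤ) C
  C-vanish = All.++⁺ (All.replicate⁺ n (ι-≢ x≢y)) (tailCols-vanish y ps hx)
  side : ∀ p′ R′ → All (λ r → val r (ι x) ≡ 0ℤ) R′ →
         per (replicate p′ (δ x) ++ R′) (replicate q (ι x) ++ ε (x , y) ∷ ε (x , y) ∷ C) ≡
         fe p′ (2 ℕ.+ q) * per R′ C + (pos 2 * (fe p′ (1 ℕ.+ q) * per R′ (ι y ∷ C)) + fe p′ q * per R′ (ι y ∷ ι y ∷ C))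
  side p′ R′ h = per-εε x y q (replicate p′ (δ x) ++ R′) C ∙ cong₂ _+_ (block (2 ℕ.+ q) C-vanish)
    (cong₂ _+_ (cong (pos 2 *_) (block (1 ℕ.+ q) (ι-≢ x≢y ∷ C-vanish))) (block q (ι-≢ x≢y ∷ ι-≢ x≢y ∷ C-vanish)))
    where
    block : ∀ q′ {C′} → All (λ f → f x ≡ 0ℤ) C′ →
            per (replicate p′ (δ x) ++ R′) (replicate q′ (ι x) ++ C′) ≡ fe p′ q′ * per R′ C′
    block q′ hc = per-block p′ q′ (δ x) (ι x) (ι-refl x) h hc
  rest : ∀ p′ m → fe p′ (2 ℕ.+ q) * per (replicate m (δ y) ++ tailRows y (map proj₁ ps)) C +
           (pos 2 * (fe p′ (1 ℕ.+ q) * per (replicate m (δ y) ++ tailRows y (map proj₁ ps)) (ι y ∷ C)) + fe p′ q * per (replicate m (δ y) ++ tailRows y (map proj₁ ps)) (ι y ∷ ι y ∷ C)) ≡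
         fe p′ (2 ℕ.+ q) * W m n (map proj₂ ps) +
           (pos 2 * (fe p′ (1 ℕ.+ q) * W m (1 ℕ.+ n) (map proj₂ ps)) + fe p′ q * W m (2 ℕ.+ n) (map proj₂ ps))
  rest p′ m = cong₂ _+_ (cong (fe p′ (2 ℕ.+ q) *_) (per-path m n y ps u))
    (cong₂ _+_ (cong (λ v → pos 2 * (fe p′ (1 ℕ.+ q) * v)) (per-path m (1 ℕ.+ n) y ps u))
               (cong (fe p′ q *_) (per-path m (2 ℕ.+ n) y ps u)))

-- Periodicity of the path block with period six.

-- At most `p + 1` rows are supported at the first vertex, so they cannot absorb more than `p + 1`
-- columns there.
W₁-vanish : ∀ q ns → W 1 (3 ℕ.+ q) ns ≡ 0ℤ
W₁-vanish q []       = W-[] 1 (3 ℕ.+ q)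
W₁-vanish q (n ∷ ns) = W-∷ 1 (3 ℕ.+ q) n ns ∙ lemma (W 2 n ns) (W 2 (1 ℕ.+ n) ns) (W 2 (2 ℕ.+ n) ns) (W 1 n ns) (W 1 (1 ℕ.+ n) ns) (W 1 (2 ℕ.+ n) ns)
  where
  lemma : ∀ a b c d e f → (0ℤ * a + (pos 2 * (0ℤ * b) + 0ℤ * c)) - (0ℤ * d + (pos 2 * (0ℤ * e) + 0ℤ * f)) ≡ 0ℤ
  lemma = solve-∀

W₂-vanish : ∀ q ns → W 2 (4 ℕ.+ q) ns ≡ 0ℤ
W₂-vanish q []       = W-[] 2 (4 ℕ.+ q)
W₂-vanish q (n ∷ ns) = W-∷ 2 (4 ℕ.+ q) n ns ∙ lemma (W 2 n ns) (W 2 (1 ℕ.+ n) ns) (W 2 (2 ℕ.+ n) ns) (W 1 n ns) (W 1 (1 ℕ.+ n) ns) (W 1 (2 ℕ.+ n) ns)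
  where
  lemma : ∀ a b c d e f → (0ℤ * a + (pos 2 * (0ℤ * b) + 0ℤ * c)) - (0ℤ * d + (pos 2 * (0ℤ * e) + 0ℤ * f)) ≡ 0ℤ
  lemma = solve-∀

-- Three columns against three rows, or two against two, use up everything at the first vertex and
-- leave the same remainder; the ratio is 3! / 2!.
W₂₃ : ∀ ns → W 2 3 ns ≡ pos 3 * W 1 2 ns
W₂₃ []       = W-[] 2 3 ∙ sym (cong (pos 3 *_) (W-[] 1 2))
W₂₃ (n ∷ ns) = W-∷ 2 3 n ns ∙ lemma (W 2 n ns) (W 2 (1 ℕ.+ n) ns) (W 2 (2 ℕ.+ n) ns) (W 1 n ns) (W 1 (1 ℕ.+ n) ns) (W 1 (2 ℕ.+ n) ns) ∙ sym (cong (pos 3 *_) (W-∷ 1 2 n ns))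
  where
  lemma : ∀ a b c d e f → (0ℤ * a + (pos 2 * (0ℤ * b) + 0ℤ * c)) - (0ℤ * d + (pos 2 * (0ℤ * e) + pos 6 * f)) ≡
          pos 3 * ((0ℤ * a + (pos 2 * (0ℤ * b) + 0ℤ * c)) - (0ℤ * d + (pos 2 * (0ℤ * e) + pos 2 * f)))
  lemma = solve-∀

module _ (ns : List ℕ) where

  -- A vertex without extra column preserves `p - q`, because in a surviving term rows and columns
  -- match in number at the eliminated vertex. The recursion thus splits into sectors with at most
  -- two independent values each.
  W₁₂ : W 1 2 (0 ∷ ns) ≡ - pos 2 * W 1 2 ns
  W₁₂ = W-∷ 1 2 0 ns ∙ lemma (W 2 0 ns) (W 2 1 ns) (W 2 2 ns) (W 1 0 ns) (W 1 1 ns) (W 1 2 ns)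
    where
    lemma : ∀ a b c d e f → (0ℤ * a + (pos 2 * (0ℤ * b) + 0ℤ * c)) - (0ℤ * d + (pos 2 * (0ℤ * e) + pos 2 * f)) ≡ - pos 2 * f
    lemma = solve-∀

  W₁₁ : W 1 1 (0 ∷ ns) ≡ W 2 2 ns - pos 4 * W 1 1 ns
  W₁₁ = W-∷ 1 1 0 ns ∙ lemma (W 2 0 ns) (W 2 1 ns) (W 2 2 ns) (W 1 0 ns) (W 1 1 ns) (W 1 2 ns)
    where
    lemma : ∀ a b c d e f → (0ℤ * a + (pos 2 * (0ℤ * b) + 1ℤ * c)) - (0ℤ * d + (pos 2 * (pos 2 * e) + 0ℤ * f)) ≡ c - pos 4 * e
    lemma = solve-∀

  W₂₂ : W 2 2 (0 ∷ ns) ≡ pos 2 * W 2 2 ns - pos 12 * W 1 1 ns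
  W₂₂ = W-∷ 2 2 0 ns ∙ lemma (W 2 0 ns) (W 2 1 ns) (W 2 2 ns) (W 1 0 ns) (W 1 1 ns) (W 1 2 ns)
    where
    lemma : ∀ a b c d e f → (0ℤ * a + (pos 2 * (0ℤ * b) + pos 2 * c)) - (0ℤ * d + (pos 2 * (pos 6 * e) + 0ℤ * f)) ≡ pos 2 * c - pos 12 * e
    lemma = solve-∀

  W₁₀ : W 1 0 (0 ∷ ns) ≡ pos 2 * W 2 1 ns - pos 2 * W 1 0 ns
  W₁₀ = W-∷ 1 0 0 ns ∙ lemma (W 2 0 ns) (W 2 1 ns) (W 2 2 ns) (W 1 0 ns) (W 1 1 ns) (W 1 2 ns)
    where
    lemma : ∀ a b c d e f → (0ℤ * a + (pos 2 * (1ℤ * b) + 0ℤ * c)) - (pos 2 * d + (pos 2 * (0ℤ * e) + 0ℤ * f)) ≡ pos 2 * b - pos 2 * d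
    lemma = solve-∀

  W₂₁ : W 2 1 (0 ∷ ns) ≡ pos 4 * W 2 1 ns - pos 6 * W 1 0 ns
  W₂₁ = W-∷ 2 1 0 ns ∙ lemma (W 2 0 ns) (W 2 1 ns) (W 2 2 ns) (W 1 0 ns) (W 1 1 ns) (W 1 2 ns)
    where
    lemma : ∀ a b c d e f → (0ℤ * a + (pos 2 * (pos 2 * b) + 0ℤ * c)) - (pos 6 * d + (pos 2 * (0ℤ * e) + 0ℤ * f)) ≡ pos 4 * b - pos 6 * d
    lemma = solve-∀

  W₂₀ : W 2 0 (0 ∷ ns) ≡ pos 2 * W 2 0 ns
  W₂₀ = W-∷ 2 0 0 ns ∙ lemma (W 2 0 ns) (W 2 1 ns) (W 2 2 ns) (W 1 0 ns) (W 1 1 ns) (W 1 2 ns)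
    where
    lemma : ∀ a b c d e f → (pos 2 * a + (pos 2 * (0ℤ * b) + 0ℤ * c)) - (0ℤ * d + (pos 2 * (0ℤ * e) + 0ℤ * f)) ≡ pos 2 * a
    lemma = solve-∀

0⁶ : List ℕ → List ℕ
0⁶ ns = 0 ∷ 0 ∷ 0 ∷ 0 ∷ 0 ∷ 0 ∷ ns

-- The recursion for `W` continues with `p = 1` and `p = 2` only, so a relation between these two
-- families, for all `q`, survives a common prefix.
Scaled : (ms ns : List ℕ) → Set
Scaled ms ns = ∀ q → W 1 q ms ≡ pos 64 * W 1 q ns × W 2 q ms ≡ pos 64 * W 2 q ns

Scaled-∷ : ∀ {ms ns} n → Scaled ms ns → Scaled (n ∷ ms) (n ∷ ns)
Scaled-∷ {ms} {ns} n h q = side 1 , side 2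
  where
  distr : ∀ u v w x y z (a b c d e f : ℤ) →
          (u * (pos 64 * a) + (pos 2 * (v * (pos 64 * b)) + w * (pos 64 * c))) - (x * (pos 64 * d) + (pos 2 * (y * (pos 64 * e)) + z * (pos 64 * f))) ≡
          pos 64 * ((u * a + (pos 2 * (v * b) + w * c)) - (x * d + (pos 2 * (y * e) + z * f)))
  distr = solve-∀
  side : ∀ p → W p q (n ∷ ms) ≡ pos 64 * W p q (n ∷ ns)
  side p rewrite W-∷ p q n ms | W-∷ p q n ns | proj₁ (h n) | proj₁ (h (1 ℕ.+ n)) | proj₁ (h (2 ℕ.+ n)) | proj₂ (h n) | proj₂ (h (1 ℕ.+ n)) | proj₂ (h (2 ℕ.+ n)) =
    distr (fe p (2 ℕ.+ q)) (fe p (1 ℕ.+ q)) (fe p q) (fe (suc p) (2 ℕ.+ q)) (fe (suc p) (1 ℕ.+ q)) (fe (suc p) q)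
          (W 2 n ns) (W 2 (1 ℕ.+ n) ns) (W 2 (2 ℕ.+ n) ns) (W 1 n ns) (W 1 (1 ℕ.+ n) ns) (W 1 (2 ℕ.+ n) ns)

-- In each sector p - q the transfer matrix M of one step satisfies M³ = ± 8.
module _ {f g : List ℕ → ℤ} where

  -- The step matrix with rows (-4, 1) and (-12, 2) has characteristic polynomial λ² + 2λ + 4, a
  -- divisor of λ³ - 8.
  sector₀ : (∀ ns → f (0 ∷ ns) ≡ g ns - pos 4 * f ns) → (∀ ns → g (0 ∷ ns) ≡ pos 2 * g ns - pos 12 * f ns) →
            ∀ ns → f (0 ∷ 0 ∷ 0 ∷ ns) ≡ pos 8 * f ns × g (0 ∷ 0 ∷ 0 ∷ ns) ≡ pos 8 * g ns
  sector₀ hf hg ns rewrite hf (0 ∷ 0 ∷ ns) | hg (0 ∷ 0 ∷ ns) | hf (0 ∷ ns) | hg (0 ∷ ns) | hf ns | hg ns =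
    lemma₁ (f ns) (g ns) , lemma₂ (f ns) (g ns)
    where
    lemma₁ : ∀ x y → (pos 2 * (pos 2 * y - pos 12 * x) - pos 12 * (y - pos 4 * x)) - pos 4 * ((pos 2 * y - pos 12 * x) - pos 4 * (y - pos 4 * x)) ≡ pos 8 * x
    lemma₁ = solve-∀
    lemma₂ : ∀ x y → pos 2 * (pos 2 * (pos 2 * y - pos 12 * x) - pos 12 * (y - pos 4 * x)) - pos 12 * ((pos 2 * y - pos 12 * x) - pos 4 * (y - pos 4 * x)) ≡ pos 8 * y
    lemma₂ = solve-∀

  -- The step matrix with rows (-2, 2) and (-6, 4) has characteristic polynomial λ² - 2λ + 4, a
  -- divisor of λ³ + 8.
  sector₁ : (∀ ns → f (0 ∷ ns) ≡ pos 2 * g ns - pos 2 * f ns) → (∀ ns → g (0 ∷ ns) ≡ pos 4 * g ns - pos 6 * f ns) →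
            ∀ ns → f (0 ∷ 0 ∷ 0 ∷ ns) ≡ - pos 8 * f ns × g (0 ∷ 0 ∷ 0 ∷ ns) ≡ - pos 8 * g ns
  sector₁ hf hg ns rewrite hf (0 ∷ 0 ∷ ns) | hg (0 ∷ 0 ∷ ns) | hf (0 ∷ ns) | hg (0 ∷ ns) | hf ns | hg ns =
    lemma₁ (f ns) (g ns) , lemma₂ (f ns) (g ns)
    where
    lemma₁ : ∀ x y → pos 2 * (pos 4 * (pos 4 * y - pos 6 * x) - pos 6 * (pos 2 * y - pos 2 * x)) - pos 2 * (pos 2 * (pos 4 * y - pos 6 * x) - pos 2 * (pos 2 * y - pos 2 * x)) ≡ - pos 8 * x
    lemma₁ = solve-∀
    lemma₂ : ∀ x y → pos 4 * (pos 4 * (pos 4 * y - pos 6 * x) - pos 6 * (pos 2 * y - pos 2 * x)) - pos 6 * (pos 2 * (pos 4 * y - pos 6 * x) - pos 2 * (pos 2 * y - pos 2 * x)) ≡ - pos 8 * y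
    lemma₂ = solve-∀

cube : ∀ {f : List ℕ → ℤ} c {d} → c * c * c ≡ d → (∀ ns → f (0 ∷ ns) ≡ c * f ns) → ∀ ns → f (0 ∷ 0 ∷ 0 ∷ ns) ≡ d * f ns
cube {f} c refl h ns rewrite h (0 ∷ 0 ∷ ns) | h (0 ∷ ns) | h ns = lemma c (f ns)
  where
  lemma : ∀ c x → c * (c * (c * x)) ≡ c * c * c * x
  lemma = solve-∀

square : ∀ {f : List ℕ → ℤ} c {d} → c * c ≡ d → (∀ ns → f (0 ∷ 0 ∷ 0 ∷ ns) ≡ c * f ns) → ∀ ns → f (0⁶ ns) ≡ d * f ns
square {f} c refl h ns = h (0 ∷ 0 ∷ 0 ∷ ns) ∙ cong (c *_) (h ns) ∙ sym (ℤ.*-assoc c c (f ns))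

-- The sign of the cube depends on the sector; squaring it removes the sign, so that one factor 64
-- serves all sectors at once.
0⁶-scaled : ∀ ns → Scaled (0⁶ ns) ns
0⁶-scaled ns q = side₁ q , side₂ q
  where
  side₁ : ∀ q → W 1 q (0⁶ ns) ≡ pos 64 * W 1 q ns
  side₁ 0 = square {W 1 0} (- pos 8) {pos 64} refl (λ ns → proj₁ (sector₁ {W 1 0} {W 2 1} W₁₀ W₂₁ ns)) ns
  side₁ 1 = square {W 1 1} (pos 8) {pos 64} refl (λ ns → proj₁ (sector₀ {W 1 1} {W 2 2} W₁₁ W₂₂ ns)) ns
  side₁ 2 = square {W 1 2} (- pos 8) {pos 64} refl (cube {W 1 2} (- pos 2) { - pos 8} refl W₁₂) ns
  side₁ (suc (suc (suc q))) = W₁-vanish q (0⁶ ns) ∙ sym (cong (pos 64 *_) (W₁-vanish q ns))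
  side₂ : ∀ q → W 2 q (0⁶ ns) ≡ pos 64 * W 2 q ns
  side₂ 0 = square {W 2 0} (pos 8) {pos 64} refl (cube {W 2 0} (pos 2) {pos 8} refl W₂₀) ns
  side₂ 1 = square {W 2 1} (- pos 8) {pos 64} refl (λ ns → proj₂ (sector₁ {W 1 0} {W 2 1} W₁₀ W₂₁ ns)) ns
  side₂ 2 = square {W 2 2} (pos 8) {pos 64} refl (λ ns → proj₂ (sector₀ {W 1 1} {W 2 2} W₁₁ W₂₂ ns)) ns
  side₂ 3 = W₂₃ (0⁶ ns) ∙ cong (pos 3 *_) (side₁ 2) ∙ lemma (W 1 2 ns) ∙ cong (pos 64 *_) (sym (W₂₃ ns))
    where
    lemma : ∀ x → pos 3 * (pos 64 * x) ≡ pos 64 * (pos 3 * x)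
    lemma = solve-∀
  side₂ (suc (suc (suc (suc q)))) = W₂-vanish q (0⁶ ns) ∙ sym (cong (pos 64 *_) (W₂-vanish q ns))

bump : ℕ → List ℕ → List ℕ
bump i       []       = []
bump zero    (n ∷ ns) = suc n ∷ ns
bump (suc i) (n ∷ ns) = n ∷ bump i ns

W₀ : List ℕ → ℤ
W₀ []       = 1ℤ
W₀ (n ∷ ns) = W 2 n ns

units : ℕ → ℕ → ℕ → ℕ → List ℕ
units n i j l = bump i (bump j (bump l (replicate n 0)))

-- The value of the path block with extra columns (x₁ + s xₙ)² xᵢ₊₁.
Q : ℕ → ℤ → ℕ → ℤ
Q n s i = (W₀ (units n 0 0 i) + pos 2 * s * W₀ (units n 0 (ℕ.pred n) i)) + s * s * W₀ (units n (ℕ.pred n) (ℕ.pred n) i)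

-- The extra columns sit at the first four vertices or at the last one, so six unmarked vertices can
-- be inserted directly after the fourth.
Q-periodic : ∀ s i m → i ℕ.< 4 → Q (11 ℕ.+ m) s i ≡ pos 64 * Q (5 ℕ.+ m) s i
Q-periodic s i m i<4 = combine (periodic₁ i i<4) (periodic₂ i i<4) (periodic₃ i i<4)
  where
  combine : ∀ {a b c a′ b′ c′} → a ≡ pos 64 * a′ → b ≡ pos 64 * b′ → c ≡ pos 64 * c′ →
            (a + pos 2 * s * b) + s * s * c ≡ pos 64 * ((a′ + pos 2 * s * b′) + s * s * c′)
  combine {a′ = a′} {b′} {c′} refl refl refl = lemma s a′ b′ c′
    where
    lemma : ∀ s a b c → (pos 64 * a + pos 2 * s * (pos 64 * b)) + s * s * (pos 64 * c) ≡ pos 64 * ((a + pos 2 * s * b) + s * s * c)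
    lemma = solve-∀
  -- The part of the path behind the fourth vertex, with `z` extra columns at its end.
  last : ℕ → List ℕ
  last zero    = replicate (suc m) 0
  last (suc z) = bump m (last z)
  start : ∀ a b c d z {ms ns} → ms ≡ a ∷ b ∷ c ∷ d ∷ 0⁶ (last z) → ns ≡ a ∷ b ∷ c ∷ d ∷ last z → W₀ ms ≡ pos 64 * W₀ ns
  start a b c d z refl refl = proj₂ (Scaled-∷ b (Scaled-∷ c (Scaled-∷ d (0⁶-scaled (last z)))) a)
  periodic₁ : ∀ i → i ℕ.< 4 → W₀ (units (11 ℕ.+ m) 0 0 i) ≡ pos 64 * W₀ (units (5 ℕ.+ m) 0 0 i)
  periodic₁ 0 _ = start 3 0 0 0 0 {units (11 ℕ.+ m) 0 0 0} {units (5 ℕ.+ m) 0 0 0} refl refl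
  periodic₁ 1 _ = start 2 1 0 0 0 {units (11 ℕ.+ m) 0 0 1} {units (5 ℕ.+ m) 0 0 1} refl refl
  periodic₁ 2 _ = start 2 0 1 0 0 {units (11 ℕ.+ m) 0 0 2} {units (5 ℕ.+ m) 0 0 2} refl refl
  periodic₁ 3 _ = start 2 0 0 1 0 {units (11 ℕ.+ m) 0 0 3} {units (5 ℕ.+ m) 0 0 3} refl refl
  periodic₁ (suc (suc (suc (suc i)))) (ℕ.s≤s (ℕ.s≤s (ℕ.s≤s (ℕ.s≤s ()))))
  periodic₂ : ∀ i → i ℕ.< 4 → W₀ (units (11 ℕ.+ m) 0 (10 ℕ.+ m) i) ≡ pos 64 * W₀ (units (5 ℕ.+ m) 0 (4 ℕ.+ m) i)
  periodic₂ 0 _ = start 2 0 0 0 1 {units (11 ℕ.+ m) 0 (10 ℕ.+ m) 0} {units (5 ℕ.+ m) 0 (4 ℕ.+ m) 0} refl refl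
  periodic₂ 1 _ = start 1 1 0 0 1 {units (11 ℕ.+ m) 0 (10 ℕ.+ m) 1} {units (5 ℕ.+ m) 0 (4 ℕ.+ m) 1} refl refl
  periodic₂ 2 _ = start 1 0 1 0 1 {units (11 ℕ.+ m) 0 (10 ℕ.+ m) 2} {units (5 ℕ.+ m) 0 (4 ℕ.+ m) 2} refl refl
  periodic₂ 3 _ = start 1 0 0 1 1 {units (11 ℕ.+ m) 0 (10 ℕ.+ m) 3} {units (5 ℕ.+ m) 0 (4 ℕ.+ m) 3} refl refl
  periodic₂ (suc (suc (suc (suc i)))) (ℕ.s≤s (ℕ.s≤s (ℕ.s≤s (ℕ.s≤s ()))))
  periodic₃ : ∀ i → i ℕ.< 4 → W₀ (units (11 ℕ.+ m) (10 ℕ.+ m) (10 ℕ.+ m) i) ≡ pos 64 * W₀ (units (5 ℕ.+ m) (4 ℕ.+ m) (4 ℕ.+ m) i)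
  periodic₃ 0 _ = start 1 0 0 0 2 {units (11 ℕ.+ m) (10 ℕ.+ m) (10 ℕ.+ m) 0} {units (5 ℕ.+ m) (4 ℕ.+ m) (4 ℕ.+ m) 0} refl refl
  periodic₃ 1 _ = start 0 1 0 0 2 {units (11 ℕ.+ m) (10 ℕ.+ m) (10 ℕ.+ m) 1} {units (5 ℕ.+ m) (4 ℕ.+ m) (4 ℕ.+ m) 1} refl refl
  periodic₃ 2 _ = start 0 0 1 0 2 {units (11 ℕ.+ m) (10 ℕ.+ m) (10 ℕ.+ m) 2} {units (5 ℕ.+ m) (4 ℕ.+ m) (4 ℕ.+ m) 2} refl refl
  periodic₃ 3 _ = start 0 0 0 1 2 {units (11 ℕ.+ m) (10 ℕ.+ m) (10 ℕ.+ m) 3} {units (5 ℕ.+ m) (4 ℕ.+ m) (4 ℕ.+ m) 3} refl refl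
  periodic₃ (suc (suc (suc (suc i)))) (ℕ.s≤s (ℕ.s≤s (ℕ.s≤s (ℕ.s≤s ()))))

Q₂ : ℕ → ℤ → ℕ → ℤ → ℤ → ℤ
Q₂ n s i a b = a * Q n s i + b * Q n s (suc i)

Q₂-periodic : ∀ r {s i a b} → suc i ℕ.< 4 → Q₂ (5 ℕ.+ r) s i a b ≢ 0ℤ → ∀ j → Q₂ (5 ℕ.+ (j ℕ.* 6 ℕ.+ r)) s i a b ≢ 0ℤ
Q₂-periodic r i<3 nz zero eq = nz eq
Q₂-periodic r {s} {i} {a} {b} i<3 nz (suc j) eq =
  [ (λ ()) , Q₂-periodic r {s} {i} {a} {b} i<3 nz j ]′ (ℤ.i*j≡0⇒i≡0∨j≡0 (pos 64) (sym (lemma a b (Q (5 ℕ.+ m) s i) (Q (5 ℕ.+ m) s (suc i))) ∙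
    sym (cong₂ (λ u v → a * u + b * v) (Q-periodic s i m (ℕ.<-trans (ℕ.n<1+n i) i<3)) (Q-periodic s (suc i) m i<3)) ∙ eq))
  where
  m = j ℕ.* 6 ℕ.+ r
  lemma : ∀ a b x y → a * (pos 64 * x) + b * (pos 64 * y) ≡ pos 64 * (a * x + b * y)
  lemma = solve-∀

-- Evaluation of the base cases.

infixl 7 _⊛_

-- Multiplication that does not evaluate its second argument when the first one is 0.
_⊛_ : ℤ → ℤ → ℤ
(pos zero)      ⊛ j = 0ℤ
i@(pos (suc _)) ⊛ j = i * j
i@(-[1+ _ ])    ⊛ j = i * j

⊛≡* : ∀ i j → i ⊛ j ≡ i * j
⊛≡* (pos zero)    j = sym (ℤ.*-zeroˡ j)
⊛≡* (pos (suc _)) j = refl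
⊛≡* (-[1+ _ ])    j = refl

-- A transparent copy of the opaque `W` for computing closed instances. Since `fe` vanishes off the
-- diagonal, at most two of the six recursive calls survive and `_⊛_` cuts off the others.
W′ : ℕ → ℕ → List ℕ → ℤ
W′ p q []       = fe (suc p) q
W′ p q (n ∷ ns) =
  (fe p (2 ℕ.+ q) ⊛ W′ 2 n ns + (pos 2 * (fe p (1 ℕ.+ q) ⊛ W′ 2 (1 ℕ.+ n) ns) + fe p q ⊛ W′ 2 (2 ℕ.+ n) ns)) -
  (fe (suc p) (2 ℕ.+ q) ⊛ W′ 1 n ns + (pos 2 * (fe (suc p) (1 ℕ.+ q) ⊛ W′ 1 (1 ℕ.+ n) ns) + fe (suc p) q ⊛ W′ 1 (2 ℕ.+ n) ns))

W≡W′ : ∀ p q ns → W p q ns ≡ W′ p q ns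
W≡W′ p q []       = W-[] p q
W≡W′ p q (n ∷ ns) = W-∷ p q n ns ∙ cong₂ _-_ (side p 2) (side (suc p) 1)
  where
  term : ∀ c m n → c * W m n ns ≡ c ⊛ W′ m n ns
  term c m n = cong (c *_) (W≡W′ m n ns) ∙ sym (⊛≡* c (W′ m n ns))
  side : ∀ p′ m → fe p′ (2 ℕ.+ q) * W m n ns + (pos 2 * (fe p′ (1 ℕ.+ q) * W m (1 ℕ.+ n) ns) + fe p′ q * W m (2 ℕ.+ n) ns) ≡
                  fe p′ (2 ℕ.+ q) ⊛ W′ m n ns + (pos 2 * (fe p′ (1 ℕ.+ q) ⊛ W′ m (1 ℕ.+ n) ns) + fe p′ q ⊛ W′ m (2 ℕ.+ n) ns)
  side p′ m = cong₂ _+_ (term (fe p′ (2 ℕ.+ q)) m n)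
    (cong₂ _+_ (cong (pos 2 *_) (term (fe p′ (1 ℕ.+ q)) m (1 ℕ.+ n))) (term (fe p′ q) m (2 ℕ.+ n)))

W₀′ : List ℕ → ℤ
W₀′ []       = 1ℤ
W₀′ (n ∷ ns) = W′ 2 n ns

W₀≡W₀′ : ∀ ns → W₀ ns ≡ W₀′ ns
W₀≡W₀′ []       = refl
W₀≡W₀′ (n ∷ ns) = W≡W′ 2 n ns

Q′ : ℕ → ℤ → ℕ → ℤ
Q′ n s i = (W₀′ (units n 0 0 i) + pos 2 * s * W₀′ (units n 0 (ℕ.pred n) i)) + s * s * W₀′ (units n (ℕ.pred n) (ℕ.pred n) i)

Q≡Q′ : ∀ n s i → Q n s i ≡ Q′ n s i
Q≡Q′ n s i = cong₂ _+_ (cong₂ _+_ (W₀≡W₀′ (units n 0 0 i)) (cong (pos 2 * s *_) (W₀≡W₀′ (units n 0 (ℕ.pred n) i))))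
                       (cong (s * s *_) (W₀≡W₀′ (units n (ℕ.pred n) (ℕ.pred n) i)))

sgn : Bool → ℤ
sgn true  = 1ℤ
sgn false = - 1ℤ

-- The value of the path block with extra columns (x₁ + s xₙ)² (± xᵢ₊₁ ∓ xᵢ₊₂).
Block : ℕ → ℤ → ℕ → Bool → Bool → ℤ
Block n s i c c′ = Q₂ n s i (sgn c) (- sgn c′)

Block-periodic : ∀ r s i c c′ → suc i ℕ.< 4 → Block (5 ℕ.+ r) s i c c′ ≢ 0ℤ → ∀ j → Block (5 ℕ.+ (j ℕ.* 6 ℕ.+ r)) s i c c′ ≢ 0ℤ
Block-periodic r s i c c′ i<3 = Q₂-periodic r {s} {i} {sgn c} { - sgn c′} i<3

Block-value : ∀ n s i c c′ {u v} → Q′ n s i ≡ u → Q′ n s (suc i) ≡ v → Block n s i c c′ ≡ sgn c * u + - sgn c′ * v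
Block-value n s i c c′ hu hv = cong₂ (λ u v → sgn c * u + - sgn c′ * v) (Q≡Q′ n s i ∙ hu) (Q≡Q′ n s (suc i) ∙ hv)

-- The colours enter only through two signs, so two evaluations of `Q′` settle all four cases.
nonzero : ∀ n s i {u v} → Q′ n s i ≡ u → Q′ n s (suc i) ≡ v → (∀ c c′ → sgn c * u + - sgn c′ * v ≢ 0ℤ) →
          ∀ c c′ → Block n s i c c′ ≢ 0ℤ
nonzero n s i hu hv nz c c′ eq = nz c c′ (sym (Block-value n s i c c′ hu hv) ∙ eq)

block-minus-3-1 : ∀ c c′ → Block 3 (- 1ℤ) 1 c c′ ≢ 0ℤ
block-minus-3-1 = nonzero 3 (- 1ℤ) 1 refl refl λ { true true () ; true false () ; false true () ; false false () }

block-minus-4-0 : ∀ c c′ → Block 4 (- 1ℤ) 0 c c′ ≢ 0ℤ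
block-minus-4-0 = nonzero 4 (- 1ℤ) 0 refl refl λ { true true () ; true false () ; false true () ; false false () }

block-minus-5-1 : ∀ c c′ → Block 5 (- 1ℤ) 1 c c′ ≢ 0ℤ
block-minus-5-1 = nonzero 5 (- 1ℤ) 1 refl refl λ { true true () ; true false () ; false true () ; false false () }

block-minus-8-1 : ∀ c c′ → Block 8 (- 1ℤ) 1 c c′ ≢ 0ℤ
block-minus-8-1 = nonzero 8 (- 1ℤ) 1 refl refl λ { true true () ; true false () ; false true () ; false false () }

block-minus-9-1 : ∀ c c′ → Block 9 (- 1ℤ) 1 c c′ ≢ 0ℤ
block-minus-9-1 = nonzero 9 (- 1ℤ) 1 refl refl λ { true true () ; true false () ; false true () ; false false () }

block-minus-10-0 : ∀ c c′ → Block 10 (- 1ℤ) 0 c c′ ≢ 0ℤ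
block-minus-10-0 = nonzero 10 (- 1ℤ) 0 refl refl λ { true true () ; true false () ; false true () ; false false () }

-- For `s = 1` each length comes with two consecutive indices, because one of the two corresponding
-- pairs of leaves may be separated by the end of the second branch at the fork.
block-plus-5-1 : ∀ c c′ → Block 5 1ℤ 1 c c′ ≢ 0ℤ
block-plus-5-1 = nonzero 5 1ℤ 1 refl refl λ { true true () ; true false () ; false true () ; false false () }

block-plus-5-2 : ∀ c c′ → Block 5 1ℤ 2 c c′ ≢ 0ℤ
block-plus-5-2 = nonzero 5 1ℤ 2 refl refl λ { true true () ; true false () ; false true () ; false false () }

block-plus-6-0 : ∀ c c′ → Block 6 1ℤ 0 c c′ ≢ 0ℤ
block-plus-6-0 = nonzero 6 1ℤ 0 refl refl λ { true true () ; true false () ; false true () ; false false () }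

block-plus-6-1 : ∀ c c′ → Block 6 1ℤ 1 c c′ ≢ 0ℤ
block-plus-6-1 = nonzero 6 1ℤ 1 refl refl λ { true true () ; true false () ; false true () ; false false () }

-- The two values of `Q′` are 24 and -24, so distinct colours would make the block vanish; this is
-- why three leaves need a special choice of root.
block-minus-2-0 : ∀ c → Block 2 (- 1ℤ) 0 c c ≢ 0ℤ
block-minus-2-0 c eq = contra c (sym (Block-value 2 (- 1ℤ) 0 c c refl refl) ∙ eq)
  where
  contra : ∀ c → sgn c * Q′ 2 (- 1ℤ) 0 + - sgn c * Q′ 2 (- 1ℤ) 1 ≢ 0ℤ
  contra true  ()
  contra false ()

cols : List (ℕ × ℕ) → List Column
cols []             = []
cols ((x , n) ∷ ps) = replicate n (ι x) ++ tailCols x ps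

pathRows : List ℕ → List Row
pathRows []       = []
pathRows (x ∷ xs) = δ x ∷ δ x ∷ tailRows x xs

per-cols : ∀ ps → Unique (map proj₁ ps) → per (pathRows (map proj₁ ps)) (cols ps) ≡ W₀ (map proj₂ ps)
per-cols []             u = per-[]
per-cols ((x , n) ∷ ps) u = per-path 2 n x ps u

data At : ℕ → ℕ → List ℕ → Set where
  here  : ∀ {x xs} → At 0 x (x ∷ xs)
  there : ∀ {i x y xs} → At i x xs → At (suc i) x (y ∷ xs)

At-last : ∀ x xs → At (length xs) (lastOr x xs) (x ∷ xs)
At-last x []       = here
At-last x (y ∷ xs) = there (At-last y xs)

bump′ : ℕ → List (ℕ × ℕ) → List (ℕ × ℕ)
bump′ i       []             = []
bump′ zero    ((x , n) ∷ ps) = (x , suc n) ∷ ps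
bump′ (suc i) (p ∷ ps)       = p ∷ bump′ i ps

labels-bump′ : ∀ i ps → map proj₁ (bump′ i ps) ≡ map proj₁ ps
labels-bump′ i       []       = refl
labels-bump′ zero    (p ∷ ps) = refl
labels-bump′ (suc i) (p ∷ ps) = cong (proj₁ p ∷_) (labels-bump′ i ps)

counts-bump′ : ∀ i ps → map proj₂ (bump′ i ps) ≡ bump i (map proj₂ ps)
counts-bump′ i       []       = refl
counts-bump′ zero    (p ∷ ps) = refl
counts-bump′ (suc i) (p ∷ ps) = cong (proj₂ p ∷_) (counts-bump′ i ps)

cols-bump′ : ∀ {i y} ps → At i y (map proj₁ ps) → ι y ∷ cols ps ↭ cols (bump′ i ps)
cols-bump′ ((x , n) ∷ ps) here = refl
cols-bump′ {y = y} ((x , n) ∷ (z , m) ∷ ps) (there at) =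
  trans (↭-sym (shift (ι y) (replicate n (ι x)) _)) (++⁺ˡ (replicate n (ι x))
    (trans (swap _ _ (refl)) (trans (prep _ (swap _ _ refl)) (tail at))))
  where
  tail : ∀ {i y} → At i y (z ∷ map proj₁ ps) →
         ε (x , z) ∷ ε (x , z) ∷ ι y ∷ cols ((z , m) ∷ ps) ↭ tailCols x (bump′ i ((z , m) ∷ ps))
  tail here       = prep _ (prep _ (cols-bump′ ((z , m) ∷ ps) here))
  tail (there at) = prep _ (prep _ (cols-bump′ ((z , m) ∷ ps) (there at)))

cols-bumps : ∀ {i j l u v w} ps → At i u (map proj₁ ps) → At j v (map proj₁ ps) → At l w (map proj₁ ps) →
             ι u ∷ ι v ∷ ι w ∷ cols ps ↭ cols (bump′ i (bump′ j (bump′ l ps)))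
cols-bumps {i} {j} {l} ps atu atv atw =
  trans (prep _ (prep _ (cols-bump′ ps atw)))
  (trans (prep _ (cols-bump′ (bump′ l ps) (subst (At j _) (sym (labels-bump′ l ps)) atv)))
         (cols-bump′ (bump′ j (bump′ l ps)) (subst (At i _) (sym (labels-bump′ j _ ∙ labels-bump′ l ps)) atu)))

unmarked : List ℕ → List (ℕ × ℕ)
unmarked = map (_, 0)

labels-unmarked : ∀ xs → map proj₁ (unmarked xs) ≡ xs
labels-unmarked []       = refl
labels-unmarked (x ∷ xs) = cong (x ∷_) (labels-unmarked xs)

counts-unmarked : ∀ xs → map proj₂ (unmarked xs) ≡ replicate (length xs) 0
counts-unmarked []       = refl
counts-unmarked (x ∷ xs) = cong (0 ∷_) (counts-unmarked xs)

per-units : ∀ {i j l u v w} xs → Unique xs → At i u xs → At j v xs → At l w xs →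
            per (pathRows xs) (ι u ∷ ι v ∷ ι w ∷ cols (unmarked xs)) ≡ W₀ (units (length xs) i j l)
per-units {i} {j} {l} xs uq atu atv atw = begin
  per (pathRows xs) _
    ≡⟨ per-cols-↭ (cols-bumps (unmarked xs) (lift atu) (lift atv) (lift atw)) (pathRows xs) ⟩
  per (pathRows xs) (cols ps)
    ≡⟨ cong (λ ys → per (pathRows ys) (cols ps)) (sym labels) ⟩
  per (pathRows (map proj₁ ps)) (cols ps)
    ≡⟨ per-cols ps (subst Unique (sym labels) uq) ⟩
  W₀ (map proj₂ ps)
    ≡⟨ cong W₀ (counts-bump′ i _ ∙ cong (bump i) (counts-bump′ j _ ∙ cong (bump j) (counts-bump′ l _ ∙ cong (bump l) (counts-unmarked xs)))) ⟩
  W₀ (units (length xs) i j l) ∎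
  where
  open ≡-Reasoning
  ps = bump′ i (bump′ j (bump′ l (unmarked xs)))
  labels : map proj₁ ps ≡ xs
  labels = labels-bump′ i _ ∙ labels-bump′ j _ ∙ labels-bump′ l _ ∙ labels-unmarked xs
  lift : ∀ {i u} → At i u xs → At i u (map proj₁ (unmarked xs))
  lift = subst (At _ _) (sym (labels-unmarked xs))

-- Linearity in the three combined columns turns each of them into extra columns at single vertices;
-- in the square of `f` the two mixed terms agree.
per-closed-path : ∀ {i u v} x xs s a b (f g : Column) → Unique (x ∷ xs) →
                  At i u (x ∷ xs) → At (suc i) v (x ∷ xs) →
                  (∀ z → f z ≡ 1ℤ * ι x z + s * ι (lastOr x xs) z) → (∀ z → g z ≡ a * ι u z + b * ι v z) →
                  per (pathRows (x ∷ xs)) (f ∷ f ∷ g ∷ cols (unmarked (x ∷ xs))) ≡ Q₂ (suc (length xs)) s i a b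
per-closed-path {i} {u} {v} x xs s a b f g uq atu atv hf hg = begin
  per R (f ∷ f ∷ g ∷ E)
    ≡⟨ per-cols-↭ (trans (swap f f refl) (trans (prep f (swap f g refl)) (swap f g refl))) R ⟩
  per R (g ∷ f ∷ f ∷ E)
    ≡⟨ per-combination a b hg R _ ⟩
  a * per R (ι u ∷ f ∷ f ∷ E) + b * per R (ι v ∷ f ∷ f ∷ E)
    ≡⟨ cong₂ (λ p q → a * p + b * q) (expand atu) (expand atv) ⟩
  Q₂ n s i a b ∎
  where
  open ≡-Reasoning
  n = suc (length xs)
  R = pathRows (x ∷ xs)
  E = cols (unmarked (x ∷ xs))
  l = lastOr x xs
  atl = At-last x xs
  collect : ∀ s p q r → (1ℤ * (1ℤ * p + s * q) + s * (1ℤ * q + s * r)) ≡ (p + pos 2 * s * q) + s * s * r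
  collect = solve-∀
  expand : ∀ {i w} → At i w (x ∷ xs) → per R (ι w ∷ f ∷ f ∷ E) ≡ Q n s i
  expand {i} {w} at = begin
    per R (ι w ∷ f ∷ f ∷ E)
      ≡⟨ per-cols-↭ (swap (ι w) f refl) R ⟩
    per R (f ∷ ι w ∷ f ∷ E)
      ≡⟨ per-combination 1ℤ s hf R _ ⟩
    1ℤ * per R (ι x ∷ ι w ∷ f ∷ E) + s * per R (ι l ∷ ι w ∷ f ∷ E)
      ≡⟨ cong₂ (λ p q → 1ℤ * p + s * q) (second x) (second l) ⟩
    1ℤ * (1ℤ * per R (ι x ∷ ι x ∷ ι w ∷ E) + s * per R (ι l ∷ ι x ∷ ι w ∷ E)) +
    s * (1ℤ * per R (ι x ∷ ι l ∷ ι w ∷ E) + s * per R (ι l ∷ ι l ∷ ι w ∷ E))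
      ≡⟨ cong₂ (λ p q → 1ℤ * p + s * q)
           (cong₂ (λ p q → 1ℤ * p + s * q) (per-units (x ∷ xs) uq here here at)
             (per-cols-↭ (swap (ι l) (ι x) refl) R ∙ per-units (x ∷ xs) uq here atl at))
           (cong₂ (λ p q → 1ℤ * p + s * q) (per-units (x ∷ xs) uq here atl at) (per-units (x ∷ xs) uq atl atl at)) ⟩
    1ℤ * (1ℤ * W₀ (units n 0 0 i) + s * W₀ (units n 0 (length xs) i)) +
    s * (1ℤ * W₀ (units n 0 (length xs) i) + s * W₀ (units n (length xs) (length xs) i))
      ≡⟨ collect s (W₀ (units n 0 0 i)) (W₀ (units n 0 (length xs) i)) (W₀ (units n (length xs) (length xs) i)) ⟩
    Q n s i ∎
    where
    second : ∀ y → per R (ι y ∷ ι w ∷ f ∷ E) ≡ 1ℤ * per R (ι x ∷ ι y ∷ ι w ∷ E) + s * per R (ι l ∷ ι y ∷ ι w ∷ E)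
    second y = per-cols-↭ (trans (prep (ι y) (swap (ι w) f refl)) (swap (ι y) f refl)) R ∙ per-combination 1ℤ s hf R _

∂-δ : ∀ {u v} (f : Column) → f u ≡ 0ℤ → val (∂ (u , v)) f ≡ val (δ v) f
∂-δ {v = v} f fu = cong (λ z → f v - z) fu ∙ ℤ.+-identityʳ (f v)

module _ {u w y : ℕ} {ys : List ℕ} {leaf : List Edge} (leaves : map proj₂ leaf ≡ y ∷ ys) where

  Avoids : Column → Set
  Avoids f = f u ≡ 0ℤ × f w ≡ 0ℤ × All (λ e → f (proj₁ e) ≡ 0ℤ) leaf

  -- On a column that vanishes at the first end of an edge, the row of the edge is evaluation at its
  -- second end. Leaf edges and the two cycle edges leaving the path therefore act as `δ` rows.
  per-avoiding : ∀ {cs} → All Avoids cs →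
                 per (map ∂ (leaf ++ (u , y) ∷ pathEdges (y ∷ ys) ++ (w , lastOr y ys) ∷ [])) cs ≡ per (pathRows (y ∷ ys)) cs
  per-avoiding {cs} h = begin
    per (map ∂ (leaf ++ (u , y) ∷ pathEdges (y ∷ ys) ++ (w , lastOr y ys) ∷ [])) cs
      ≡⟨ cong (λ rs → per rs cs) (List.map-++ ∂ leaf _ ∙ cong (λ rs → map ∂ leaf ++ ∂ (u , y) ∷ rs) (List.map-++ ∂ (pathEdges (y ∷ ys)) _)) ⟩
    per (map ∂ leaf ++ ∂ (u , y) ∷ map ∂ (pathEdges (y ∷ ys)) ++ ∂ (w , lastOr y ys) ∷ []) cs
      ≡⟨ per-rows-cong h (Pointwise.++⁺ (pointwise leaf (λ av → proj₂ (proj₂ av)))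
           ((λ {f} av → ∂-δ f (proj₁ av)) ∷ Pointwise.++⁺ (Pointwise.refl (λ {_} {_} _ → refl)) ((λ {f} av → ∂-δ f (proj₁ (proj₂ av))) ∷ []))) ⟩
    per (map δ (map proj₂ leaf) ++ δ y ∷ map ∂ (pathEdges (y ∷ ys)) ++ δ (lastOr y ys) ∷ []) cs
      ≡⟨ cong (λ xs → per (map δ xs ++ δ y ∷ map ∂ (pathEdges (y ∷ ys)) ++ δ (lastOr y ys) ∷ []) cs) leaves ⟩
    per (δ y ∷ map δ ys ++ δ y ∷ map ∂ (pathEdges (y ∷ ys)) ++ δ (lastOr y ys) ∷ []) cs
      ≡⟨ per-rows-↭ (prep (δ y) (trans (shift (δ y) (map δ ys) _) (prep (δ y) (interleave y ys)))) cs ⟩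
    per (pathRows (y ∷ ys)) cs ∎
    where
    open ≡-Reasoning
    pointwise : ∀ es → (∀ {f} → Avoids f → All (λ e → f (proj₁ e) ≡ 0ℤ) es) →
                Pointwise (λ r r′ → ∀ {f} → Avoids f → val r f ≡ val r′ f) (map ∂ es) (map δ (map proj₂ es))
    pointwise []       h = []
    pointwise (e ∷ es) h = (λ {f} av → ∂-δ f (All.head (h av))) ∷ pointwise es (λ av → All.tail (h av))
    interleave : ∀ y ys → map δ ys ++ map ∂ (pathEdges (y ∷ ys)) ++ δ (lastOr y ys) ∷ [] ↭ tailRows y ys
    interleave y []       = refl
    interleave y (z ∷ zs) = trans (prep (δ z) (shift (∂ (y , z)) (map δ zs) _))
      (trans (swap (δ z) (∂ (y , z)) refl) (prep (∂ (y , z)) (prep (δ z) (interleave z zs))))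

-- Splitting off a triangular part.

_Kills_ : Row → List Column → Set
r Kills cs = All (λ f → val r f ≡ 0ℤ) cs

-- Expansion goes along rows: a row meets its own column and no later one. `double` is for an edge
-- column that is spent on two rows at once, as happens at the fork.
data Triangular : List Row → List Column → Set where
  []     : Triangular [] []
  single : ∀ {r c rs cs} → val r c ≢ 0ℤ → r Kills cs → Triangular rs cs → Triangular (r ∷ rs) (c ∷ cs)
  double : ∀ {r s c rs cs} → val r c ≢ 0ℤ → val s c ≢ 0ℤ → r Kills cs → s Kills cs →
           Triangular rs cs → Triangular (r ∷ s ∷ rs) (c ∷ c ∷ cs)

Triangular-cong : ∀ {rs rs′ cs cs′} → rs ≡ rs′ → cs ≡ cs′ → Triangular rs cs → Triangular rs′ cs′
Triangular-cong refl refl t = t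

Triangular-++ : ∀ {rs rs′ cs cs′} → Triangular rs cs → All (_Kills cs′) rs → Triangular rs′ cs′ →
                Triangular (rs ++ rs′) (cs ++ cs′)
Triangular-++ [] _ t′ = t′
Triangular-++ (single nz k t) (k′ ∷ ks) t′ = single nz (All.++⁺ k k′) (Triangular-++ t ks t′)
Triangular-++ (double nr ns kr ks t) (kr′ ∷ ks′ ∷ hs) t′ =
  double nr ns (All.++⁺ kr kr′) (All.++⁺ ks ks′) (Triangular-++ t hs t′)

*-≢0 : ∀ {i j} → i ≢ 0ℤ → j ≢ 0ℤ → i * j ≢ 0ℤ
*-≢0 {i} hi hj eq with ℤ.i*j≡0⇒i≡0∨j≡0 i eq
... | inj₁ e = hi e
... | inj₂ e = hj e

per-triangular : ∀ {rs rs′ cs cs′} → Triangular rs cs → All (_Kills cs′) rs → per rs′ cs′ ≢ 0ℤ →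
                 per (rs ++ rs′) (cs ++ cs′) ≢ 0ℤ
per-triangular [] _ nz = nz
per-triangular (single {r} {c} {rs} {cs} nrc k t) (k′ ∷ ks) nz eq =
  *-≢0 nrc (per-triangular t ks nz) (sym (per-corner r _ c (All.++⁺ k k′)) ∙ eq)
per-triangular (double {r} {s} {c} nrc nsc kr ks t) (kr′ ∷ ks′ ∷ hs) nz eq =
  *-≢0 {pos 2} (λ ()) (*-≢0 nrc (*-≢0 nsc (per-triangular t hs nz)))
    (sym (per-corner₂ r s _ c (All.++⁺ kr kr′) (All.++⁺ ks ks′)) ∙ eq)

-- Combinations of edge columns and multilinear selection.

Form : Set
Form = List (ℤ × Edge)

eval : Form → Column
eval []            x = 0ℤ
eval ((c , e) ∷ F) x = c * ε e x + eval F x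

support : Form → List Edge
support = map proj₂

infix 4 _⊑_

-- Inclusion of multisets: for `H` without repetition, `⊑ H ++ H` says that no edge is used more
-- than twice.
_⊑_ : {A : Set} → List A → List A → Set
xs ⊑ ys = ∃ λ zs → xs ++ zs ↭ ys

module _ {A : Set} where

  ⊑-↭ : {xs ys zs : List A} → xs ⊑ ys → ys ↭ zs → xs ⊑ zs
  ⊑-↭ (r , p) q = r , trans p q

  ↭-⊑ : {xs ys zs : List A} → xs ↭ ys → ys ⊑ zs → xs ⊑ zs
  ↭-⊑ q (r , p) = r , trans (++⁺ʳ r q) p

  ⊑-trans : {xs ys zs : List A} → xs ⊑ ys → ys ⊑ zs → xs ⊑ zs
  ⊑-trans {xs} (r , p) (s , q) = r ++ s , trans (↭-reflexive (sym (List.++-assoc xs r s))) (trans (++⁺ʳ s p) q)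

  ⊑-refl : {xs : List A} → xs ⊑ xs
  ⊑-refl {xs} = [] , ↭-reflexive (List.++-identityʳ xs)

  []⊑ : {xs : List A} → [] ⊑ xs
  []⊑ {xs} = xs , refl

  ⊑-++ : {xs ys xs′ ys′ : List A} → xs ⊑ ys → xs′ ⊑ ys′ → xs ++ xs′ ⊑ ys ++ ys′
  ⊑-++ {xs} {ys} {xs′} {ys′} (r , p) (s , q) = r ++ s , (begin
    (xs ++ xs′) ++ r ++ s ≡⟨ List.++-assoc xs xs′ (r ++ s) ⟩
    xs ++ xs′ ++ r ++ s   ↭⟨ ++⁺ˡ xs (shifts xs′ r) ⟩
    xs ++ r ++ xs′ ++ s   ≡⟨ sym (List.++-assoc xs r (xs′ ++ s)) ⟩
    (xs ++ r) ++ xs′ ++ s ↭⟨ ++⁺ p q ⟩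
    ys ++ ys′ ∎)
    where open PermutationReasoning

  ∈-⊑ : {x : A} {xs : List A} → x ∈ xs → x ∷ [] ⊑ xs
  ∈-⊑ {xs = x ∷ xs} (here refl) = xs , refl
  ∈-⊑ {x} {y ∷ xs} (there m) with r , p ← ∈-⊑ m = y ∷ r , trans (swap x y refl) (prep y p)

per-eval : ∀ F rs cs → per rs (eval F ∷ cs) ≢ 0ℤ → ∃ λ e → e ∈ support F × per rs (ε e ∷ cs) ≢ 0ℤ
per-eval [] rs cs nz = contradiction (per-zero-col (eval []) cs (All.universal zero-val rs)) nz
  where
  zero-val : ∀ r → val r (eval []) ≡ 0ℤ
  zero-val (δ x) = refl
  zero-val (∂ e) = refl
per-eval ((c , e) ∷ F) rs cs nz with per rs (ε e ∷ cs) ℤ.≟ 0ℤ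
... | no  nz′ = e , here refl , nz′
... | yes z with per-eval F rs cs (λ z′ → nz (
        per-combination {eval ((c , e) ∷ F)} {ε e} {eval F} c 1ℤ (λ x → cong (c * ε e x +_) (sym (ℤ.*-identityˡ (eval F x)))) rs cs ∙
        cong₂ (λ i j → c * i + 1ℤ * j) z z′ ∙ cong (_+ 0ℤ) (ℤ.*-zeroʳ c)))
...   | e′ , m , nz′ = e′ , there m , nz′

-- Supports are counted with repetition over all columns, so whichever term multilinearity selects,
-- one edge per column, respects the bound of two.
Certificate : List Edge → Set
Certificate H = ∃ λ Fs → per (map ∂ H) (map eval Fs) ≢ 0ℤ × concatMap support Fs ⊑ H ++ H

-- By multilinearity some term of the expansion of the columns is nonzero.
select-from : ∀ rs Fs es → per rs (map eval Fs ++ map ε es) ≢ 0ℤ →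
              ∃ λ es′ → per rs (map ε es′) ≢ 0ℤ × es′ ⊑ concatMap support Fs ++ es
select-from rs []       es nz = es , nz , ⊑-refl
select-from rs (F ∷ Fs) es nz with e , m , nz₁ ← per-eval F rs _ nz
  with es′ , nz₂ , sub ← select-from rs Fs (e ∷ es)
         (λ z → nz₁ (per-cols-↭ (↭-sym (shift (ε e) (map eval Fs) (map ε es))) rs ∙ z)) =
  es′ , nz₂ , ⊑-trans sub (↭-⊑ (shift e (concatMap support Fs) es)
    (⊑-↭ (⊑-++ (∈-⊑ m) (⊑-refl {xs = concatMap support Fs ++ es})) (↭-reflexive (sym (List.++-assoc (support F) _ es)))))

select : ∀ {H} → Certificate H → ∃ λ es → per (map ∂ H) (map ε es) ≢ 0ℤ × es ⊑ H ++ H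
select {H} (Fs , nz , sub)
  with es , nz′ , sub′ ← select-from (map ∂ H) Fs [] (subst (λ cs → per (map ∂ H) cs ≢ 0ℤ) (sym (List.++-identityʳ _)) nz) =
  es , nz′ , ⊑-trans sub′ (↭-⊑ (↭-reflexive (List.++-identityʳ _)) sub)

-- Edges, leaves and labels of a tree in preorder.

↭-interchange : ∀ {A : Set} (ws xs ys zs : List A) → (ws ++ xs) ++ ys ++ zs ↭ (ws ++ ys) ++ xs ++ zs
↭-interchange ws xs ys zs = begin
  (ws ++ xs) ++ ys ++ zs ≡⟨ List.++-assoc ws xs (ys ++ zs) ⟩
  ws ++ xs ++ ys ++ zs   ↭⟨ ++⁺ˡ ws (shifts xs ys) ⟩
  ws ++ ys ++ xs ++ zs   ≡⟨ sym (List.++-assoc ws ys (xs ++ zs)) ⟩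
  (ws ++ ys) ++ xs ++ zs ∎
  where open PermutationReasoning

AllPairs-⊆ : ∀ {A : Set} {R : A → A → Set} {xs ys} → xs ⊆ ys → AllPairs R ys → AllPairs R xs
AllPairs-⊆ []         []       = []
AllPairs-⊆ (y ∷ʳ p)   (_ ∷ h)  = AllPairs-⊆ p h
AllPairs-⊆ (refl ∷ p) (hx ∷ h) = Sublist.All-resp-⊆ p hx ∷ AllPairs-⊆ p h

range : ℕ → ℕ → List ℕ
range k zero    = []
range k (suc n) = k ∷ range (suc k) n

range-++ : ∀ k m n → range k (m ℕ.+ n) ≡ range k m ++ range (k ℕ.+ m) n
range-++ k zero    n = cong (λ j → range j n) (sym (ℕ.+-identityʳ k))
range-++ k (suc m) n = cong (k ∷_) (range-++ (suc k) m n ∙ cong (λ j → range (suc k) m ++ range j n) (sym (ℕ.+-suc k m)))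

range-≥ : ∀ {j} k n → j ≤ k → All (j ≤_) (range k n)
range-≥ k zero    _ = []
range-≥ k (suc n) h = h ∷ range-≥ (suc k) n (ℕ.m≤n⇒m≤1+n h)

range-< : ∀ k n → All (_< k ℕ.+ n) (range k n)
range-< k zero    = []
range-< k (suc n) = ℕ.m<m+n k (s≤s z≤n) ∷ All.map (λ h → ℕ.≤-trans h (ℕ.≤-reflexive (sym (ℕ.+-suc k n)))) (range-< (suc k) n)

range-sorted : ∀ k n → AllPairs _<_ (range k n)
range-sorted k zero    = []
range-sorted k (suc n) = range-≥ (suc k) n ℕ.≤-refl ∷ range-sorted (suc k) n

sorted⇒unique : ∀ {xs} → AllPairs _<_ xs → Unique xs
sorted⇒unique = AllPairs.map ℕ.<⇒≢

range-unique : ∀ k n → Unique (range k n)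
range-unique k n = sorted⇒unique (range-sorted k n)

mutual
  -- Edges are sorted by the kind of their lower end: those of `leafT` supply rows at leaves, while
  -- those of `intT` have internal lower ends and supply rows of the triangular part.
  leafT : ℕ → ℕ → Tree → List Edge
  leafT p k (node [])      = (p , k) ∷ []
  leafT p k (node (t ∷ f)) = leafF k (suc k) (t ∷ f)

  leafF : ℕ → ℕ → Forest → List Edge
  leafF p k []      = []
  leafF p k (t ∷ f) = leafT p k t ++ leafF p (k ℕ.+ size t) f

mutual
  intT : ℕ → ℕ → Tree → List Edge
  intT p k (node [])      = []
  intT p k (node (t ∷ f)) = (p , k) ∷ intF k (suc k) (t ∷ f)

  intF : ℕ → ℕ → Forest → List Edge
  intF p k []      = []
  intF p k (t ∷ f) = intT p k t ++ intF p (k ℕ.+ size t) f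

stem : ℕ → ℕ → Tree → List Edge
stem p k t = (p , k) ∷ edgesT k t

mutual
  splitT : ∀ p k t → stem p k t ↭ leafT p k t ++ intT p k t
  splitT p k (node [])      = refl
  splitT p k (node (t ∷ f)) = trans (prep (p , k) (splitF k (suc k) (t ∷ f))) (↭-sym (shift (p , k) (leafF k (suc k) (t ∷ f)) _))

  splitF : ∀ p k f → edgesF p k f ↭ leafF p k f ++ intF p k f
  splitF p k []      = refl
  splitF p k (t ∷ f) = trans (++⁺ (splitT p k t) (splitF p (k ℕ.+ size t) f))
    (↭-interchange (leafT p k t) (intT p k t) (leafF p (k ℕ.+ size t) f) (intF p (k ℕ.+ size t) f))

mutual
  labelsT : ∀ p k t → map proj₂ (stem p k t) ≡ range k (size t)
  labelsT p k (node f) = cong (k ∷_) (labelsF k (suc k) f)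

  labelsF : ∀ p k f → map proj₂ (edgesF p k f) ≡ range k (sizeF f)
  labelsF p k []      = refl
  labelsF p k (t ∷ f) = List.map-++ proj₂ (stem p k t) _ ∙
    cong₂ _++_ (labelsT p k t) (labelsF p (k ℕ.+ size t) f) ∙ sym (range-++ k (size t) (sizeF f))

mutual
  leaves-leafT : ∀ p k t → map proj₂ (leafT p k t) ≡ leavesT k t
  leaves-leafT p k (node [])      = refl
  leaves-leafT p k (node (t ∷ f)) = leaves-leafF k (suc k) (t ∷ f)

  leaves-leafF : ∀ p k f → map proj₂ (leafF p k f) ≡ leavesF k f
  leaves-leafF p k []      = refl
  leaves-leafF p k (t ∷ f) = List.map-++ proj₂ (leafT p k t) _ ∙ cong₂ _++_ (leaves-leafT p k t) (leaves-leafF p (k ℕ.+ size t) f)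

mutual
  leavesT⊆ : ∀ k t → leavesT k t ⊆ range k (size t)
  leavesT⊆ k (node [])      = ⊆-refl
  leavesT⊆ k (node (t ∷ f)) = k ∷ʳ leavesF⊆ (suc k) (t ∷ f)

  leavesF⊆ : ∀ k f → leavesF k f ⊆ range k (sizeF f)
  leavesF⊆ k []      = []
  leavesF⊆ k (t ∷ f) = subst (leavesF k (t ∷ f) ⊆_) (sym (range-++ k (size t) (sizeF f)))
    (Sublist.++⁺ (leavesT⊆ k t) (leavesF⊆ (k ℕ.+ size t) f))

mutual
  intT⊆ : ∀ p k t → map proj₂ (intT p k t) ⊆ range k (size t)
  intT⊆ p k (node [])      = k ∷ʳ []
  intT⊆ p k (node (t ∷ f)) = refl ∷ intF⊆ k (suc k) (t ∷ f)

  intF⊆ : ∀ p k f → map proj₂ (intF p k f) ⊆ range k (sizeF f)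
  intF⊆ p k []      = []
  intF⊆ p k (t ∷ f) = subst (_⊆ range k (sizeF (t ∷ f))) (sym (List.map-++ proj₂ (intT p k t) _))
    (subst (map proj₂ (intT p k t) ++ map proj₂ (intF p (k ℕ.+ size t) f) ⊆_) (sym (range-++ k (size t) (sizeF f)))
      (Sublist.++⁺ (intT⊆ p k t) (intF⊆ p (k ℕ.+ size t) f)))

mutual
  parentsT : ∀ p k t → All (λ e → proj₁ e ∈ p ∷ map proj₂ (intT p k t)) (stem p k t)
  parentsT p k (node [])      = here refl ∷ []
  parentsT p k (node (t ∷ f)) = here refl ∷ All.map there (parentsF k (suc k) (t ∷ f))

  parentsF : ∀ p k f → All (λ e → proj₁ e ∈ p ∷ map proj₂ (intF p k f)) (edgesF p k f)
  parentsF p k []      = []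
  parentsF p k (t ∷ f) = All.++⁺ (All.map (λ {e} → left {e}) (parentsT p k t)) (All.map (λ {e} → right {e}) (parentsF p (k ℕ.+ size t) f))
    where
    eq = List.map-++ proj₂ (intT p k t) (intF p (k ℕ.+ size t) f)
    left : ∀ {e : Edge} → proj₁ e ∈ p ∷ map proj₂ (intT p k t) → proj₁ e ∈ p ∷ map proj₂ (intF p k (t ∷ f))
    left (here e)  = here e
    left (there m) = there (subst (_ ∈_) (sym eq) (∈-++⁺ˡ m))
    right : ∀ {e : Edge} → proj₁ e ∈ p ∷ map proj₂ (intF p (k ℕ.+ size t) f) → proj₁ e ∈ p ∷ map proj₂ (intF p k (t ∷ f))
    right (here e)  = here e
    right (there m) = there (subst (_ ∈_) (sym eq) (∈-++⁺ʳ _ m))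

Ascending : Edge → Set
Ascending e = proj₁ e < proj₂ e

mutual
  ascendingT : ∀ p k t → p < k → All Ascending (stem p k t)
  ascendingT p k (node f) p<k = p<k ∷ ascendingF k (suc k) f ℕ.≤-refl

  ascendingF : ∀ p k f → p < k → All Ascending (edgesF p k f)
  ascendingF p k []      _   = []
  ascendingF p k (t ∷ f) p<k = All.++⁺ (ascendingT p k t p<k) (ascendingF p (k ℕ.+ size t) f (ℕ.≤-trans p<k (ℕ.m≤m+n k (size t))))

-- In preorder the first child of v is v + 1.
next : Edge → Edge
next (_ , v) = v , suc v

mutual
  -- Different internal vertices have different edges to their first children, so the triangular
  -- part spends a tree edge at most once.
  next-intT : ∀ p k t → map next (intT p k t) ⊑ edgesT k t
  next-intT p k (node [])      = []⊑
  next-intT p k (node (t ∷ f)) =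
    ⊑-++ (⊑-refl {xs = (k , suc k) ∷ []}) (subst (_⊑ edgesT (suc k) t ++ edgesF k (suc k ℕ.+ size t) f)
      (sym (List.map-++ next (intT k (suc k) t) _)) (⊑-++ (next-intT k (suc k) t) (next-intF k (suc k ℕ.+ size t) f)))

  next-intF : ∀ p k f → map next (intF p k f) ⊑ edgesF p k f
  next-intF p k []      = []⊑
  next-intF p k (t ∷ f) = subst (_⊑ edgesF p k (t ∷ f)) (sym (List.map-++ next (intT p k t) _))
    (⊑-++ (⊑-trans (next-intT p k t) ((p , k) ∷ [] , ++-comm (edgesT k t) ((p , k) ∷ []))) (next-intF p (k ℕ.+ size t) f))

Above : ℕ → Edge → Set
Above k e = k ≤ proj₁ e × k ≤ proj₂ e

Below : ℕ → Edge → Set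
Below k e = proj₁ e < k × proj₂ e < k

ε-≢ : ∀ {u v x} → x ≢ u → x ≢ v → ε (u , v) x ≡ 0ℤ
ε-≢ hu hv = cong₂ _+_ (ι-≢ hu) (ι-≢ hv)

ε-above : ∀ {k x e} → Above k e → x < k → ε e x ≡ 0ℤ
ε-above (h₁ , h₂) x<k = ε-≢ (ℕ.<⇒≢ (ℕ.<-≤-trans x<k h₁)) (ℕ.<⇒≢ (ℕ.<-≤-trans x<k h₂))

∂-vanish : ∀ e (f : Column) → f (proj₁ e) ≡ 0ℤ → f (proj₂ e) ≡ 0ℤ → val (∂ e) f ≡ 0ℤ
∂-vanish e f h₁ h₂ = cong₂ _-_ h₂ h₁

below-kills-above : ∀ {k e es} → Below k e → All (Above k) es → ∂ e Kills map ε es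
below-kills-above {e = e} (h₁ , h₂) hs =
  All.map⁺ (All.map (λ {e′} h → ∂-vanish e (ε e′) (ε-above h h₁) (ε-above h h₂)) hs)

All-below-kills-above : ∀ {k rs es} → All (Below k) rs → All (Above k) es → All (_Kills map ε es) (map ∂ rs)
All-below-kills-above hr hs = All.map⁺ (All.map (λ h → below-kills-above h hs) hr)

val-next : ∀ {p v} → p < v → val (∂ (p , v)) (ε (v , suc v)) ≢ 0ℤ
val-next {p} {v} p<v eq with () ← sym eq ∙ cong₂ _-_ (cong₂ _+_ (ι-refl v) (ι-≢ (ℕ.<⇒≢ ℕ.≤-refl))) (ε-above {v} (ℕ.≤-refl , ℕ.n≤1+n v) p<v)

-- The row of an edge with lower end `v` sees only labels up to `v`, whereas later columns involve
-- an internal vertex beyond `v` and its first child.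
triangular-next : ∀ {es} → All Ascending es → AllPairs _<_ (map proj₂ es) → Triangular (map ∂ es) (map ε (map next es))
triangular-next [] [] = []
triangular-next {(p , v) ∷ es} (p<v ∷ asc) (hv ∷ sorted) = single (val-next p<v)
  (below-kills-above {suc v} {p , v} (ℕ.m≤n⇒m≤1+n p<v , ℕ.≤-refl) (All.map⁺ (All.map (λ h → h , ℕ.m≤n⇒m≤1+n h) (All.map⁻ hv))))
  (triangular-next asc sorted)

-- Linear forms written as combinations of tree edges.

ι-sym : ∀ x y → ι x y ≡ ι y x
ι-sym x y with x ℕ.≟ y
... | yes refl = refl
... | no x≢y   = ι-≢ (λ e → x≢y (sym e)) ∙ sym (ι-≢ x≢y)

rsum : (ℕ → ℤ) → ℕ → ℕ → ℤ
rsum h k zero    = 0ℤ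
rsum h k (suc n) = h k + rsum h (suc k) n

rsum-++ : ∀ h k m n → rsum h k (m ℕ.+ n) ≡ rsum h k m + rsum h (k ℕ.+ m) n
rsum-++ h k zero    n = cong (λ j → rsum h j n) (sym (ℕ.+-identityʳ k)) ∙ sym (ℤ.+-identityˡ _)
rsum-++ h k (suc m) n = cong (h k +_) (rsum-++ h (suc k) m n ∙ cong (λ j → rsum h (suc k) m + rsum h j n) (sym (ℕ.+-suc k m))) ∙
  sym (ℤ.+-assoc (h k) _ _)

rsum-cong : ∀ {h h′} → (∀ x → h x ≡ h′ x) → ∀ k n → rsum h k n ≡ rsum h′ k n
rsum-cong eq k zero    = refl
rsum-cong eq k (suc n) = cong₂ _+_ (eq k) (rsum-cong eq (suc k) n)

rsum-+ : ∀ h h′ k n → rsum (λ x → h x + h′ x) k n ≡ rsum h k n + rsum h′ k n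
rsum-+ h h′ k zero    = refl
rsum-+ h h′ k (suc n) = cong (λ z → h k + h′ k + z) (rsum-+ h h′ (suc k) n) ∙ lemma (h k) (h′ k) _ _
  where
  lemma : ∀ a b c d → a + b + (c + d) ≡ a + c + (b + d)
  lemma = solve-∀

rsum-outside : ∀ (w : ℕ → ℤ) i k n → (k ≤ i → k ℕ.+ n ≤ i) → rsum (λ x → w x * ι i x) k n ≡ 0ℤ
rsum-outside w i k zero    h = refl
rsum-outside w i k (suc n) h = cong₂ _+_
  (cong (w k *_) (ι-≢ (λ k≡i → ℕ.<⇒≢ (ℕ.≤-trans (ℕ.m<m+n k (s≤s z≤n)) (h (ℕ.≤-reflexive k≡i))) k≡i)) ∙ ℤ.*-zeroʳ (w k))
  (rsum-outside w i (suc k) n (λ h′ → ℕ.≤-trans (ℕ.≤-reflexive (sym (ℕ.+-suc k n))) (h (ℕ.<⇒≤ h′))))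

rsum-inside : ∀ (w : ℕ → ℤ) i k n → k ≤ i → i < k ℕ.+ n → rsum (λ x → w x * ι i x) k n ≡ w i
rsum-inside w i k zero    k≤i i<k = contradiction (subst (i <_) (ℕ.+-identityʳ k) i<k) (ℕ.≤⇒≯ k≤i)
rsum-inside w i k (suc n) k≤i i<k with k ℕ.≟ i
... | yes refl = cong₂ _+_ (cong (w k *_) (ι-refl k) ∙ ℤ.*-identityʳ (w k)) (rsum-outside w k (suc k) n (λ h → contradiction h ℕ.1+n≰n)) ∙ ℤ.+-identityʳ (w k)
... | no k≢i   = cong₂ _+_ (cong (w k *_) (ι-≢ k≢i) ∙ ℤ.*-zeroʳ (w k))
                   (rsum-inside w i (suc k) n (ℕ.≤∧≢⇒< k≤i k≢i) (subst (i <_) (ℕ.+-suc k n) i<k)) ∙ ℤ.+-identityˡ (w i)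

eval-++ : ∀ F G x → eval (F ++ G) x ≡ eval F x + eval G x
eval-++ []            G x = sym (ℤ.+-identityˡ _)
eval-++ ((c , e) ∷ F) G x = cong (c * ε e x +_) (eval-++ F G x) ∙ sym (ℤ.+-assoc (c * ε e x) _ _)

sgn-not : ∀ b → sgn (not b) ≡ - sgn b
sgn-not true  = refl
sgn-not false = refl

sgn² : ∀ b → sgn b * sgn b ≡ 1ℤ
sgn² true  = refl
sgn² false = refl

Proper : (ℕ → Bool) → Edge → Set
Proper χ (u , v) = χ u ≡ not (χ v)

-- Writing a linear form g as a combination of tree edges: the coefficient of the edge
-- above a subtree is, up to sign, the χ-weighted sum of g over that subtree.
module Flux (χ : ℕ → Bool) (g : ℕ → ℤ) where

  h : ℕ → ℤ
  h x = sgn (χ x) * g x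

  coefficient : ℕ → Tree → ℤ
  coefficient k t = sgn (χ k) * rsum h k (size t)

  mutual
    formT : ℕ → Tree → Form
    formT k (node f) = formF k (suc k) f

    formF : ℕ → ℕ → Forest → Form
    formF p k []      = []
    formF p k (t ∷ f) = (coefficient k t , p , k) ∷ (formT k t ++ formF p (k ℕ.+ size t) f)

  mutual
    support-formT : ∀ k t → support (formT k t) ≡ edgesT k t
    support-formT k (node f) = support-formF k (suc k) f

    support-formF : ∀ p k f → support (formF p k f) ≡ edgesF p k f
    support-formF p k []      = refl
    support-formF p k (t ∷ f) = cong ((p , k) ∷_) (List.map-++ proj₂ (formT k t) _ ∙
      cong₂ _++_ (support-formT k t) (support-formF p (k ℕ.+ size t) f))

  spread : ℕ → ℕ → ℕ → ℤ
  spread k n x = rsum (λ v → g v * ι v x) k n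

  -- At a vertex `k` the edges to its children contribute the weighted sum below `k`, which cancels
  -- against the edge above `k` up to `g k`, as the signs at the two ends are opposite. Only the
  -- root `p` keeps a remainder, and it vanishes when the total weighted sum is zero.
  eval-formF : ∀ p k f x → All (Proper χ) (edgesF p k f) →
               eval (formF p k f) x ≡ spread k (sizeF f) x - sgn (χ p) * rsum h k (sizeF f) * ι p x
  eval-formF p k [] x _ = lemma (sgn (χ p)) (ι p x)
    where
    lemma : ∀ a i → 0ℤ ≡ 0ℤ - a * 0ℤ * i
    lemma = solve-∀
  eval-formF p k (node f′ ∷ f) x (pk ∷ proper) = begin
    coefficient k (node f′) * ε (p , k) x + eval (formF k (suc k) f′ ++ formF p K f) x
      ≡⟨ cong (coefficient k (node f′) * ε (p , k) x +_) (eval-++ (formF k (suc k) f′) _ x ∙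
           cong₂ _+_ (eval-formF k (suc k) f′ x (All.++⁻ˡ (edgesF k (suc k) f′) proper)) (eval-formF p K f x (All.++⁻ʳ (edgesF k (suc k) f′) proper))) ⟩
    s * (s * g k + S) * (ι p x + ι k x) + ((spread (suc k) (sizeF f′) x - s * S * ι k x) + (spread K (sizeF f) x - sgn (χ p) * S′ * ι p x))
      ≡⟨ cong (λ σ → s * (s * g k + S) * (ι p x + ι k x) + ((spread (suc k) (sizeF f′) x - s * S * ι k x) + (spread K (sizeF f) x - σ * S′ * ι p x))) sp ⟩
    s * (s * g k + S) * (ι p x + ι k x) + ((spread (suc k) (sizeF f′) x - s * S * ι k x) + (spread K (sizeF f) x - - s * S′ * ι p x))
      ≡⟨ lemma s (g k) S S′ (ι p x) (ι k x) (spread (suc k) (sizeF f′) x) (spread K (sizeF f) x) ⟩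
    ((s * s * (g k * ι k x) + spread (suc k) (sizeF f′) x) + spread K (sizeF f) x) - - s * ((s * g k + S) + S′) * ι p x
      ≡⟨ cong₂ (λ a σ → ((a * (g k * ι k x) + spread (suc k) (sizeF f′) x) + spread K (sizeF f) x) - σ * ((s * g k + S) + S′) * ι p x) (sgn² (χ k)) (sym sp) ⟩
    ((1ℤ * (g k * ι k x) + spread (suc k) (sizeF f′) x) + spread K (sizeF f) x) - sgn (χ p) * ((s * g k + S) + S′) * ι p x
      ≡⟨ cong₂ (λ a b → a - sgn (χ p) * b * ι p x)
           (cong (λ a → (a + spread (suc k) (sizeF f′) x) + spread K (sizeF f) x) (ℤ.*-identityˡ (g k * ι k x)) ∙ sym (rsum-++ (λ v → g v * ι v x) k (size (node f′)) (sizeF f)))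
           (sym (rsum-++ h k (size (node f′)) (sizeF f))) ⟩
    spread k (sizeF (node f′ ∷ f)) x - sgn (χ p) * rsum h k (sizeF (node f′ ∷ f)) * ι p x ∎
    where
    open ≡-Reasoning
    K = k ℕ.+ size (node f′)
    s = sgn (χ k)
    S = rsum h (suc k) (sizeF f′)
    S′ = rsum h K (sizeF f)
    sp : sgn (χ p) ≡ - s
    sp = cong sgn pk ∙ sgn-not (χ k)
    lemma : ∀ s g S S′ i j a b → s * (s * g + S) * (i + j) + ((a - s * S * j) + (b - - s * S′ * i)) ≡
            ((s * s * (g * j) + a) + b) - - s * ((s * g + S) + S′) * i
    lemma = solve-∀

-- The signs make the weighted sum zero: each point contributes the square of a sign, once with plus
-- and once with minus.
twoPoint : (ℕ → Bool) → ℕ → ℕ → Column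
twoPoint χ i j x = sgn (χ i) * ι i x + - sgn (χ j) * ι j x

module _ (χ : ℕ → Bool) (i j : ℕ) where
  open Flux χ (twoPoint χ i j)

  twoPoint-sum : ∀ k n → rsum h k n ≡ rsum (λ x → sgn (χ x) * sgn (χ i) * ι i x) k n + rsum (λ x → sgn (χ x) * - sgn (χ j) * ι j x) k n
  twoPoint-sum k n = rsum-cong (λ x → lemma (sgn (χ x)) (sgn (χ i)) (- sgn (χ j)) (ι i x) (ι j x)) k n ∙ rsum-+ _ _ k n
    where
    lemma : ∀ s a b u v → s * (a * u + b * v) ≡ s * a * u + s * b * v
    lemma = solve-∀

  twoPoint-inside : ∀ {k n} → k ≤ i → i < k ℕ.+ n → k ≤ j → j < k ℕ.+ n → rsum h k n ≡ 0ℤ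
  twoPoint-inside {k} {n} k≤i i<k k≤j j<k = twoPoint-sum k n ∙
    cong₂ _+_ (rsum-inside (λ x → sgn (χ x) * sgn (χ i)) i k n k≤i i<k) (rsum-inside (λ x → sgn (χ x) * - sgn (χ j)) j k n k≤j j<k) ∙
    cong₂ _+_ (sgn² (χ i)) (sym (ℤ.neg-distribʳ-* (sgn (χ j)) (sgn (χ j))) ∙ cong -_ (sgn² (χ j)))

  twoPoint-outside : ∀ {k n} → k ℕ.+ n ≤ i → k ℕ.+ n ≤ j → rsum h k n ≡ 0ℤ
  twoPoint-outside {k} {n} hi hj = twoPoint-sum k n ∙
    cong₂ _+_ (rsum-outside (λ x → sgn (χ x) * sgn (χ i)) i k n (λ _ → hi)) (rsum-outside (λ x → sgn (χ x) * - sgn (χ j)) j k n (λ _ → hj))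

  spread-twoPoint : ∀ {k n} → k ≤ i → i < k ℕ.+ n → k ≤ j → j < k ℕ.+ n → ∀ x → spread k n x ≡ twoPoint χ i j x
  spread-twoPoint {k} {n} k≤i i<k k≤j j<k x = rsum-cong (λ v → cong (twoPoint χ i j v *_) (ι-sym v x)) k n ∙ at-x
    where
    away : x ≢ i → x ≢ j → 0ℤ ≡ twoPoint χ i j x
    away x≢i x≢j = sym (cong₂ (λ a b → sgn (χ i) * a + - sgn (χ j) * b) (ι-≢ x≢i) (ι-≢ x≢j) ∙
      cong₂ _+_ (ℤ.*-zeroʳ (sgn (χ i))) (ℤ.*-zeroʳ (- sgn (χ j))))
    at-x : rsum (λ v → twoPoint χ i j v * ι x v) k n ≡ twoPoint χ i j x
    at-x with k ℕ.≤? x | x ℕ.<? k ℕ.+ n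
    ... | yes k≤x | yes x<k = rsum-inside (twoPoint χ i j) x k n k≤x x<k
    ... | no k≰x  | _       = rsum-outside (twoPoint χ i j) x k n (λ k≤x → contradiction k≤x k≰x) ∙
                              away (λ { refl → k≰x k≤i }) (λ { refl → k≰x k≤j })
    ... | yes _   | no x≮k  = rsum-outside (twoPoint χ i j) x k n (λ _ → ℕ.≮⇒≥ x≮k) ∙
                              away (λ { refl → x≮k i<k }) (λ { refl → x≮k j<k })

  eval-twoPoint : ∀ {p k f} → All (Proper χ) (edgesF p k f) → k ≤ i → i < k ℕ.+ sizeF f → k ≤ j → j < k ℕ.+ sizeF f →
                  ∀ x → eval (formF p k f) x ≡ twoPoint χ i j x
  eval-twoPoint {p} {k} {f} proper k≤i i<k k≤j j<k x = eval-formF p k f x proper ∙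
    cong₂ (λ a b → a - sgn (χ p) * b * ι p x) (spread-twoPoint k≤i i<k k≤j j<k x) (twoPoint-inside k≤i i<k k≤j j<k) ∙
    lemma (twoPoint χ i j x) (sgn (χ p)) (ι p x)
    where
    lemma : ∀ a s i → a - s * 0ℤ * i ≡ a
    lemma = solve-∀

-- Assembling a certificate from a triangular part and a path block.

At⇒∈ : ∀ {i x xs} → At i x xs → x ∈ xs
At⇒∈ here       = here refl
At⇒∈ (there at) = there (At⇒∈ at)

doubled : {A : Set} → List A → List A
doubled []       = []
doubled (x ∷ xs) = x ∷ x ∷ doubled xs

doubled-↭ : ∀ {A : Set} (xs : List A) → doubled xs ↭ xs ++ xs
doubled-↭ []       = refl
doubled-↭ (x ∷ xs) = prep x (trans (prep x (doubled-↭ xs)) (↭-sym (shift x xs xs)))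

one : Edge → Form
one e = (1ℤ , e) ∷ []

eval-one : ∀ e x → eval (one e) x ≡ ε e x
eval-one e x = ℤ.+-identityʳ (1ℤ * ε e x) ∙ ℤ.*-identityˡ (ε e x)

support-ones : ∀ es → concatMap support (map one es) ≡ es
support-ones []       = refl
support-ones (e ∷ es) = cong (e ∷_) (support-ones es)

cols-unmarked : ∀ y ys → cols (unmarked (y ∷ ys)) ≡ map ε (doubled (pathEdges (y ∷ ys)))
cols-unmarked y []       = refl
cols-unmarked y (z ∷ ys) = cong (λ cs → ε (y , z) ∷ ε (y , z) ∷ cs) (cols-unmarked z ys)

VanishesOff : List ℕ → Column → Set
VanishesOff S f = ∀ x → x ∉ S → f x ≡ 0ℤ

BothOff : List ℕ → Edge → Set
BothOff S e = proj₁ e ∉ S × proj₂ e ∉ S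

combination-off : ∀ {S u v} m n → u ∈ S → v ∈ S → VanishesOff S (λ x → m * ι u x + n * ι v x)
combination-off m n u∈S v∈S x x∉S =
  cong₂ (λ a b → m * a + n * b) (ι-≢ (λ { refl → x∉S u∈S })) (ι-≢ (λ { refl → x∉S v∈S })) ∙
  cong₂ _+_ (ℤ.*-zeroʳ m) (ℤ.*-zeroʳ n)

path-off : ∀ y ys S → All (_∈ S) (y ∷ ys) → All (VanishesOff S) (map ε (doubled (pathEdges (y ∷ ys))))
path-off y []       S _ = []
path-off y (z ∷ ys) S (y∈S ∷ h@(z∈S ∷ _)) = off ∷ off ∷ path-off z ys S h
  where
  off : VanishesOff S (ε (y , z))
  off x x∉S = ε-≢ (λ { refl → x∉S y∈S }) (λ { refl → x∉S z∈S })

module _ {late lateCols leaf H : List Edge} {u w y i a b : ℕ} {ys : List ℕ} {s : ℤ} {χ : ℕ → Bool} {C G : Form} where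

  -- The common frame of both constructions. `u` and `w` are the outer ends of the two cycle edges
  -- leaving the path: both are the root, or `u` is the omitted first leaf. The last hypothesis is
  -- the account of edge uses.
  assemble : H ↭ late ++ leaf ++ (u , y) ∷ pathEdges (y ∷ ys) ++ (w , lastOr y ys) ∷ [] →
             Triangular (map ∂ late) (map ε lateCols) →
             map proj₂ leaf ≡ y ∷ ys → Unique (y ∷ ys) →
             All (BothOff (y ∷ ys)) late → u ∉ y ∷ ys → w ∉ y ∷ ys → All (λ e → proj₁ e ∉ y ∷ ys) leaf →
             (∀ x → eval C x ≡ 1ℤ * ι y x + s * ι (lastOr y ys) x) →
             (∀ x → eval G x ≡ twoPoint χ a b x) → At i a (y ∷ ys) → At (suc i) b (y ∷ ys) →
             Block (suc (length ys)) s i (χ a) (χ b) ≢ 0ℤ →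
             lateCols ++ support C ++ support C ++ support G ++ pathEdges (y ∷ ys) ++ pathEdges (y ∷ ys) ⊑ H ++ H →
             Certificate H
  assemble perm tri leaves uq late-off u-off w-off leaf-off evalC evalG ata atb nz bag =
    Fs , nonvanishing , ↭-⊑ (↭-reflexive bag-eq) (↭-⊑ (++⁺ˡ lateCols (++⁺ˡ (support C) (++⁺ˡ (support C) (++⁺ˡ (support G) (doubled-↭ path))))) bag)
    where
    S = y ∷ ys
    path = pathEdges S
    Fs : List Form
    Fs = map one lateCols ++ C ∷ C ∷ G ∷ map one (doubled path)
    c g : Column
    c x = 1ℤ * ι y x + s * ι (lastOr y ys) x
    g = twoPoint χ a b
    blockCols : List Column
    blockCols = c ∷ c ∷ g ∷ map ε (doubled path)
    bag-eq : concatMap support Fs ≡ lateCols ++ support C ++ support C ++ support G ++ doubled path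
    bag-eq = List.concatMap-++ support (map one lateCols) _ ∙
      cong₂ (λ p q → p ++ support C ++ support C ++ support G ++ q) (support-ones lateCols) (support-ones (doubled path))
    last∈S : lastOr y ys ∈ S
    last∈S = At⇒∈ (At-last y ys)
    block-off : All (VanishesOff S) blockCols
    block-off = c-off ∷ c-off ∷ combination-off (sgn (χ a)) (- sgn (χ b)) (At⇒∈ ata) (At⇒∈ atb) ∷
                path-off y ys S (All.tabulate (λ m → m))
      where
      c-off : VanishesOff S c
      c-off = combination-off 1ℤ s (here refl) last∈S
    val-eq : ∀ {f f′ : Column} → (∀ x → f x ≡ f′ x) → ∀ r → val r f ≡ val r f′
    val-eq eq r = val-cong r eq
    ones : ∀ es → Pointwise (λ f f′ → ∀ r → val r f ≡ val r f′) (map eval (map one es)) (map ε es)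
    ones []       = []
    ones (e ∷ es) = val-eq (eval-one e) ∷ ones es
    columns : Pointwise (λ f f′ → ∀ r → val r f ≡ val r f′) (map eval Fs) (map ε lateCols ++ blockCols)
    columns = subst (λ cs → Pointwise _ cs (map ε lateCols ++ blockCols)) (sym (List.map-++ eval (map one lateCols) _))
      (Pointwise.++⁺ (ones lateCols) (val-eq evalC ∷ val-eq evalC ∷ val-eq evalG ∷ ones (doubled path)))
    block : List Edge
    block = leaf ++ (u , y) ∷ path ++ (w , lastOr y ys) ∷ []
    block-value : per (map ∂ block) blockCols ≡ Block (suc (length ys)) s i (χ a) (χ b)
    block-value = per-avoiding {u} {w} leaves (All.map (λ off → off u u-off , off w w-off , All.map (λ {e} h → off (proj₁ e) h) leaf-off) block-off) ∙
      cong (λ E → per (pathRows S) (c ∷ c ∷ g ∷ E)) (sym (cols-unmarked y ys)) ∙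
      per-closed-path y ys s (sgn (χ a)) (- sgn (χ b)) c g uq ata atb (λ _ → refl) (λ _ → refl)
    late-kills : All (_Kills blockCols) (map ∂ late)
    late-kills = All.map⁺ (All.map (λ {e} (h₁ , h₂) → All.map (λ {f} off → ∂-vanish e f (off _ h₁) (off _ h₂)) block-off) late-off)
    nonvanishing : per (map ∂ H) (map eval Fs) ≢ 0ℤ
    nonvanishing z = per-triangular tri late-kills (λ z′ → nz (sym block-value ∙ z′))
      (cong (λ rs → per rs (map ε lateCols ++ blockCols)) (sym (List.map-++ ∂ late block)) ∙
       sym (per-rows-↭ (map⁺ ∂ perm) _) ∙ sym (per-cols-cong columns (map ∂ H)) ∙ z)

-- The construction with all non-root leaves in the path block.

module ++-Solver {A : Set} = CommutativeMonoidSolver (++-commutativeMonoid {A = A})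

Unique-resp-↭ : ∀ {A : Set} {xs ys : List A} → xs ↭ ys → Unique xs → Unique ys
Unique-resp-↭ refl         u                      = u
Unique-resp-↭ (prep x p)   (h ∷ u)                = All-resp-↭ p h ∷ Unique-resp-↭ p u
Unique-resp-↭ (swap x y p) ((x≢y ∷ hx) ∷ hy ∷ u)  = ((λ e → x≢y (sym e)) ∷ All-resp-↭ p hy) ∷ All-resp-↭ p hx ∷ Unique-resp-↭ p u
Unique-resp-↭ (trans p q)  u                      = Unique-resp-↭ q (Unique-resp-↭ p u)

Unique-++-∉ : ∀ {A : Set} {x : A} xs {ys} → Unique (xs ++ ys) → x ∈ ys → x ∉ xs
Unique-++-∉ (z ∷ xs) (h ∷ u) x∈ys (here refl) = All.lookup h (∈-++⁺ʳ xs x∈ys) refl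
Unique-++-∉ (z ∷ xs) (h ∷ u) x∈ys (there m)   = Unique-++-∉ xs u x∈ys m

split-disjoint : ∀ {E A B : List Edge} → Unique (map proj₂ E) → E ↭ A ++ B → All (λ e → proj₂ e ∉ map proj₂ A) B
split-disjoint {E} {A} {B} u p = All.tabulate (λ e∈B → Unique-++-∉ (map proj₂ A)
  (subst Unique (List.map-++ proj₂ A B) (Unique-resp-↭ (map⁺ proj₂ p) u)) (∈-map⁺ proj₂ e∈B))

leaves-sorted : ∀ k f → AllPairs _<_ (leavesF k f)
leaves-sorted k f = AllPairs-⊆ (leavesF⊆ k f) (range-sorted k (sizeF f))

leaves-unique : ∀ k f → Unique (leavesF k f)
leaves-unique k f = sorted⇒unique (leaves-sorted k f)

leaves-≥ : ∀ k f → All (k ≤_) (leavesF k f)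
leaves-≥ k f = Sublist.All-resp-⊆ (leavesF⊆ k f) (range-≥ k (sizeF f) ℕ.≤-refl)

leaves-< : ∀ k f → All (_< k ℕ.+ sizeF f) (leavesF k f)
leaves-< k f = Sublist.All-resp-⊆ (leavesF⊆ k f) (range-< k (sizeF f))

edges-unique : ∀ p k f → Unique (map proj₂ (edgesF p k f))
edges-unique p k f = subst Unique (sym (labelsF p k f)) (range-unique k (sizeF f))

-- The label of a parent is either the root or that of an internal vertex, hence no leaf.
parents-off-leaves : ∀ p k f → p < k → All (λ e → proj₁ e ∉ leavesF k f) (edgesF p k f)
parents-off-leaves p k f p<k = All.map (λ {e} → off {e}) (parentsF p k f)
  where
  off : ∀ {e : Edge} → proj₁ e ∈ p ∷ map proj₂ (intF p k f) → proj₁ e ∉ leavesF k f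
  off (here refl) m = ℕ.<⇒≱ p<k (All.lookup (leaves-≥ k f) m)
  off (there m) m′ with e , e∈ , eq ← ∈-map⁻ proj₂ m =
    All.lookup (split-disjoint (edges-unique p k f) (splitF p k f)) e∈
      (subst₂∈ eq (subst (_ ∈_) (sym (leaves-leafF p k f)) m′))
    where
    subst₂∈ : ∀ {x y : ℕ} {xs} → x ≡ y → x ∈ xs → y ∈ xs
    subst₂∈ refl h = h

int-ascending : ∀ p k f → p < k → All Ascending (intF p k f)
int-ascending p k f p<k = All.++⁻ʳ (leafF p k f) (All-resp-↭ (splitF p k f) (ascendingF p k f p<k))

int-sorted : ∀ p k f → AllPairs _<_ (map proj₂ (intF p k f))
int-sorted p k f = AllPairs-⊆ (intF⊆ p k f) (range-sorted k (sizeF f))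

int-above : ∀ p k f → All (Above k) (map next (intF p k f))
int-above p k f = All.map⁺ (All.map (λ h → h , ℕ.m≤n⇒m≤1+n h) (All.map⁻ (Sublist.All-resp-⊆ (intF⊆ p k f) (range-≥ k (sizeF f) ℕ.≤-refl))))

int-triangular : ∀ p k f → p < k → Triangular (map ∂ (intF p k f)) (map ε (map next (intF p k f)))
int-triangular p k f p<k = triangular-next (int-ascending p k f p<k) (int-sorted p k f)

-- `halinEdges` for a tree whose root 0 is a leaf, with the closing cycle edge turned around so that
-- every edge ascends.
halin : ℕ → List ℕ → List Edge → List Edge
halin y ys E = E ++ (0 , y) ∷ pathEdges (y ∷ ys) ++ (0 , lastOr y ys) ∷ []

module _ (f : Forest) (χ : ℕ → Bool) (proper : All (Proper χ) (edgesF 0 1 f)) {y i a b : ℕ} {ys : List ℕ}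
         (eq : leavesF 1 f ≡ y ∷ ys) (ata : At i a (y ∷ ys)) (atb : At (suc i) b (y ∷ ys)) where

  private
    E = edgesF 0 1 f
    l = lastOr y ys
    path = pathEdges (y ∷ ys)
    S = y ∷ ys
    leaf∈ : ∀ {x} → x ∈ S → x ∈ leavesF 1 f
    leaf∈ = subst (_ ∈_) (sym eq)
    bounds : ∀ {x} → x ∈ S → 1 ≤ x × x < 1 ℕ.+ sizeF f
    bounds m = All.lookup (leaves-≥ 1 f) (leaf∈ m) , All.lookup (leaves-< 1 f) (leaf∈ m)
    parents-off : All (λ e → proj₁ e ∉ S) E
    parents-off = All.map (λ h m → h (leaf∈ m)) (parents-off-leaves 0 1 f ℕ.≤-refl)
    0∉S : 0 ∉ S
    0∉S m with () ← proj₁ (bounds m)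

  open Flux χ (twoPoint χ a b)

  -- The `next` columns and the tree combination draw on one copy of the tree edges each; the path
  -- edges and the two edges at 0 are spent exactly twice.
  certificate : Block (suc (length ys)) (- 1ℤ) i (χ a) (χ b) ≢ 0ℤ → Certificate (halin y ys E)
  certificate nz = assemble {late = int} {lateCols = map next int} {leaf = leafF 0 1 f} {u = 0} {w = 0} {s = - 1ℤ} {χ = χ} {C = C} {G = formF 0 1 f}
    (trans (++⁺ʳ _ (trans (splitF 0 1 f) (++-comm (leafF 0 1 f) int))) (↭-reflexive (List.++-assoc int (leafF 0 1 f) _)))
    (int-triangular 0 1 f ℕ.≤-refl)
    (leaves-leafF 0 1 f ∙ eq) (subst Unique eq (leaves-unique 1 f))
    (All.zip (All.++⁻ʳ (leafF 0 1 f) split-parents ,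
      All.map (λ h m → h (subst (_ ∈_) (sym (leaves-leafF 0 1 f)) (leaf∈ m))) (split-disjoint (edges-unique 0 1 f) (splitF 0 1 f))))
    0∉S 0∉S (All.++⁻ˡ (leafF 0 1 f) split-parents)
    (λ x → closing (ι 0 x) (ι y x) (ι l x))
    (eval-twoPoint χ a b proper (proj₁ ba) (proj₂ ba) (proj₁ bb) (proj₂ bb)) ata atb nz
    (subst (λ G → map next int ++ support C ++ support C ++ G ++ path ++ path ⊑ halin y ys E ++ halin y ys E) (sym (support-formF 0 1 f))
      (⊑-↭ (⊑-++ (next-intF 0 1 f) (⊑-refl {xs = support C ++ support C ++ E ++ path ++ path})) bag))
    where
    int = intF 0 1 f
    C : Form
    C = (1ℤ , 0 , y) ∷ (- 1ℤ , 0 , l) ∷ []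
    ba = bounds (At⇒∈ ata)
    bb = bounds (At⇒∈ atb)
    split-parents = All-resp-↭ (splitF 0 1 f) parents-off
    closing : ∀ o y l → 1ℤ * (o + y) + (- 1ℤ * (o + l) + 0ℤ) ≡ 1ℤ * y + - 1ℤ * l
    closing = solve-∀
    bag : E ++ support C ++ support C ++ E ++ path ++ path ↭ halin y ys E ++ halin y ys E
    bag = solve 4 (λ e p u v → (e ⊕ ((u ⊕ v) ⊕ ((u ⊕ v) ⊕ (e ⊕ (p ⊕ p))))) ⊜ ((e ⊕ (u ⊕ (p ⊕ v))) ⊕ (e ⊕ (u ⊕ (p ⊕ v))))) refl
            E path ((0 , y) ∷ []) ((0 , l) ∷ [])
      where open ++-Solver

-- The construction with the first leaf left out.

data Chain : Tree → Set where
  end  : Chain (node [])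
  link : ∀ {t} → Chain t → Chain (node (t ∷ []))

-- The leftmost path of a tree that is not a chain contains a last vertex with two children.
data Spine : Tree → Set where
  fork : ∀ {t u f} → Chain t → Spine (node (t ∷ u ∷ f))
  down : ∀ {t f} → Spine t → Spine (node (t ∷ f))

chain-or-spine : ∀ t → Chain t ⊎ Spine t
chain-or-spine (node []) = inj₁ end
chain-or-spine (node (t ∷ f)) with chain-or-spine t | f
... | inj₂ s | _     = inj₂ (down s)
... | inj₁ c | []    = inj₁ (link c)
... | inj₁ c | _ ∷ _ = inj₂ (fork c)

chain-leaf : ∀ {t} k → Chain t → leavesT (suc k) t ≡ (k ℕ.+ size t) ∷ []
chain-leaf k end = cong (_∷ []) (sym (ℕ.+-comm k 1))
chain-leaf k (link {t} c) = List.++-identityʳ _ ∙ chain-leaf (suc k) c ∙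
  cong (_∷ []) (sym (ℕ.+-suc k (size t)) ∙ cong (λ n → k ℕ.+ suc n) (sym (ℕ.+-identityʳ (size t))))

-- Listed from the deepest edge upwards, the order in which the rows of the branch are eliminated.
descend : ∀ {t} → ℕ → Chain t → List Edge
descend k end      = []
descend k (link c) = descend (suc k) c ++ (k , suc k) ∷ []

descend-↭ : ∀ {t} k (c : Chain t) → descend k c ↭ edgesT k t
descend-↭ k end = refl
descend-↭ k (link {t} c) = trans (++-comm (descend (suc k) c) _)
  (prep (k , suc k) (trans (descend-↭ (suc k) c) (↭-reflexive (sym (List.++-identityʳ (edgesT (suc k) t))))))

descend-above : ∀ {t} k (c : Chain t) → All (Above k) (descend k c)
descend-above k end      = []
descend-above k (link c) = All.++⁺ (All.map (λ (h₁ , h₂) → ℕ.<⇒≤ h₁ , ℕ.<⇒≤ h₂) (descend-above (suc k) c)) ((ℕ.≤-refl , ℕ.n≤1+n k) ∷ [])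

size>0 : ∀ t → 0 < size t
size>0 (node f) = s≤s z≤n

descend-below : ∀ {t} k (c : Chain t) → All (Below (k ℕ.+ size t)) (descend k c)
descend-below k end = []
descend-below k (link {t} c) = All.++⁺ (All.map (λ (h₁ , h₂) → ℕ.≤-trans h₁ le , ℕ.≤-trans h₂ le) (descend-below (suc k) c))
  ((ℕ.≤-trans (ℕ.m≤m+n (suc k) (size t)) le , ℕ.≤-trans (ℕ.m<m+n (suc k) (size>0 t)) le) ∷ [])
  where
  le : suc k ℕ.+ size t ≤ k ℕ.+ suc (size t ℕ.+ 0)
  le = ℕ.≤-reflexive (sym (ℕ.+-suc k (size t)) ∙ cong (λ n → k ℕ.+ suc n) (sym (ℕ.+-identityʳ (size t))))

val-head : ∀ {u v w} → w ≢ u → w ≢ v → u ≢ v → val (∂ (w , v)) (ε (u , v)) ≢ 0ℤ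
val-head {u} {v} {w} w≢u w≢v u≢v eq with () ← sym eq ∙ cong₂ _-_ (cong₂ _+_ (ι-≢ (λ e → u≢v (sym e))) (ι-refl v)) (ε-≢ w≢u w≢v)

val-tail : ∀ {u v w} → w ≢ u → w ≢ v → u ≢ v → val (∂ (u , w)) (ε (u , v)) ≢ 0ℤ
val-tail {u} {v} {w} w≢u w≢v u≢v eq with () ← sym eq ∙ cong₂ _-_ (ε-≢ w≢u w≢v) (cong₂ _+_ (ι-refl u) (ι-≢ u≢v))

val-middle : ∀ {u v w} → u < v → v < w → val (∂ (v , w)) (ε (u , v)) ≢ 0ℤ
val-middle {u} {v} {w} u<v v<w eq with () ← sym eq ∙ cong₂ _-_
  (ε-≢ (ℕ.>⇒≢ (ℕ.<-trans u<v v<w)) (ℕ.>⇒≢ v<w)) (cong₂ _+_ (ι-≢ (ℕ.>⇒≢ u<v)) (ι-refl v))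

-- The matching is shifted by one: the row ending in the leaf takes the deepest edge, and every row
-- of the chain takes the edge directly above it. The last row is thus served by the column of
-- `(k , suc k)`, the top edge of the branch.
descend-triangular : ∀ {t} z k (c : Chain t) → z < k →
  Triangular (∂ (z , k ℕ.+ size t) ∷ map ∂ (descend (suc k) c)) (map ε (descend (suc k) c ++ (k , suc k) ∷ []))
descend-triangular z k end z<k rewrite ℕ.+-comm k 1 =
  single (val-head (ℕ.<⇒≢ z<k) (ℕ.<⇒≢ (ℕ.m<n⇒m<1+n z<k)) (ℕ.<⇒≢ ℕ.≤-refl)) [] []
descend-triangular z k (link {t} c) z<k =
  Triangular-cong
    (cong₂ _∷_ (cong (λ n → ∂ (z , n)) (sym (ℕ.+-suc k (size t)) ∙ cong (λ n → k ℕ.+ suc n) (sym (ℕ.+-identityʳ (size t)))))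
               (sym (List.map-++ ∂ (descend (suc (suc k)) c) _)))
    (sym (List.map-++ ε (descend (suc (suc k)) c ++ (suc k , suc (suc k)) ∷ []) _))
    (Triangular-++ (descend-triangular z (suc k) c (ℕ.m<n⇒m<1+n z<k))
      ((∂-vanish (z , suc k ℕ.+ size t) (ε (k , suc k)) (ε-above {k} (ℕ.≤-refl , ℕ.n≤1+n k) z<k)
          (ε-≢ (ℕ.>⇒≢ (ℕ.<-trans ℕ.≤-refl (ℕ.m<m+n (suc k) (size>0 t)))) (ℕ.>⇒≢ (ℕ.m<m+n (suc k) (size>0 t)))) ∷ []) ∷
       All.map⁺ (All.map (λ {e} (h₁ , h₂) → ∂-vanish e (ε (k , suc k)) (high h₁) (high h₂) ∷ []) (descend-above (suc (suc k)) c)))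
      (single (val-middle ℕ.≤-refl ℕ.≤-refl) [] []))
  where
  high : ∀ {x} → suc (suc k) ≤ x → ε (k , suc k) x ≡ 0ℤ
  high h = ε-≢ (ℕ.>⇒≢ (ℕ.<⇒≤ h)) (ℕ.>⇒≢ h)

Outside : ℕ → ℕ → ℕ → Set
Outside c b x = x ≤ c ⊎ b < x

-- c is the last vertex with two children on the leftmost path from k, b is the first
-- leaf, and b + 1 is the second child of c, with subtree u.
record SpineData (p k : ℕ) (t : Tree) : Set where
  field
    {c b}   : ℕ
    {u}     : Tree
    {leaf main mainCols leg} : List Edge
    c<b     : c < b
    k≤c     : k ≤ c
    split   : stem p k t ↭ leaf ++ main ++ leg
    leaves  : leavesT k t ≡ b ∷ map proj₂ leaf
    -- The additional `(c , suc b)` on the right is a second use of that edge, which the combination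
    -- of tree edges has to give up.
    bag     : mainCols ++ leg ++ (c , suc c) ∷ [] ⊑ (c , suc b) ∷ edgesT k t
    fork∈   : ∀ χ g → (Flux.coefficient χ g (suc b) u , c , suc b) ∈ Flux.formT χ g k t
    main-triangular : Triangular (map ∂ main) (map ε mainCols)
    main-below : All (Below (k ℕ.+ size t)) main
    main-above : All (Above k) mainCols
    -- The leg lives on labels above `c` and at most `b`, so these columns vanish on its rows.
    main-outside : All (λ e → Outside c b (proj₁ e) × Outside c b (proj₂ e)) mainCols
    leg-triangular : ∀ z → z < k → Triangular (∂ (z , b) ∷ map ∂ leg) (map ε (leg ++ (c , suc c) ∷ []))
    leg-inside : All (λ e → (c < proj₁ e × proj₁ e ≤ b) × (c < proj₂ e × proj₂ e ≤ b)) leg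

spineData : ∀ {t} p k → p < k → Spine t → SpineData p k t
spineData {node (t ∷ u ∷ f)} p k p<k (fork ch) = record
  { c = k ; b = k ℕ.+ size t ; u = u
  ; leaf = leafF k d (u ∷ f)
  ; main = (p , k) ∷ (k , suc k) ∷ intF k d (u ∷ f)
  -- The edge to the second child serves both the row above the fork and the row of the edge to the
  -- first child. The column of the latter edge is thereby free for the leg.
  ; mainCols = (k , d) ∷ (k , d) ∷ map next (intF k d (u ∷ f))
  ; leg = descend (suc k) ch
  ; c<b = ℕ.m<m+n k (size>0 t)
  ; k≤c = ℕ.≤-refl
  ; split = split
  ; leaves = cong₂ _++_ (chain-leaf k ch) (sym (leaves-leafF k d (u ∷ f)))
  ; bag = bag
  ; fork∈ = λ χ g → there (∈-++⁺ʳ (Flux.formT χ g (suc k) t) (here refl))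
  ; main-triangular = double (val-next′ p<k) (val-tail (ℕ.>⇒≢ ℕ.≤-refl) (ℕ.<⇒≢ sk<d) (ℕ.<⇒≢ k<d))
      (below-kills-above {d} {p , k} (ℕ.<-trans p<k k<d , k<d) (int-above k d (u ∷ f)))
      (below-kills-above {d} {k , suc k} (k<d , sk<d) (int-above k d (u ∷ f)))
      (int-triangular k d (u ∷ f) k<d)
  ; main-below = (ℕ.<-trans p<k k<K , k<K) ∷ (k<K , sk<K) ∷ int-below
  ; main-above = (ℕ.≤-refl , ℕ.<⇒≤ k<d) ∷ (ℕ.≤-refl , ℕ.<⇒≤ k<d) ∷
      All.map (λ (h₁ , h₂) → ℕ.≤-trans (ℕ.<⇒≤ k<d) h₁ , ℕ.≤-trans (ℕ.<⇒≤ k<d) h₂) (int-above k d (u ∷ f))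
  ; main-outside = (inj₁ ℕ.≤-refl , inj₂ ℕ.≤-refl) ∷ (inj₁ ℕ.≤-refl , inj₂ ℕ.≤-refl) ∷
      All.map (λ (h₁ , h₂) → inj₂ h₁ , inj₂ h₂) (int-above k d (u ∷ f))
  ; leg-triangular = λ z z<k → descend-triangular z k ch z<k
  ; leg-inside = All.zipWith (λ ((l₁ , l₂) , (r₁ , r₂)) → (l₁ , ℕ.≤-pred r₁) , (l₂ , ℕ.≤-pred r₂)) (descend-above (suc k) ch , descend-below (suc k) ch)
  }
  where
  d = suc k ℕ.+ size t
  K = k ℕ.+ size (node (t ∷ u ∷ f))
  sk<d : suc k < d
  sk<d = ℕ.m<m+n (suc k) (size>0 t)
  k<d : k < d
  k<d = ℕ.<-trans ℕ.≤-refl sk<d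
  dK : d ℕ.+ sizeF (u ∷ f) ≡ K
  dK = ℕ.+-assoc (suc k) (size t) (sizeF (u ∷ f)) ∙ sym (ℕ.+-suc k _)
  d≤K : d ≤ K
  d≤K = ℕ.≤-trans (ℕ.m≤m+n d _) (ℕ.≤-reflexive dK)
  k<K : k < K
  k<K = ℕ.<-≤-trans k<d d≤K
  sk<K : suc k < K
  sk<K = ℕ.<-≤-trans sk<d d≤K
  val-next′ : ∀ {p} → p < k → val (∂ (p , k)) (ε (k , d)) ≢ 0ℤ
  val-next′ {p} p<k eq with () ← sym eq ∙ cong₂ _-_ (cong₂ _+_ (ι-refl k) (ι-≢ (ℕ.<⇒≢ k<d))) (ε-above {k} (ℕ.≤-refl , ℕ.<⇒≤ k<d) p<k)
  int-below : All (Below K) (intF k d (u ∷ f))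
  int-below = All.zipWith (λ (h₁ , h₂) → ℕ.<-trans h₁ (ℕ.<-≤-trans h₂ (ℕ.≤-reflexive dK)) , ℕ.<-≤-trans h₂ (ℕ.≤-reflexive dK))
    (int-ascending k d (u ∷ f) k<d , All.map⁻ (Sublist.All-resp-⊆ (intF⊆ k d (u ∷ f)) (range-< d (sizeF (u ∷ f)))))
  open ++-Solver
  split : (p , k) ∷ (k , suc k) ∷ edgesT (suc k) t ++ edgesF k d (u ∷ f) ↭
          leafF k d (u ∷ f) ++ ((p , k) ∷ (k , suc k) ∷ intF k d (u ∷ f)) ++ descend (suc k) ch
  split = trans (prep (p , k) (prep (k , suc k) (++⁺ (↭-sym (descend-↭ (suc k) ch)) (splitF k d (u ∷ f)))))
    (solve 4 (λ e l a b → (e ⊕ (b ⊕ (l ⊕ a))) ⊜ (l ⊕ ((e ⊕ a) ⊕ b))) refl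
      ((p , k) ∷ (k , suc k) ∷ []) (leafF k d (u ∷ f)) (intF k d (u ∷ f)) (descend (suc k) ch))
  bag : ((k , d) ∷ (k , d) ∷ map next (intF k d (u ∷ f))) ++ descend (suc k) ch ++ (k , suc k) ∷ [] ⊑
        (k , d) ∷ (k , suc k) ∷ edgesT (suc k) t ++ edgesF k d (u ∷ f)
  bag = subst (λ N → ((k , d) ∷ (k , d) ∷ N) ++ descend (suc k) ch ++ (k , suc k) ∷ [] ⊑ (k , d) ∷ (k , suc k) ∷ edgesT (suc k) t ++ edgesF k d (u ∷ f))
    (sym (List.map-++ next (intT k d u) _))
    (⊑-↭ (⊑-++ (⊑-++ (⊑-refl {xs = (k , d) ∷ (k , d) ∷ []}) (⊑-++ (next-intT k d u) (next-intF k (d ℕ.+ size u) f)))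
               (⊑-refl {xs = descend (suc k) ch ++ (k , suc k) ∷ []}))
         (trans (++⁺ˡ (((k , d) ∷ (k , d) ∷ []) ++ edgesT d u ++ edgesF k (d ℕ.+ size u) f) (++⁺ʳ _ (descend-↭ (suc k) ch)))
           (solve 5 (λ x y a b e → ((x ⊕ x) ⊕ (a ⊕ b)) ⊕ (e ⊕ y) ⊜ x ⊕ (y ⊕ (e ⊕ (x ⊕ (a ⊕ b))))) refl
             ((k , d) ∷ []) ((k , suc k) ∷ []) (edgesT d u) (edgesF k (d ℕ.+ size u) f) (edgesT (suc k) t))))
spineData {node (t ∷ f)} p k p<k (down s) = record
  { u = u
  ; leaf = leaf ++ leafF k K f
  ; main = (p , k) ∷ main ++ intF k K f
  ; mainCols = (k , suc k) ∷ mainCols ++ map next (intF k K f)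
  ; c<b = c<b
  ; k≤c = ℕ.<⇒≤ k≤c
  ; split = split′
  ; leaves = cong₂ _++_ leaves (sym (leaves-leafF k K f)) ∙ cong (b ∷_) (sym (List.map-++ proj₂ leaf (leafF k K f)))
  ; bag = bag′
  ; fork∈ = λ χ g → there (∈-++⁺ˡ (fork∈ χ g))
  ; main-triangular = single (val-next p<k)
      (below-kills-above {suc k} {p , k} (ℕ.m<n⇒m<1+n p<k , ℕ.≤-refl) (All.++⁺ main-above int-above′))
      (Triangular-cong (sym (List.map-++ ∂ main _)) (sym (List.map-++ ε mainCols _))
        (Triangular-++ main-triangular (All-below-kills-above main-below (int-above k K f)) (int-triangular k K f k<K)))
  ; main-below = (ℕ.<-trans p<k k<N , k<N) ∷ All.++⁺ (All.map (λ (h₁ , h₂) → ℕ.<-≤-trans h₁ K≤N , ℕ.<-≤-trans h₂ K≤N) main-below) int-below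
  ; main-above = (ℕ.≤-refl , ℕ.n≤1+n k) ∷ All.map (λ (h₁ , h₂) → ℕ.<⇒≤ h₁ , ℕ.<⇒≤ h₂) (All.++⁺ main-above int-above′)
  ; main-outside = (inj₁ (ℕ.<⇒≤ k≤c) , inj₁ k≤c) ∷ All.++⁺ main-outside
      (All.map (λ (h₁ , h₂) → inj₂ (ℕ.<-≤-trans b<K h₁) , inj₂ (ℕ.<-≤-trans b<K h₂)) (int-above k K f))
  ; leg-triangular = λ z z<k → leg-triangular z (ℕ.m<n⇒m<1+n z<k)
  ; leg-inside = leg-inside
  }
  where
  open SpineData (spineData k (suc k) ℕ.≤-refl s)
  K = suc k ℕ.+ size t
  N = k ℕ.+ size (node (t ∷ f))
  k<K : k < K
  k<K = ℕ.m≤m+n (suc k) (size t)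
  KN : K ℕ.+ sizeF f ≡ N
  KN = ℕ.+-assoc (suc k) (size t) (sizeF f) ∙ sym (ℕ.+-suc k _)
  K≤N : K ≤ N
  K≤N = ℕ.≤-trans (ℕ.m≤m+n K _) (ℕ.≤-reflexive KN)
  k<N : k < N
  k<N = ℕ.<-≤-trans k<K K≤N
  b<K : b < K
  b<K = All.head (subst (All (_< K)) leaves (Sublist.All-resp-⊆ (leavesT⊆ (suc k) t) (range-< (suc k) (size t))))
  int-above′ : All (Above (suc k)) (map next (intF k K f))
  int-above′ = All.map (λ (h₁ , h₂) → ℕ.≤-trans k<K h₁ , ℕ.≤-trans k<K h₂) (int-above k K f)
  int-below : All (Below N) (intF k K f)
  int-below = All.zipWith (λ (h₁ , h₂) → ℕ.<-trans h₁ (ℕ.<-≤-trans h₂ (ℕ.≤-reflexive KN)) , ℕ.<-≤-trans h₂ (ℕ.≤-reflexive KN))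
    (int-ascending k K f k<K , All.map⁻ (Sublist.All-resp-⊆ (intF⊆ k K f) (range-< K (sizeF f))))
  open ++-Solver
  split′ : (p , k) ∷ stem k (suc k) t ++ edgesF k K f ↭ (leaf ++ leafF k K f) ++ ((p , k) ∷ main ++ intF k K f) ++ leg
  split′ = trans (prep (p , k) (++⁺ split (splitF k K f)))
    (solve 6 (λ x a b c d e → (x ⊕ ((a ⊕ (b ⊕ c)) ⊕ (d ⊕ e))) ⊜ ((a ⊕ d) ⊕ ((x ⊕ (b ⊕ e)) ⊕ c))) refl
      ((p , k) ∷ []) leaf main leg (leafF k K f) (intF k K f))
  bag′ : ((k , suc k) ∷ mainCols ++ map next (intF k K f)) ++ leg ++ (c , suc c) ∷ [] ⊑ (c , suc b) ∷ stem k (suc k) t ++ edgesF k K f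
  bag′ = ↭-⊑ (solve 5 (λ x m n l e → ((x ⊕ (m ⊕ n)) ⊕ (l ⊕ e)) ⊜ (x ⊕ ((m ⊕ (l ⊕ e)) ⊕ n))) refl
                 ((k , suc k) ∷ []) mainCols (map next (intF k K f)) leg ((c , suc c) ∷ []))
    (⊑-↭ (⊑-++ (⊑-refl {xs = (k , suc k) ∷ []}) (⊑-++ bag (next-intF k K f)))
      (swap (k , suc k) (c , suc b) refl))

eval-↭ : ∀ {F G} → F ↭ G → ∀ x → eval F x ≡ eval G x
eval-↭ refl                       x = refl
eval-↭ (prep (c , e) p)           x = cong (c * ε e x +_) (eval-↭ p x)
eval-↭ (swap (c , e) (c′ , e′) p) x = cong (λ z → c * ε e x + (c′ * ε e′ x + z)) (eval-↭ p x) ∙ lemma (c * ε e x) (c′ * ε e′ x) _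
  where
  lemma : ∀ a b z → a + (b + z) ≡ b + (a + z)
  lemma = solve-∀
eval-↭ (trans p q)                x = eval-↭ p x ∙ eval-↭ q x

∈⇒↭ : ∀ {A : Set} {x : A} {xs} → x ∈ xs → ∃ λ ys → xs ↭ x ∷ ys
∈⇒↭ m with ys , zs , refl ← ∈-∃++ m = ys ++ zs , shift _ ys zs

-- A term with coefficient zero still counts in the support; removing it frees one use of its edge.
drop-zero : ∀ {c e F} → (c , e) ∈ F → c ≡ 0ℤ → ∃ λ G → support F ↭ e ∷ support G × (∀ x → eval G x ≡ eval F x)
drop-zero {e = e} m refl with G , p ← ∈⇒↭ m =
  G , map⁺ proj₂ p , λ x → sym (eval-↭ p x ∙ ℤ.+-identityˡ (eval G x))

SameSide : ℕ → ℕ → ℕ → Set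
SameSide K a b = (a < K × b < K) ⊎ (K ≤ a × K ≤ b)

module _ (t : Tree) (χ : ℕ → Bool) (proper : All (Proper χ) (edgesF 0 1 (t ∷ []))) (sp : SpineData 0 1 t) {y i a b₂ : ℕ} {ys : List ℕ}
         (eq : map proj₂ (SpineData.leaf sp) ≡ y ∷ ys) (ata : At i a (y ∷ ys)) (atb : At (suc i) b₂ (y ∷ ys)) where

  open SpineData sp
  private
    f : Forest
    f = t ∷ []
    E = edgesF 0 1 f
    l = lastOr y ys
    path = pathEdges (y ∷ ys)
    S : List ℕ
    S = y ∷ ys

    leaves′ : leavesF 1 f ≡ b ∷ S
    leaves′ = List.++-identityʳ _ ∙ leaves ∙ cong (b ∷_) eq
    leaf∈ : ∀ {x} → x ∈ b ∷ S → x ∈ leavesF 1 f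
    leaf∈ = subst (_ ∈_) (sym leaves′)
    bounds : ∀ {x} → x ∈ b ∷ S → 1 ≤ x × x < 1 ℕ.+ sizeF f
    bounds m = All.lookup (leaves-≥ 1 f) (leaf∈ m) , All.lookup (leaves-< 1 f) (leaf∈ m)
    above-b : All (b <_) S
    above-b = AllPairs.head (subst (AllPairs _<_) leaves′ (leaves-sorted 1 f))
    parents-off : All (λ e → proj₁ e ∉ S) E
    parents-off = All.map (λ h m → h (leaf∈ (there m))) (parents-off-leaves 0 1 f ℕ.≤-refl)
    0∉S : 0 ∉ S
    0∉S m with () ← proj₁ (bounds (there m))
    b∉S : b ∉ S
    b∉S m = ℕ.<⇒≢ (All.lookup above-b m) refl
    E↭ : E ↭ leaf ++ main ++ leg
    E↭ = trans (↭-reflexive (List.++-identityʳ _)) split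
    split-parents = All-resp-↭ E↭ parents-off

    late lateCols : List Edge
    late = (0 , b) ∷ leg ++ main
    lateCols = (leg ++ (c , suc c) ∷ []) ++ mainCols

    outside-kill : ∀ {x e} → c < x → x ≤ b → Outside c b (proj₁ e) × Outside c b (proj₂ e) → ε e x ≡ 0ℤ
    outside-kill {x} c<x x≤b (o₁ , o₂) = ε-≢ (apart o₁) (apart o₂)
      where
      apart : ∀ {z} → Outside c b z → x ≢ z
      apart (inj₁ z≤c) refl = ℕ.<⇒≱ c<x z≤c
      apart (inj₂ b<z) refl = ℕ.<⇒≱ b<z x≤b

    late-triangular : Triangular (map ∂ late) (map ε lateCols)
    late-triangular = Triangular-cong (cong (∂ (0 , b) ∷_) (sym (List.map-++ ∂ leg main))) (sym (List.map-++ ε (leg ++ (c , suc c) ∷ []) mainCols))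
      (Triangular-++ (leg-triangular 0 (s≤s z≤n))
        (All.map⁺ (All.zipWith (λ {e} (ab , o) → ∂-vanish (0 , b) (ε e) (ε-above ab (s≤s z≤n)) (outside-kill c<b ℕ.≤-refl o)) (main-above , main-outside)) ∷
         All.map⁺ (All.map (λ {e} ((h₁ , h₂) , (h₃ , h₄)) → All.map⁺ (All.map (λ {e′} o → ∂-vanish e (ε e′) (outside-kill h₁ h₂ o) (outside-kill h₃ h₄ o)) main-outside)) leg-inside))
        main-triangular)

    late-off : All (BothOff S) late
    late-off = (0∉S , b∉S) ∷ All-resp-↭ (++-comm main leg) (All.zip (All.++⁻ʳ leaf split-parents ,
      All.map (λ h m → h (subst (_ ∈_) (sym eq) m)) (split-disjoint (edges-unique 0 1 f) E↭)))

  open Flux χ (twoPoint χ a b₂)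

  -- The coefficient is the weighted sum over the subtree `u`, whose labels run from `suc b` to just
  -- below the bound. Both leaves lie beyond `b`, so they are either both inside, where they cancel,
  -- or both outside.
  zero-coefficient : SameSide (suc b ℕ.+ size u) a b₂ → coefficient (suc b) u ≡ 0ℤ
  zero-coefficient side = cong (sgn (χ (suc b)) *_) (sum side) ∙ ℤ.*-zeroʳ (sgn (χ (suc b)))
    where
    sum : SameSide (suc b ℕ.+ size u) a b₂ → rsum h (suc b) (size u) ≡ 0ℤ
    sum (inj₁ (a< , b<)) = twoPoint-inside χ a b₂ (All.lookup above-b (At⇒∈ ata)) a< (All.lookup above-b (At⇒∈ atb)) b<
    sum (inj₂ (a≥ , b≥)) = twoPoint-outside χ a b₂ {suc b} {size u} a≥ b≥

  certificate′ : SameSide (suc b ℕ.+ size u) a b₂ → Block (suc (length ys)) 1ℤ i (χ a) (χ b₂) ≢ 0ℤ →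
                 Certificate (halin b (y ∷ ys) E)
  certificate′ side nz with G , supp , evalG ← drop-zero (∈-++⁺ˡ {ys = formF 0 (1 ℕ.+ size t) []} (fork∈ χ (twoPoint χ a b₂))) (zero-coefficient side) =
    assemble {late = late} {lateCols = lateCols} {leaf = leaf} {u = b} {w = 0} {s = 1ℤ} {χ = χ} {C = C} {G = (coefficient 1 t , 0 , 1) ∷ G}
      (trans (++⁺ʳ _ E↭) rows)
      late-triangular eq (sorted⇒unique (AllPairs.tail (subst (AllPairs _<_) leaves′ (leaves-sorted 1 f))))
      late-off b∉S 0∉S (All.++⁻ˡ leaf split-parents)
      (λ x → closing (ι 0 x) (ι b x) (ι y x) (ι l x))
      (λ x → cong (coefficient 1 t * ε (0 , 1) x +_) (evalG x) ∙
        eval-twoPoint χ a b₂ {f = f} proper (proj₁ ba) (proj₂ ba) (proj₁ bb) (proj₂ bb) x)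
      ata atb nz
      (⊑-↭ (⊑-++ (↭-⊑ (++-comm (leg ++ (c , suc c) ∷ []) mainCols) (⊑-trans bag bag-E)) (⊑-refl {xs = support C ++ support C ++ ((0 , 1) ∷ support G) ++ path ++ path})) (bags supp))
    where
    C : Form
    -- Alternating signs along the walk from `y` over `b` and 0 to `l` cancel the inner vertices;
    -- having three edges, the walk leaves both ends with a plus sign.
    C = (1ℤ , b , y) ∷ (- 1ℤ , 0 , b) ∷ (1ℤ , 0 , l) ∷ []
    ba = bounds (there (At⇒∈ ata))
    bb = bounds (there (At⇒∈ atb))
    closing : ∀ o b y l → 1ℤ * (b + y) + (- 1ℤ * (o + b) + (1ℤ * (o + l) + 0ℤ)) ≡ 1ℤ * y + 1ℤ * l
    closing = solve-∀
    open ++-Solver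
    rows : (leaf ++ main ++ leg) ++ (0 , b) ∷ ((b , y) ∷ path) ++ (0 , l) ∷ [] ↭ late ++ leaf ++ (b , y) ∷ path ++ (0 , l) ∷ []
    rows = solve 5 (λ a b c d e → ((a ⊕ (b ⊕ c)) ⊕ (d ⊕ e)) ⊜ ((d ⊕ (c ⊕ b)) ⊕ (a ⊕ e))) refl
      leaf main leg ((0 , b) ∷ []) ((b , y) ∷ path ++ (0 , l) ∷ [])
    bag-E : (c , suc b) ∷ edgesT 1 t ⊑ (c , suc b) ∷ E
    bag-E = (0 , 1) ∷ [] , prep (c , suc b) (trans (++-comm (edgesT 1 t) _) (prep (0 , 1) (↭-reflexive (sym (List.++-identityʳ (edgesT 1 t))))))
    bags : ∀ {G} → support (formT 1 t ++ []) ↭ (c , suc b) ∷ support G →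
           ((c , suc b) ∷ E) ++ support C ++ support C ++ ((0 , 1) ∷ support G) ++ path ++ path ↭ halin b (y ∷ ys) E ++ halin b (y ∷ ys) E
    bags {G} supp = trans
      (solve 8 (λ x e u v w o g p → ((x ⊕ e) ⊕ ((u ⊕ (v ⊕ w)) ⊕ ((u ⊕ (v ⊕ w)) ⊕ ((o ⊕ g) ⊕ (p ⊕ p))))) ⊜
                                      ((e ⊕ (v ⊕ ((u ⊕ p) ⊕ w))) ⊕ ((o ⊕ (x ⊕ g)) ⊕ (v ⊕ ((u ⊕ p) ⊕ w))))) refl
        ((c , suc b) ∷ []) E ((b , y) ∷ []) ((0 , b) ∷ []) ((0 , l) ∷ []) ((0 , 1) ∷ []) (support G) path)
      (++⁺ˡ (halin b (y ∷ ys) E) (++⁺ʳ ((0 , b) ∷ ((b , y) ∷ path) ++ (0 , l) ∷ [])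
        (prep (0 , 1) (trans (↭-sym supp) (↭-reflexive (List.map-++ proj₂ (formT 1 t) [] ∙ cong (_++ []) (support-formT 1 t)))))))

-- Choice of the construction by the number of leaves modulo six.

-- A single threshold cannot separate both of two consecutive pairs.
same-side : ∀ {K u v w} → u < v → v < w → SameSide K u v ⊎ SameSide K v w
same-side {K} {v = v} u<v v<w with v ℕ.<? K
... | yes v<K = inj₁ (inj₁ (ℕ.<-trans u<v v<K , v<K))
... | no v≮K  = inj₂ (inj₂ (ℕ.≮⇒≥ v≮K , ℕ.≤-trans (ℕ.≮⇒≥ v≮K) (ℕ.<⇒≤ v<w)))

data Mod6 : ℕ → Set where
  mod6 : ∀ j r → r < 6 → Mod6 (j ℕ.* 6 ℕ.+ r)

toMod6 : ∀ m → Mod6 m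
toMod6 0 = mod6 0 0 (s≤s z≤n)
toMod6 1 = mod6 0 1 (s≤s (s≤s z≤n))
toMod6 2 = mod6 0 2 (s≤s (s≤s (s≤s z≤n)))
toMod6 3 = mod6 0 3 (s≤s (s≤s (s≤s (s≤s z≤n))))
toMod6 4 = mod6 0 4 (s≤s (s≤s (s≤s (s≤s (s≤s z≤n)))))
toMod6 5 = mod6 0 5 ℕ.≤-refl
toMod6 (suc (suc (suc (suc (suc (suc m)))))) with toMod6 m
... | mod6 j r r<6 = mod6 (suc j) r r<6

Balanced : (ℕ → Bool) → List ℕ → Set
Balanced χ (x ∷ y ∷ []) = χ x ≡ χ y
Balanced χ _            = ⊤

module _ (t : Tree) (χ : ℕ → Bool) (proper : All (Proper χ) (edgesF 0 1 (t ∷ []))) where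

  private
    E = edgesF 0 1 (t ∷ [])

  -- The case where the first leaf of t is left out of the path block.
  module _ {x y₁ y₂ y₃ y₄ : ℕ} {zs : List ℕ} (eq : leavesF 1 (t ∷ []) ≡ x ∷ y₁ ∷ y₂ ∷ y₃ ∷ y₄ ∷ zs) where

    private
      eqT : leavesT 1 t ≡ x ∷ y₁ ∷ y₂ ∷ y₃ ∷ y₄ ∷ zs
      eqT = sym (List.++-identityʳ (leavesT 1 t)) ∙ eq
      sorted = subst (AllPairs _<_) eq (leaves-sorted 1 (t ∷ []))

    -- The alternatives offer the indices 0, 1 or 1, 2; at least one of the two corresponding pairs
    -- of leaves is not separated. Without `x` the block has `4 + length zs` vertices, written as
    -- `5 + (length zs ∸ 1)` to match `Block-periodic`.
    certificate-from-second-leaf : (∀ i → i < 2 → ∀ c c′ → Block (5 ℕ.+ (length zs ℕ.∸ 1)) 1ℤ i c c′ ≢ 0ℤ) ⊎ (∀ i → 1 ≤ i → i < 3 → ∀ c c′ → Block (5 ℕ.+ (length zs ℕ.∸ 1)) 1ℤ i c c′ ≢ 0ℤ) →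
            1 ≤ length zs → Certificate (halin x (y₁ ∷ y₂ ∷ y₃ ∷ y₄ ∷ zs) E)
    certificate-from-second-leaf nz zs≢[] with chain-or-spine t
    ... | inj₁ ch with () ← sym (chain-leaf 0 ch) ∙ eqT
    ... | inj₂ sp with spineData 0 1 ℕ.≤-refl sp
    ...   | sd with List.∷-injective (sym (SpineData.leaves sd) ∙ eqT)
    ...     | refl , eq′ = go nz (AllPairs.tail sorted)
      where
      len : ∀ {s i c c′} → Block (5 ℕ.+ (length zs ℕ.∸ 1)) s i c c′ ≢ 0ℤ → Block (4 ℕ.+ length zs) s i c c′ ≢ 0ℤ
      len {s} {i} {c} {c′} = subst (λ n → Block n s i c c′ ≢ 0ℤ) (cong (4 ℕ.+_) (ℕ.m+[n∸m]≡n zs≢[]))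
      go : _ → AllPairs _<_ (y₁ ∷ y₂ ∷ y₃ ∷ y₄ ∷ zs) → Certificate (halin x (y₁ ∷ y₂ ∷ y₃ ∷ y₄ ∷ zs) E)
      go (inj₁ nz) ((h₁₂ ∷ _) ∷ (h₂₃ ∷ _) ∷ _) with same-side h₁₂ h₂₃
      ... | inj₁ side = certificate′ t χ proper sd eq′ here (there here) side (len {1ℤ} {0} {χ y₁} {χ y₂} (nz 0 (s≤s z≤n) (χ y₁) (χ y₂)))
      ... | inj₂ side = certificate′ t χ proper sd eq′ (there here) (there (there here)) side (len {1ℤ} {1} {χ y₂} {χ y₃} (nz 1 ℕ.≤-refl (χ y₂) (χ y₃)))
      go (inj₂ nz) (_ ∷ (h₂₃ ∷ _) ∷ (h₃₄ ∷ _) ∷ _) with same-side h₂₃ h₃₄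
      ... | inj₁ side = certificate′ t χ proper sd eq′ (there here) (there (there here)) side (len {1ℤ} {1} {χ y₂} {χ y₃} (nz 1 ℕ.≤-refl (s≤s (s≤s z≤n)) (χ y₂) (χ y₃)))
      ... | inj₂ side = certificate′ t χ proper sd eq′ (there (there here)) (there (there (there here))) side (len {1ℤ} {2} {χ y₃} {χ y₄} (nz 2 (s≤s z≤n) ℕ.≤-refl (χ y₃) (χ y₄)))

  -- Blocks of two, three and four leaves are treated directly, since periodicity sets in at five.
  halin-certificate : ∀ y ys → leavesF 1 (t ∷ []) ≡ y ∷ ys → 1 ≤ length ys → Balanced χ (y ∷ ys) → Certificate (halin y ys E)
  halin-certificate y₁ (y₂ ∷ []) eq _ bal =
    certificate (t ∷ []) χ proper eq here (there here)
      (subst (λ c → Block 2 (- 1ℤ) 0 (χ y₁) c ≢ 0ℤ) bal (block-minus-2-0 (χ y₁)))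
  halin-certificate y₁ (y₂ ∷ y₃ ∷ []) eq _ _ =
    certificate (t ∷ []) χ proper eq (there here) (there (there here)) (block-minus-3-1 (χ y₂) (χ y₃))
  halin-certificate y₁ (y₂ ∷ y₃ ∷ y₄ ∷ []) eq _ _ =
    certificate (t ∷ []) χ proper eq here (there here) (block-minus-4-0 (χ y₁) (χ y₂))
  halin-certificate y₁ (y₂ ∷ y₃ ∷ y₄ ∷ y₅ ∷ zs) eq _ _ = go (toMod6 (length zs)) refl
    where
    -- The number of non-root leaves is n = 5 + m, so the residues 1 and 2 of m are the cases n ≡ 0
    -- and n ≡ 1.
    go : ∀ {m} → Mod6 m → length zs ≡ m → Certificate (halin y₁ (y₂ ∷ y₃ ∷ y₄ ∷ y₅ ∷ zs) E)
    go (mod6 j 0 _) len = certificate (t ∷ []) χ proper eq (there here) (there (there here))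
      (subst (λ m → Block (5 ℕ.+ m) (- 1ℤ) 1 (χ y₂) (χ y₃) ≢ 0ℤ) (sym len) (Block-periodic 0 (- 1ℤ) 1 (χ y₂) (χ y₃) (s≤s (s≤s (s≤s z≤n))) (block-minus-5-1 (χ y₂) (χ y₃)) j))
    go (mod6 j 1 _) len = certificate-from-second-leaf eq (inj₂ λ i 1≤i i<3 c c′ → subst (λ m → Block (5 ℕ.+ m) 1ℤ i c c′ ≢ 0ℤ) (sym pred) (nz i 1≤i i<3 c c′)) zs≢[]
      where
      pred : length zs ℕ.∸ 1 ≡ j ℕ.* 6 ℕ.+ 0
      pred = cong (ℕ._∸ 1) (len ∙ ℕ.+-suc (j ℕ.* 6) 0)
      zs≢[] : 1 ≤ length zs
      zs≢[] = subst (1 ≤_) (sym len) (ℕ.m≤n+m 1 (j ℕ.* 6))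
      nz : ∀ i → 1 ≤ i → i < 3 → ∀ c c′ → Block (5 ℕ.+ (j ℕ.* 6 ℕ.+ 0)) 1ℤ i c c′ ≢ 0ℤ
      nz 1 _ _ c c′ = Block-periodic 0 1ℤ 1 c c′ (s≤s (s≤s (s≤s z≤n))) (block-plus-5-1 c c′) j
      nz 2 _ _ c c′ = Block-periodic 0 1ℤ 2 c c′ ℕ.≤-refl (block-plus-5-2 c c′) j
      nz (suc (suc (suc _))) _ (s≤s (s≤s (s≤s ())))
    go (mod6 j 2 _) len = certificate-from-second-leaf eq (inj₁ λ i i<2 c c′ → subst (λ m → Block (5 ℕ.+ m) 1ℤ i c c′ ≢ 0ℤ) (sym pred) (nz i i<2 c c′)) zs≢[]
      where
      pred : length zs ℕ.∸ 1 ≡ j ℕ.* 6 ℕ.+ 1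
      pred = cong (ℕ._∸ 1) (len ∙ ℕ.+-suc (j ℕ.* 6) 1)
      zs≢[] : 1 ≤ length zs
      zs≢[] = subst (1 ≤_) (sym len) (ℕ.≤-trans (s≤s z≤n) (ℕ.m≤n+m 2 (j ℕ.* 6)))
      nz : ∀ i → i < 2 → ∀ c c′ → Block (5 ℕ.+ (j ℕ.* 6 ℕ.+ 1)) 1ℤ i c c′ ≢ 0ℤ
      nz 0 _ c c′ = Block-periodic 1 1ℤ 0 c c′ (s≤s (s≤s z≤n)) (block-plus-6-0 c c′) j
      nz 1 _ c c′ = Block-periodic 1 1ℤ 1 c c′ (s≤s (s≤s (s≤s z≤n))) (block-plus-6-1 c c′) j
      nz (suc (suc _)) (s≤s (s≤s ()))
    go (mod6 j 3 _) len = certificate (t ∷ []) χ proper eq (there here) (there (there here))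
      (subst (λ m → Block (5 ℕ.+ m) (- 1ℤ) 1 (χ y₂) (χ y₃) ≢ 0ℤ) (sym len) (Block-periodic 3 (- 1ℤ) 1 (χ y₂) (χ y₃) (s≤s (s≤s (s≤s z≤n))) (block-minus-8-1 (χ y₂) (χ y₃)) j))
    go (mod6 j 4 _) len = certificate (t ∷ []) χ proper eq (there here) (there (there here))
      (subst (λ m → Block (5 ℕ.+ m) (- 1ℤ) 1 (χ y₂) (χ y₃) ≢ 0ℤ) (sym len) (Block-periodic 4 (- 1ℤ) 1 (χ y₂) (χ y₃) (s≤s (s≤s (s≤s z≤n))) (block-minus-9-1 (χ y₂) (χ y₃)) j))
    go (mod6 j 5 _) len = certificate (t ∷ []) χ proper eq here (there here)
      (subst (λ m → Block (5 ℕ.+ m) (- 1ℤ) 0 (χ y₁) (χ y₂) ≢ 0ℤ) (sym len) (Block-periodic 5 (- 1ℤ) 0 (χ y₁) (χ y₂) (s≤s (s≤s z≤n)) (block-minus-10-0 (χ y₁) (χ y₂)) j))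
    go (mod6 j (suc (suc (suc (suc (suc (suc _)))))) (s≤s (s≤s (s≤s (s≤s (s≤s (s≤s ()))))))) len

-- From certificates to matrices of the graph.

sumFin-cong : ∀ {n} {g g′ : Fin n → ℤ} → (∀ i → g i ≡ g′ i) → sumFin g ≡ sumFin g′
sumFin-cong {zero}  eq = refl
sumFin-cong {suc n} eq = cong₂ _+_ (eq zero) (sumFin-cong (λ i → eq (suc i)))

perm-cong : ∀ {n} {M N : Fin n → Fin n → ℤ} → (∀ i j → M i j ≡ N i j) → perm M ≡ perm N
perm-cong {zero}  eq = refl
perm-cong {suc n} eq = sumFin-cong (λ j → cong₂ _*_ (eq zero j) (perm-cong (λ i j′ → eq (suc i) (punchIn j j′))))

ex-tabulate : ∀ {X : Set} {n} (k : X → List X → ℤ) (x : Fin (suc n) → X) →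
              ex k (tabulate x) ≡ sumFin (λ j → k (x j) (tabulate (x ∘ punchIn j)))
ex-tabulate {n = zero}  k x = refl
ex-tabulate {n = suc n} k x = cong (k (x zero) (tabulate (x ∘ suc)) +_) (ex-tabulate (λ y ys → k y (x zero ∷ ys)) (x ∘ suc))

perm-per : ∀ {n} (r : Fin n → Row) (x : Fin n → Column) → perm (λ i j → val (r i) (x j)) ≡ per (tabulate r) (tabulate x)
perm-per {zero}  r x = sym per-[]
perm-per {suc n} r x =
  sumFin-cong (λ j → cong (val (r zero) (x j) *_) (perm-per (r ∘ suc) (x ∘ punchIn j))) ∙
  sym (per-row (r zero) (tabulate (r ∘ suc)) (tabulate x) ∙ ex-tabulate (λ c cs → val (r zero) c * per (tabulate (r ∘ suc)) cs) x)

ex-≢0 : ∀ {X : Set} {k : X → List X → ℤ} xs → ex k xs ≢ 0ℤ → ∃ λ x → ∃ λ ys → k x ys ≢ 0ℤ × length xs ≡ suc (length ys)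
ex-≢0 [] nz = contradiction refl nz
ex-≢0 {k = k} (x ∷ xs) nz with k x xs ℤ.≟ 0ℤ
... | no nz′ = x , xs , nz′ , refl
... | yes z with y , ys , nz′ , len ← ex-≢0 {k = λ y ys → k y (x ∷ ys)} xs (λ z′ → nz (cong₂ _+_ z z′)) =
  y , x ∷ ys , nz′ , cong suc len

-- This supplies the number of selected edges: a nonzero permanent can only come from a square
-- matrix.
per-square : ∀ rs cs → per rs cs ≢ 0ℤ → length rs ≡ length cs
per-square []       []       nz = refl
per-square []       (c ∷ cs) nz = contradiction (per-zero-col c cs []) nz
per-square (r ∷ rs) cs       nz with c , cs′ , nz′ , len ← ex-≢0 cs (λ z → nz (per-row r rs cs ∙ z)) =
  cong suc (per-square rs cs′ (λ z → nz′ (cong (val r c *_) z ∙ ℤ.*-zeroʳ (val r c)))) ∙ sym len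

SameUpToSign : Row → Row → Set
SameUpToSign r s = (∀ f → val r f ≡ val s f) ⊎ (∀ f → val r f ≡ - val s f)

-- The labels of edges ascend, while the orientation of the graph is arbitrary; reversing an edge
-- negates its row.
per-sign : ∀ {rs ss} → Pointwise SameUpToSign rs ss → ∃ λ σ → ∀ cs → per rs cs ≡ σ * per ss cs
per-sign [] = 1ℤ , λ cs → sym (ℤ.*-identityˡ _)
per-sign {r ∷ rs} {s ∷ ss} (h ∷ p) with σ , eq ← per-sign p | h
... | inj₁ same = σ , λ cs → per-row r rs cs ∙
  ex-cong (λ c cs′ → cong₂ _*_ (same c) (eq cs′) ∙ lemma (val s c) σ (per ss cs′)) cs ∙ ex-* σ _ cs ∙ cong (σ *_) (sym (per-row s ss cs))
  where
  lemma : ∀ a b c → a * (b * c) ≡ b * (a * c)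
  lemma = solve-∀
... | inj₂ opp = - σ , λ cs → per-row r rs cs ∙
  ex-cong (λ c cs′ → cong₂ _*_ (opp c) (eq cs′) ∙ lemma (val s c) σ (per ss cs′)) cs ∙ ex-* (- σ) _ cs ∙ cong (- σ *_) (sym (per-row s ss cs))
  where
  lemma : ∀ a b c → - a * (b * c) ≡ - b * (a * c)
  lemma = solve-∀

both : {X Y : Set} → (X → Y) → X × X → Y × Y
both g (a , b) = g a , g b

-- A canonical representative of an undirected edge, so that edges can be compared by equality.
norm : Edge → Edge
norm (a , b) with a ℕ.≤? b
... | yes _ = a , b
... | no  _ = b , a

norm-cases : ∀ a b → norm (a , b) ≡ (a , b) ⊎ norm (a , b) ≡ (b , a)
norm-cases a b with a ℕ.≤? b
... | yes _ = inj₁ refl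
... | no  _ = inj₂ refl

norm-ascending : ∀ {a b} → a < b → norm (a , b) ≡ (a , b)
norm-ascending {a} {b} a<b with a ℕ.≤? b
... | yes _  = refl
... | no a≰b = contradiction (ℕ.<⇒≤ a<b) a≰b

norm-swap : ∀ a b → norm (a , b) ≡ norm (b , a)
norm-swap a b with a ℕ.≤? b | b ℕ.≤? a
... | yes a≤b | yes b≤a with refl ← ℕ.≤-antisym a≤b b≤a = refl
... | yes _   | no _    = refl
... | no _    | yes _   = refl
... | no a≰b  | no b≰a  = contradiction (ℕ.<⇒≤ (ℕ.≰⇒> a≰b)) b≰a

norm-injective : ∀ {a b c d} → norm (a , b) ≡ norm (c , d) → (a ≡ c × b ≡ d) ⊎ (a ≡ d × b ≡ c)
norm-injective {a} {b} {c} {d} eq with norm-cases a b | norm-cases c d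
... | inj₁ p | inj₁ q with refl ← sym p ∙ eq ∙ q = inj₁ (refl , refl)
... | inj₁ p | inj₂ q with refl ← sym p ∙ eq ∙ q = inj₂ (refl , refl)
... | inj₂ p | inj₁ q with refl ← sym p ∙ eq ∙ q = inj₂ (refl , refl)
... | inj₂ p | inj₂ q with refl ← sym p ∙ eq ∙ q = inj₁ (refl , refl)

ε-norm : ∀ a b x → ε (norm (a , b)) x ≡ ε (a , b) x
ε-norm a b x with norm-cases a b
... | inj₁ p = cong (λ e → ε e x) p
... | inj₂ p = cong (λ e → ε e x) p ∙ ℤ.+-comm (ι b x) (ι a x)

∂-norm : ∀ a b → SameUpToSign (∂ (norm (a , b))) (∂ (a , b))
∂-norm a b with norm-cases a b
... | inj₁ p = inj₁ (λ f → cong (λ e → val (∂ e) f) p)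
... | inj₂ p = inj₂ (λ f → cong (λ e → val (∂ e) f) p ∙ lemma (f a) (f b))
  where
  lemma : ∀ x y → x - y ≡ - (y - x)
  lemma = solve-∀

unique-↭ : ∀ {X : Set} {xs ys : List X} → Unique xs → Unique ys → (∀ {x} → x ∈ xs → x ∈ ys) → (∀ {x} → x ∈ ys → x ∈ xs) → xs ↭ ys
unique-↭ {xs = []} {[]}     _ _ _ _ = refl
unique-↭ {xs = []} {y ∷ ys} _ _ _ g with () ← g (here refl)
unique-↭ {xs = x ∷ xs} {ys} (hx ∷ ux) uy f g with ys′ , p ← ∈⇒↭ (f (here refl)) with hy ∷ uy′ ← Unique-resp-↭ p uy =
  trans (prep x (unique-↭ ux uy′ f′ g′)) (↭-sym p)
  where
  f′ : ∀ {z} → z ∈ xs → z ∈ ys′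
  f′ m with ∈-resp-↭ p (f (there m))
  ... | here refl = contradiction refl (All.lookup hx m)
  ... | there m′  = m′
  g′ : ∀ {z} → z ∈ ys′ → z ∈ xs
  g′ m with g (∈-resp-↭ (↭-sym p) (there m))
  ... | here refl = contradiction refl (All.lookup hy m)
  ... | there m′  = m′

map-++⁻ : ∀ {X Y : Set} (f : X → Y) zs xs {ys} → xs ++ ys ≡ map f zs → ∃ λ us → ∃ λ vs → zs ≡ us ++ vs × map f us ≡ xs
map-++⁻ f zs []       eq = [] , zs , refl , refl
map-++⁻ f (z ∷ zs) (x ∷ xs) eq with refl , eq′ ← List.∷-injective eq with us , vs , refl , refl ← map-++⁻ f zs xs eq′ =
  z ∷ us , vs , refl , refl

as-tabulate : ∀ {X : Set} n (xs : List X) → length xs ≡ n → ∃ λ (h : Fin n → X) → tabulate h ≡ xs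
as-tabulate zero    []       _  = (λ ()) , refl
as-tabulate (suc n) (x ∷ xs) eq with h , refl ← as-tabulate n xs (ℕ.suc-injective eq) = (λ { zero → x ; (suc i) → h i }) , refl

module _ {X : Set} (p : X → Bool) where

  count : List X → ℕ
  count []       = 0
  count (x ∷ xs) = (if p x then 1 else 0) ℕ.+ count xs

  count-++ : ∀ xs ys → count (xs ++ ys) ≡ count xs ℕ.+ count ys
  count-++ []       ys = refl
  count-++ (x ∷ xs) ys = cong ((if p x then 1 else 0) ℕ.+_) (count-++ xs ys) ∙ sym (ℕ.+-assoc (if p x then 1 else 0) (count xs) (count ys))

  count-↭ : ∀ {xs ys} → xs ↭ ys → count xs ≡ count ys
  count-↭ refl         = refl
  count-↭ (prep x q)   = cong ((if p x then 1 else 0) ℕ.+_) (count-↭ q)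
  count-↭ (swap {ys = ys} x y q) = cong (λ n → (if p x then 1 else 0) ℕ.+ ((if p y then 1 else 0) ℕ.+ n)) (count-↭ q) ∙
    sym (ℕ.+-assoc (if p x then 1 else 0) (if p y then 1 else 0) _) ∙
    cong (ℕ._+ count ys) (ℕ.+-comm (if p x then 1 else 0) (if p y then 1 else 0)) ∙ ℕ.+-assoc (if p y then 1 else 0) (if p x then 1 else 0) _
  count-↭ (trans q r)  = count-↭ q ∙ count-↭ r

  count-tabulate : ∀ {n} (h : Fin n → X) → countFin (p ∘ h) ≡ count (tabulate h)
  count-tabulate {zero}  h = refl
  count-tabulate {suc n} h = cong ((if p (h zero) then 1 else 0) ℕ.+_) (count-tabulate (h ∘ suc))

countFin-none : ∀ {n} (p : Fin n → Bool) → (∀ i → p i ≡ false) → countFin p ≡ 0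
countFin-none {zero}  p h = refl
countFin-none {suc n} p h rewrite h zero = countFin-none (p ∘ suc) (h ∘ suc)

countFin-≤1 : ∀ {n} (p : Fin n → Bool) → (∀ i j → p i ≡ true → p j ≡ true → i ≡ j) → countFin p ≤ 1
countFin-≤1 {zero}  p h = z≤n
countFin-≤1 {suc n} p h with p zero in eq
... | false = countFin-≤1 (p ∘ suc) (λ i j pi pj → Fin.suc-injective (h (suc i) (suc j) pi pj))
... | true  = s≤s (ℕ.≤-reflexive (countFin-none (p ∘ suc) none))
  where
  none : ∀ i → p (suc i) ≡ false
  none i with p (suc i) in eq′
  ... | false = refl
  ... | true with () ← h zero (suc i) eq eq′

edgeLabel : (G : Graph) → (Fin (nV G) → ℕ) → Fin (nE G) → Edge
edgeLabel G φ e = norm (both φ (ends G e))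

module _ (G : Graph) (φ : Fin (nV G) → ℕ) (φ-injective : Injective _≡_ _≡_ φ) where

  private
    tl hd : Fin (nE G) → Fin (nV G)
    tl e = proj₁ (ends G e)
    hd e = proj₂ (ends G e)
    label : Fin (nE G) → Edge
    label = edgeLabel G φ

  label-injective : ∀ {e f} → label e ≡ label f → e ≡ f
  label-injective {e} {f} eq with norm-injective eq
  ... | inj₁ (p , q) = noMulti G e f (inj₁ (φ-injective p , φ-injective q))
  ... | inj₂ (p , q) = noMulti G e f (inj₂ (φ-injective p , φ-injective q))

  ι-φ : ∀ v w → ι (φ v) (φ w) ≡ ind ⌊ w Fin.≟ v ⌋
  ι-φ v w with w Fin.≟ v
  ... | yes refl = ι-refl (φ v)
  ... | no w≢v   = ι-≢ (λ eq → w≢v (φ-injective eq))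

  incidence : ∀ f w → ind (incident G f w) ≡ ε (label f) (φ w)
  incidence f w = lemma ∙ cong₂ _+_ (sym (ι-φ (tl f) w)) (sym (ι-φ (hd f) w)) ∙ sym (ε-norm (φ (tl f)) (φ (hd f)) (φ w))
    where
    lemma : ind (⌊ w Fin.≟ tl f ⌋ ∨ ⌊ w Fin.≟ hd f ⌋) ≡ ind ⌊ w Fin.≟ tl f ⌋ + ind ⌊ w Fin.≟ hd f ⌋
    lemma with w Fin.≟ tl f | w Fin.≟ hd f
    ... | yes p | yes q = contradiction (sym p ∙ q) (loopless G f)
    ... | yes _ | no _  = refl
    ... | no _  | yes _ = refl
    ... | no _  | no _  = refl

  -- The matrix has 0 where the row and the column belong to the same edge. This agrees with the
  -- linear form, which takes the value 1 at both ends of that edge and so has difference 0.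
  entry : ∀ e f → A G e (inj₂ f) ≡ val (∂ (φ (tl e) , φ (hd e))) (ε (label f))
  entry e f with f Fin.≟ e
  ... | no _ = cong₂ _-_ (incidence f (hd e)) (incidence f (tl e))
  ... | yes refl = sym (cong₂ _-_
    (ε-norm (φ (tl f)) (φ (hd f)) _ ∙ cong₂ _+_ (ι-≢ (λ eq → loopless G f (sym (φ-injective eq)))) (ι-refl _))
    (ε-norm (φ (tl f)) (φ (hd f)) _ ∙ cong₂ _+_ (ι-refl _) (ι-≢ (λ eq → loopless G f (φ-injective eq)))))

  columns⇒PNS : ∀ fs → fs ⊑ allFin (nE G) ++ allFin (nE G) →
                per (map ∂ (map label (allFin (nE G)))) (map ε (map label fs)) ≢ 0ℤ → HasPNSMatrix 0 2 G
  columns⇒PNS fs (gs , bag) nz with as-tabulate (nE G) fs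
    (sym (sym (List.length-tabulate (λ i → i)) ∙ sym (List.length-map label (allFin (nE G))) ∙ sym (List.length-map ∂ (map label (allFin (nE G)))) ∙
          per-square _ _ nz ∙ List.length-map ε (map label fs) ∙ List.length-map label fs))
  ... | h , refl = (λ z → countFin (λ j → ⌊ _≟C_ {G} (inj₂ (h j)) z ⌋)) , no-vertices , at-most-two , inj₂ ∘ h , (λ z → refl) , nonsingular
    where
    no-vertices : ∀ v → countFin (λ j → ⌊ _≟C_ {G} (inj₂ (h j)) (inj₁ v) ⌋) ≤ 0
    no-vertices v = ℕ.≤-reflexive (countFin-none (λ j → ⌊ _≟C_ {G} (inj₂ (h j)) (inj₁ v) ⌋) (λ j → refl))
    at-most-two : ∀ e → countFin (λ j → ⌊ _≟C_ {G} (inj₂ (h j)) (inj₂ e) ⌋) ≤ 2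
    at-most-two e = begin
      countFin (is-e ∘ h)                   ≡⟨ count-tabulate is-e h ⟩
      count is-e fs                         ≤⟨ ℕ.m≤m+n _ _ ⟩
      count is-e fs ℕ.+ count is-e gs       ≡⟨ sym (count-++ is-e fs gs) ∙ count-↭ is-e bag ∙ count-++ is-e (allFin _) (allFin _) ⟩
      count is-e (allFin _) ℕ.+ count is-e (allFin _)
        ≤⟨ ℕ.+-mono-≤ once once ⟩
      2 ∎
      where
      open ℕ.≤-Reasoning
      is-e : Fin (nE G) → Bool
      is-e f = ⌊ _≟C_ {G} (inj₂ f) (inj₂ e) ⌋
      is-e-sound : ∀ f → is-e f ≡ true → f ≡ e
      is-e-sound f eq with f Fin.≟ e
      ... | yes p = p
      once : count is-e (allFin (nE G)) ≤ 1
      once = ℕ.≤-trans (ℕ.≤-reflexive (sym (count-tabulate is-e (λ i → i))))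
        (countFin-≤1 is-e (λ i j pi pj → is-e-sound i pi ∙ sym (is-e-sound j pj)))
    signs : ∀ es → Pointwise SameUpToSign (map ∂ (map label es)) (map (λ e → ∂ (φ (tl e) , φ (hd e))) es)
    signs []       = []
    signs (e ∷ es) = ∂-norm (φ (tl e)) (φ (hd e)) ∷ signs es
    nonsingular : perm (Aη G (inj₂ ∘ h)) ≢ 0ℤ
    nonsingular z with σ , eq ← per-sign (signs (allFin (nE G))) = nz (eq _ ∙ cong (σ *_) (
      cong₂ per (List.map-tabulate (λ i → i) (λ e → ∂ (φ (tl e) , φ (hd e))))
        (cong (map ε) (List.map-tabulate h label) ∙ List.map-tabulate (label ∘ h) ε) ∙
      sym (perm-per (λ e → ∂ (φ (tl e) , φ (hd e))) (ε ∘ label ∘ h)) ∙ sym (perm-cong (λ e j → entry e (h j))) ∙ z) ∙ ℤ.*-zeroʳ σ)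

  labels-↭ : ∀ {H} → Unique H → (∀ e → label e ∈ H) → (∀ {x} → x ∈ H → ∃ λ e → label e ≡ x) → H ↭ map label (allFin (nE G))
  labels-↭ uH into onto = unique-↭ uH (Unique.map⁺ label-injective (Unique.allFin⁺ (nE G)))
    (λ m → let e , eq = onto m in subst (_∈ _) eq (∈-map⁺ label (∈-allFin e)))
    (λ m → let e , _ , eq = ∈-map⁻ label m in subst (_∈ _) (sym eq) (into e))

  certificate⇒PNS : ∀ {H} → Unique H → (∀ e → label e ∈ H) → (∀ {x} → x ∈ H → ∃ λ e → label e ≡ x) → Certificate H → HasPNSMatrix 0 2 G
  certificate⇒PNS {H} uH into onto cert with es , nz , (rest , bag) ← select cert | H↭ ← labels-↭ uH into onto
    -- Only labels of the selected edges are known; pulling the permutation back along `label`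
    -- recovers the edges themselves.
    with zs , eq , zs↭ ← ↭-map-inv label {xs = allFin (nE G) ++ allFin (nE G)}
           (↭-sym (trans bag (trans (++⁺ H↭ H↭) (↭-reflexive (sym (List.map-++ label (allFin (nE G)) (allFin (nE G))))))))
    with fs , gs , refl , refl ← map-++⁻ label zs es eq =
    columns⇒PNS fs (gs , ↭-sym zs↭) (λ z → nz (per-rows-↭ (map⁺ ∂ H↭) _ ∙ z))

-- Moving the root of the plane tree.

infixr 5 _++F_

_++F_ : Forest → Forest → Forest
[]      ++F g = g
(t ∷ f) ++F g = t ∷ (f ++F g)

edgesF-++ : ∀ p k f g → edgesF p k (f ++F g) ≡ edgesF p k f ++ edgesF p (k ℕ.+ sizeF f) g
edgesF-++ p k []      g = cong (λ j → edgesF p j g) (sym (ℕ.+-identityʳ k))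
edgesF-++ p k (t ∷ f) g = cong ((p , k) ∷_) (cong (edgesT k t ++_) (edgesF-++ p (k ℕ.+ size t) f g ∙
  cong (λ j → edgesF p (k ℕ.+ size t) f ++ edgesF p j g) (ℕ.+-assoc k (size t) (sizeF f))) ∙
  sym (List.++-assoc (edgesT k t) (edgesF p (k ℕ.+ size t) f) _))

leavesF-++ : ∀ k f g → leavesF k (f ++F g) ≡ leavesF k f ++ leavesF (k ℕ.+ sizeF f) g
leavesF-++ k []      g = cong (λ j → leavesF j g) (sym (ℕ.+-identityʳ k))
leavesF-++ k (t ∷ f) g = cong (leavesT k t ++_) (leavesF-++ (k ℕ.+ size t) f g ∙
  cong (λ j → leavesF (k ℕ.+ size t) f ++ leavesF j g) (ℕ.+-assoc k (size t) (sizeF f))) ∙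
  sym (List.++-assoc (leavesT k t) (leavesF (k ℕ.+ size t) f) _)

Shifts : (ℕ → ℕ) → ℕ → ℕ → ℕ → Set
Shifts g k k′ n = ∀ i → i < n → g (k ℕ.+ i) ≡ k′ ℕ.+ i

module _ {g : ℕ → ℕ} where

  shifts-left : ∀ {k k′} m n → Shifts g k k′ (m ℕ.+ n) → Shifts g k k′ m
  shifts-left m n h i i<m = h i (ℕ.≤-trans i<m (ℕ.m≤m+n m n))

  shifts-right : ∀ {k k′} m n → Shifts g k k′ (m ℕ.+ n) → Shifts g (k ℕ.+ m) (k′ ℕ.+ m) n
  shifts-right {k} {k′} m n h i i<n = cong g (ℕ.+-assoc k m i) ∙ h (m ℕ.+ i) (ℕ.+-monoʳ-< m i<n) ∙ sym (ℕ.+-assoc k′ m i)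

  shifts-head : ∀ {k k′ n} → Shifts g k k′ (suc n) → g k ≡ k′
  shifts-head {k} {k′} h = cong g (sym (ℕ.+-identityʳ k)) ∙ h 0 (s≤s z≤n) ∙ ℕ.+-identityʳ k′

  shifts-tail : ∀ {k k′ n} → Shifts g k k′ (suc n) → Shifts g (suc k) (suc k′) n
  shifts-tail {k} {k′} h i i<n = cong g (sym (ℕ.+-suc k i)) ∙ h (suc i) (s≤s i<n) ∙ ℕ.+-suc k′ i

  mutual
    edgesT-shift : ∀ k k′ t → Shifts g k k′ (size t) → map (both g) (edgesT k t) ≡ edgesT k′ t
    edgesT-shift k k′ (node f) h = edgesF-shift k k′ (suc k) (suc k′) f (shifts-head h) (shifts-tail h)

    edgesF-shift : ∀ p p′ k k′ f → g p ≡ p′ → Shifts g k k′ (sizeF f) → map (both g) (edgesF p k f) ≡ edgesF p′ k′ f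
    edgesF-shift p p′ k k′ []      hp h = refl
    edgesF-shift p p′ k k′ (t ∷ f) hp h = cong₂ _∷_ (cong₂ _,_ hp (head t (shifts-left (size t) (sizeF f) h)))
      (List.map-++ (both g) (edgesT k t) _ ∙ cong₂ _++_ (edgesT-shift k k′ t (shifts-left (size t) (sizeF f) h))
        (edgesF-shift p p′ (k ℕ.+ size t) (k′ ℕ.+ size t) f hp (shifts-right (size t) (sizeF f) h)))
      where
      head : ∀ t → Shifts g k k′ (size t) → g k ≡ k′
      head (node f) h = shifts-head h

  mutual
    leavesT-shift : ∀ k k′ t → Shifts g k k′ (size t) → map g (leavesT k t) ≡ leavesT k′ t
    leavesT-shift k k′ (node [])      h = cong (_∷ []) (shifts-head h)
    leavesT-shift k k′ (node (t ∷ f)) h = leavesF-shift (suc k) (suc k′) (t ∷ f) (shifts-tail h)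

    leavesF-shift : ∀ k k′ f → Shifts g k k′ (sizeF f) → map g (leavesF k f) ≡ leavesF k′ f
    leavesF-shift k k′ []      h = refl
    leavesF-shift k k′ (t ∷ f) h = List.map-++ g (leavesT k t) _ ∙ cong₂ _++_ (leavesT-shift k k′ t (shifts-left (size t) (sizeF f) h))
      (leavesF-shift (k ℕ.+ size t) (k′ ℕ.+ size t) f (shifts-right (size t) (sizeF f) h))

  pathEdges-map : ∀ xs → map (both g) (pathEdges xs) ≡ pathEdges (map g xs)
  pathEdges-map []           = refl
  pathEdges-map (x ∷ [])     = refl
  pathEdges-map (x ∷ y ∷ xs) = cong ((g x , g y) ∷_) (pathEdges-map (y ∷ xs))

  lastOr-map : ∀ x xs → g (lastOr x xs) ≡ lastOr (g x) (map g xs)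
  lastOr-map x []       = refl
  lastOr-map x (y ∷ xs) = lastOr-map y xs

  cycleEdges-map : ∀ xs → map (both g) (cycleEdges xs) ≡ cycleEdges (map g xs)
  cycleEdges-map []       = refl
  cycleEdges-map (x ∷ xs) = List.map-++ (both g) (pathEdges (x ∷ xs)) _ ∙
    cong₂ _++_ (pathEdges-map (x ∷ xs)) (cong (λ l → (l , g x) ∷ []) (lastOr-map x xs))

pathEdges-snoc : ∀ x y ys → pathEdges (y ∷ ys ++ x ∷ []) ≡ pathEdges (y ∷ ys) ++ (lastOr y ys , x) ∷ []
pathEdges-snoc x y []       = refl
pathEdges-snoc x y (z ∷ zs) = cong ((y , z) ∷_) (pathEdges-snoc x z zs)

lastOr-snoc : ∀ x y ys → lastOr y (ys ++ x ∷ []) ≡ x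
lastOr-snoc x y []       = refl
lastOr-snoc x y (z ∷ zs) = lastOr-snoc x z zs

cycleEdges-rotate : ∀ x y ys → cycleEdges (x ∷ y ∷ ys) ↭ cycleEdges (y ∷ ys ++ x ∷ [])
cycleEdges-rotate x y ys = trans (∷↭∷ʳ (x , y) (pathEdges (y ∷ ys) ++ (lastOr y ys , x) ∷ []))
  (↭-reflexive (sym (cong₂ (λ p l → p ++ (l , y) ∷ []) (pathEdges-snoc x y ys) (lastOr-snoc x y ys))))

-- The relabelling caused by moving the root from 0 to its first child 1, whose subtree
-- has s further vertices: 1, …, s + 1 move down by one and 0 becomes s + 1.
module _ (s : ℕ) where

  σ : ℕ → ℕ
  σ zero    = suc s
  σ (suc x) with x ℕ.≤? s
  ... | yes _ = x
  ... | no  _ = suc x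

  τ : ℕ → ℕ
  τ y with y ℕ.≤? s | y ℕ.≟ suc s
  ... | yes _ | _     = suc y
  ... | no  _ | yes _ = zero
  ... | no  _ | no  _ = y

  σ-low : ∀ {x} → x ≤ s → σ (suc x) ≡ x
  σ-low {x} x≤s with x ℕ.≤? s
  ... | yes _  = refl
  ... | no x≰s = contradiction x≤s x≰s

  σ-high : ∀ {x} → s < x → σ (suc x) ≡ suc x
  σ-high {x} s<x with x ℕ.≤? s
  ... | yes x≤s = contradiction x≤s (ℕ.<⇒≱ s<x)
  ... | no _    = refl

  τσ : ∀ x → τ (σ x) ≡ x
  τσ zero with suc s ℕ.≤? s | suc s ℕ.≟ suc s
  ... | yes h | _     = contradiction h ℕ.1+n≰n
  ... | no _  | yes _ = refl
  ... | no _  | no ne = contradiction refl ne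
  τσ (suc x) with x ℕ.≤? s
  ... | yes x≤s with x ℕ.≤? s | x ℕ.≟ suc s
  ...   | yes _  | _ = refl
  ...   | no x≰s | _ = contradiction x≤s x≰s
  τσ (suc x) | no x≰s with suc x ℕ.≤? s | suc x ℕ.≟ suc s
  ...   | yes h | _        = contradiction (ℕ.<⇒≤ h) x≰s
  ...   | no _  | yes refl = contradiction ℕ.≤-refl x≰s
  ...   | no _  | no _     = refl

  σ-injective : ∀ {x y} → σ x ≡ σ y → x ≡ y
  σ-injective {x} {y} eq = sym (τσ x) ∙ cong τ eq ∙ τσ y

module _ (f₁ f : Forest) where

  private
    s = sizeF f₁
    t t′ : Tree
    t  = node (node f₁ ∷ f)
    t′ = node (f₁ ++F node f ∷ [])

    lowered : Shifts (σ s) 2 1 s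
    lowered i i<s = σ-low s i<s
    fixed : Shifts (σ s) (2 ℕ.+ s) (2 ℕ.+ s) (sizeF f)
    fixed i _ = σ-high s (s≤s (ℕ.m≤m+n s i))

  -- Only the edge between the old and the new root changes direction, which `norm` hides.
  reroot-edges : map norm (map (both (σ s)) (treeEdges t)) ↭ map norm (treeEdges t′)
  reroot-edges = trans (↭-reflexive eq) (trans (shift′ (norm (suc s , 0)) (map norm B) (map norm D)) (↭-reflexive eq′))
    where
    B = edgesF 0 1 f₁
    D = edgesF (suc s) (2 ℕ.+ s) f
    shift′ : ∀ {X : Set} (x : X) xs ys → x ∷ xs ++ ys ↭ xs ++ x ∷ ys ++ []
    shift′ x xs ys = trans (↭-sym (shift x xs ys)) (++⁺ˡ xs (prep x (↭-reflexive (sym (List.++-identityʳ ys)))))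
    eq : map norm (map (both (σ s)) (treeEdges t)) ≡ norm (suc s , 0) ∷ map norm B ++ map norm D
    eq = cong₂ _∷_ (cong (λ z → norm (suc s , z)) (σ-low s z≤n))
      (cong (map norm) (List.map-++ (both (σ s)) (edgesF 1 2 f₁) _ ∙
        cong₂ _++_ (edgesF-shift 1 0 2 1 f₁ (σ-low s z≤n) lowered) (edgesF-shift 0 (suc s) (2 ℕ.+ s) (2 ℕ.+ s) f refl fixed)) ∙
       List.map-++ norm B D)
    eq′ : map norm B ++ norm (suc s , 0) ∷ map norm D ++ [] ≡ map norm (treeEdges t′)
    eq′ = cong (λ e → map norm B ++ e ∷ map norm D ++ []) (norm-swap (suc s) 0) ∙
      cong (λ ds → map norm B ++ norm (0 , suc s) ∷ ds) (sym (List.map-++ norm D [])) ∙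
      sym (List.map-++ norm B ((0 , suc s) ∷ D ++ [])) ∙ cong (map norm) (sym (edgesF-++ 0 1 f₁ (node f ∷ [])))

reroot-treeLeaves : ∀ u f₁ f → treeLeaves (node ((u ∷ f₁) ++F node f ∷ [])) ≡
                    leavesF 1 (u ∷ f₁) ++ leavesT (suc (sizeF (u ∷ f₁))) (node f) ++ []
reroot-treeLeaves u []       f = leavesF-++ 1 (u ∷ []) (node f ∷ [])
reroot-treeLeaves u (v ∷ f₁) f = leavesF-++ 1 (u ∷ v ∷ f₁) (node f ∷ [])

NonEmpty : Forest → Set
NonEmpty []      = ⊥
NonEmpty (_ ∷ _) = ⊤

-- The old root becomes the last child of the new one, which keeps the cyclic order. Having further
-- children, it is a leaf neither before nor after, so even the starting point of the list is kept.
reroot-leaves : ∀ f₁ f → NonEmpty f → map (σ (sizeF f₁)) (treeLeaves (node (node f₁ ∷ f))) ≡ treeLeaves (node (f₁ ++F node f ∷ []))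
reroot-leaves [] (u ∷ f) _ = cong₂ _∷_ (σ-low 0 z≤n) (leavesF-shift 2 2 (u ∷ f) (λ i _ → σ-high 0 (s≤s z≤n)) ∙
  sym (List.++-identityʳ (leavesF 2 (u ∷ f))))
reroot-leaves (v ∷ f₁) (u ∷ f) _ = List.map-++ (σ s) (leavesF 2 (v ∷ f₁)) _ ∙ cong₂ _++_
    (leavesF-shift 2 1 (v ∷ f₁) (λ i i<s → σ-low s i<s))
    (leavesF-shift (2 ℕ.+ s) (2 ℕ.+ s) (u ∷ f) (λ i _ → σ-high s (s≤s (ℕ.m≤m+n s i))) ∙ sym (List.++-identityʳ (leavesF (2 ℕ.+ s) (u ∷ f)))) ∙
    sym (reroot-treeLeaves v f₁ (u ∷ f))
  where s = sizeF (v ∷ f₁)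

-- An old root that is a leaf stays a leaf but moves from the front of the list to its end, a
-- rotation of the cycle.
reroot-leaf-leaves : ∀ f₁ → NonEmpty f₁ → let s = sizeF f₁ in
  map (σ s) (treeLeaves (node (node f₁ ∷ []))) ≡ suc s ∷ leavesF 1 f₁ ×
  treeLeaves (node (f₁ ++F node [] ∷ [])) ≡ leavesF 1 f₁ ++ suc s ∷ []
reroot-leaf-leaves (v ∷ f₁) _ = cong (suc s ∷_) (cong (map (σ s)) (List.++-identityʳ (leavesF 2 (v ∷ f₁))) ∙ leavesF-shift 2 1 (v ∷ f₁) (λ i i<s → σ-low s i<s)) , reroot-treeLeaves v f₁ []
  where s = sizeF (v ∷ f₁)

norm-both : ∀ g {x y} → norm x ≡ norm y → norm (both g x) ≡ norm (both g y)
norm-both g {a , b} {c , d} eq with norm-injective eq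
... | inj₁ (refl , refl) = refl
... | inj₂ (refl , refl) = norm-swap (g a) (g b)

Proper-norm : ∀ {χ x y} → norm x ≡ norm y → Proper χ x → Proper χ y
Proper-norm {χ} {a , b} {c , d} eq p with norm-injective eq
... | inj₁ (refl , refl) = p
... | inj₂ (refl , refl) = sym (cong not p ∙ Bool.not-involutive (χ b))

-- The leaf colours are an index, so that their cyclic order can be followed through changes of the
-- root; edges are compared up to direction.
record Model (G : Graph) (t : Tree) (cs : List Bool) : Set where
  field
    φ           : Fin (nV G) → ℕ
    φ-injective : Injective _≡_ _≡_ φ
    into        : ∀ e → edgeLabel G φ e ∈ map norm (halinEdges t)
    onto        : ∀ {x} → x ∈ map norm (halinEdges t) → ∃ λ e → edgeLabel G φ e ≡ x
    χ           : ℕ → Bool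
    proper      : All (Proper χ) (treeEdges t)
    colours     : map χ (treeLeaves t) ≡ cs

module _ {G : Graph} {t t′ : Tree} {cs cs′ : List Bool} (s : ℕ) (M : Model G t cs)
         (edges : map norm (map (both (σ s)) (treeEdges t)) ↭ map norm (treeEdges t′))
         (cycle : map norm (map (both (σ s)) (cycleEdges (treeLeaves t))) ↭ map norm (cycleEdges (treeLeaves t′)))
         (colours′ : map (λ x → Model.χ M (τ s x)) (treeLeaves t′) ≡ cs′) where

  open Model M

  private
    all : map norm (map (both (σ s)) (halinEdges t)) ↭ map norm (halinEdges t′)
    all = trans (↭-reflexive (cong (map norm) (List.map-++ (both (σ s)) (treeEdges t) _) ∙ List.map-++ norm (map (both (σ s)) (treeEdges t)) _))
      (trans (++⁺ edges cycle) (↭-reflexive (sym (List.map-++ norm (treeEdges t′) _))))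

  relabel : Model G t′ cs′
  relabel = record
    { φ = σ s ∘ φ
    ; φ-injective = λ eq → φ-injective (σ-injective s eq)
    ; into = into′
    ; onto = onto′
    ; χ = χ ∘ τ s
    ; proper = All.tabulate proper′
    ; colours = colours′
    }
    where
    into′ : ∀ e → edgeLabel G (σ s ∘ φ) e ∈ map norm (halinEdges t′)
    into′ e with h , h∈ , eq ← ∈-map⁻ norm (into e) =
      ∈-resp-↭ all (subst (_∈ map norm (map (both (σ s)) (halinEdges t)))
        (sym (norm-both (σ s) {_ , _} {h} eq)) (∈-map⁺ norm (∈-map⁺ (both (σ s)) h∈)))
    onto′ : ∀ {x} → x ∈ map norm (halinEdges t′) → ∃ λ e → edgeLabel G (σ s ∘ φ) e ≡ x
    onto′ m with h′ , h′∈ , refl ← ∈-map⁻ norm (∈-resp-↭ (↭-sym all) m)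
      with h , h∈ , refl ← ∈-map⁻ (both (σ s)) h′∈ with e , eq ← onto (∈-map⁺ norm h∈) = e , norm-both (σ s) {_ , _} {h} eq
    proper′ : ∀ {q} → q ∈ treeEdges t′ → Proper (χ ∘ τ s) q
    proper′ {q} m with h′ , h′∈ , eq ← ∈-map⁻ norm (∈-resp-↭ (↭-sym edges) (∈-map⁺ norm m))
      with h , h∈ , refl ← ∈-map⁻ (both (σ s)) h′∈ = Proper-norm {x = both (σ s) h} {q} (sym eq)
        (cong χ (τσ s (proj₁ h)) ∙ All.lookup proper h∈ ∙ cong (not ∘ χ) (sym (τσ s (proj₂ h))))

relabelled-colours : ∀ s (χ : ℕ → Bool) L → map (χ ∘ τ s) (map (σ s) L) ≡ map χ L
relabelled-colours s χ L = sym (List.map-∘ L) ∙ List.map-cong (λ x → cong χ (τσ s x)) L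

reroot : ∀ {G f₁ f cs} → NonEmpty f → Model G (node (node f₁ ∷ f)) cs → Model G (node (f₁ ++F node f ∷ [])) cs
reroot {f₁ = f₁} {f} ne M = relabel (sizeF f₁) M (reroot-edges f₁ f)
  (↭-reflexive (cong (map norm) (cycleEdges-map (treeLeaves (node (node f₁ ∷ f))) ∙ cong cycleEdges (reroot-leaves f₁ f ne))))
  (cong (map (χ ∘ τ (sizeF f₁))) (sym (reroot-leaves f₁ f ne)) ∙ relabelled-colours (sizeF f₁) χ _ ∙ colours)
  where open Model M

LeafModel : Graph → List Bool → Set
LeafModel G cs = ∃ λ u → Model G (node (u ∷ [])) cs

-- Following first children brings the root to the first leaf, and no step alters the list of leaf
-- colours.
to-leaf : ∀ {G cs} f₁ f → NonEmpty f → Model G (node (node f₁ ∷ f)) cs → LeafModel G cs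
to-leaf []               f ne M = node f , reroot ne M
to-leaf (node f₂ ∷ f₃) f ne M = to-leaf f₂ (f₃ ++F node f ∷ []) (nonEmpty f₃) (reroot ne M)
  where
  nonEmpty : ∀ f₃ → NonEmpty (f₃ ++F node f ∷ [])
  nonEmpty []      = tt
  nonEmpty (_ ∷ _) = tt

-- One step away from the leaf root sends it to the end of the list; the descent along first
-- children then stops at the next leaf of the cycle.
rotate : ∀ {G c c₁ c₂ cs} → LeafModel G (c ∷ c₁ ∷ c₂ ∷ cs) → LeafModel G (c₁ ∷ c₂ ∷ cs ++ c ∷ [])
rotate (node [] , M) with () ← Model.colours M
rotate {G} {c} {c₁} {c₂} {cs} (node (node f₂ ∷ f₃) , M) = to-leaf f₂ (f₃ ++F node [] ∷ []) (nonEmpty f₃)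
  (relabel s M (reroot-edges f₁ []) (cyc (leavesF 1 f₁) refl) colours′)
  where
  open Model M
  f₁ : Forest
  f₁ = node f₂ ∷ f₃
  s = sizeF f₁
  old = proj₁ (reroot-leaf-leaves f₁ tt)
  new = proj₂ (reroot-leaf-leaves f₁ tt)
  nonEmpty : ∀ f₃ → NonEmpty (f₃ ++F node [] ∷ [])
  nonEmpty []      = tt
  nonEmpty (_ ∷ _) = tt
  cs-eq : map (χ ∘ τ s) (suc s ∷ leavesF 1 f₁) ≡ c ∷ c₁ ∷ c₂ ∷ cs
  cs-eq = cong (map (χ ∘ τ s)) (sym old) ∙ relabelled-colours s χ (treeLeaves (node (node f₁ ∷ []))) ∙ colours
  colours′ : map (χ ∘ τ s) (treeLeaves (node (f₁ ++F node [] ∷ []))) ≡ c₁ ∷ c₂ ∷ cs ++ c ∷ []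
  colours′ = cong (map (χ ∘ τ s)) new ∙ List.map-++ (χ ∘ τ s) (leavesF 1 f₁) (suc s ∷ []) ∙
    cong₂ _++_ (List.∷-injectiveʳ cs-eq) (cong (_∷ []) (List.∷-injectiveˡ cs-eq))
  cyc : ∀ L → leavesF 1 f₁ ≡ L → map norm (map (both (σ s)) (cycleEdges (treeLeaves (node (node f₁ ∷ []))))) ↭ map norm (cycleEdges (treeLeaves (node (f₁ ++F node [] ∷ []))))
  cyc []       eq with () ← cong (map (χ ∘ τ s)) (sym eq) ∙ List.∷-injectiveʳ cs-eq
  cyc (y ∷ ys) eq = map⁺ norm (trans (↭-reflexive (cycleEdges-map (treeLeaves (node (node f₁ ∷ []))) ∙ cong cycleEdges (old ∙ cong (suc s ∷_) eq)))
    (trans (cycleEdges-rotate (suc s) y ys) (↭-reflexive (cong cycleEdges (sym (new ∙ cong (_++ suc s ∷ []) eq))))))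

-- Tree edges and cycle edges are distinct.

pathEdges-∈ : ∀ xs {e} → e ∈ pathEdges xs → proj₁ e ∈ xs × proj₂ e ∈ xs
pathEdges-∈ (x ∷ y ∷ xs) (here refl) = here refl , there (here refl)
pathEdges-∈ (x ∷ y ∷ xs) (there m) with h₁ , h₂ ← pathEdges-∈ (y ∷ xs) m = there h₁ , there h₂

lastOr-∈ : ∀ x xs → lastOr x xs ∈ x ∷ xs
lastOr-∈ x xs = At⇒∈ (At-last x xs)

cycleEdges-∈ : ∀ xs {e} → e ∈ cycleEdges xs → proj₁ e ∈ xs × proj₂ e ∈ xs
cycleEdges-∈ (x ∷ xs) m with ∈-++⁻ (pathEdges (x ∷ xs)) m
... | inj₁ m′          = pathEdges-∈ (x ∷ xs) m′
... | inj₂ (here refl) = lastOr-∈ x xs , here refl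

pathEdges-ascending : ∀ xs → AllPairs _<_ xs → All Ascending (pathEdges xs)
pathEdges-ascending []           _ = []
pathEdges-ascending (x ∷ [])     _ = []
pathEdges-ascending (x ∷ y ∷ xs) ((x<y ∷ _) ∷ h) = x<y ∷ pathEdges-ascending (y ∷ xs) h

pathEdges-unique : ∀ xs → Unique xs → Unique (pathEdges xs)
pathEdges-unique []           _       = []
pathEdges-unique (x ∷ [])     _       = []
pathEdges-unique (x ∷ y ∷ xs) (h ∷ u) =
  All.tabulate (λ m eq → All.lookup h (proj₁ (pathEdges-∈ (y ∷ xs) m)) (cong proj₁ eq)) ∷ pathEdges-unique (y ∷ xs) u

map-norm : ∀ {es} → All Ascending es → map norm es ≡ es
map-norm []      = refl
map-norm (h ∷ p) = cong₂ _∷_ (norm-ascending h) (map-norm p)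

module _ {u : Tree} {y z : ℕ} {zs : List ℕ} (eq : leavesF 1 (u ∷ []) ≡ y ∷ z ∷ zs) where

  private
    ys = z ∷ zs
    E = edgesF 0 1 (u ∷ [])
    l = lastOr y ys
    path = pathEdges (y ∷ ys)
    sorted : AllPairs _<_ (y ∷ ys)
    sorted = subst (AllPairs _<_) eq (leaves-sorted 1 (u ∷ []))
    positive : All (1 ≤_) (y ∷ ys)
    positive = subst (All (1 ≤_)) eq (leaves-≥ 1 (u ∷ []))
    0∉ : 0 ∉ y ∷ ys
    0∉ m with () ← All.lookup positive m

  normalised : map norm (halinEdges (node (u ∷ []))) ≡ halin y ys E
  normalised = List.map-++ norm E _ ∙ cong₂ _++_ (map-norm (ascendingF 0 1 (u ∷ []) ℕ.≤-refl)) (cong (λ L → map norm (cycleEdges (0 ∷ L))) eq ∙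
    cong₂ _∷_ (norm-ascending (All.head positive)) (List.map-++ norm path _ ∙
      cong₂ _++_ (map-norm (pathEdges-ascending (y ∷ ys) sorted)) (cong (_∷ []) (norm-swap l 0 ∙ norm-ascending (All.lookup positive (lastOr-∈ y ys))))))

  private
    late-parents : ∀ v f → leavesF 1 (node (v ∷ f) ∷ []) ≡ y ∷ z ∷ zs → ∀ {e} → e ∈ edgesF 0 1 (node (v ∷ f) ∷ []) → proj₁ e ≡ 0 → proj₂ e ∉ y ∷ ys
    late-parents v f eq′ (here refl) _ m with s≤s () ← All.lookup (subst (All (2 ≤_)) (sym (List.++-identityʳ _) ∙ eq′) (leaves-≥ 2 (v ∷ f))) m
    late-parents v f eq′ {e} (there m) e≡0 _ with ∈-++⁻ (edgesF 1 2 (v ∷ f)) m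
    ... | inj₁ m′ with All.lookup (parentsF 1 2 (v ∷ f)) m′
    ...   | here p with () ← sym e≡0 ∙ p
    ...   | there p with () ← subst (2 ≤_) e≡0 (All.lookup (Sublist.All-resp-⊆ (intF⊆ 1 2 (v ∷ f)) (range-≥ 2 _ ℕ.≤-refl)) p)

    root-child : ∀ u → leavesF 1 (u ∷ []) ≡ y ∷ z ∷ zs → ∀ {e} → e ∈ edgesF 0 1 (u ∷ []) → proj₁ e ≡ 0 → proj₂ e ∉ y ∷ ys
    root-child (node (v ∷ f)) = late-parents v f

  -- A cycle edge within the path starts at a leaf other than 0, which is nobody's parent. A cycle
  -- edge at 0 ends in a leaf, whereas the only tree edge at 0 leads to 1, an internal vertex
  -- because at least two further leaves lie below it.
  halin-unique : Unique (halin y ys E)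
  halin-unique = Unique.++⁺ unique-E unique-cycle disjoint
    where
    unique-E : Unique E
    unique-E = AllPairs.map (λ ne e → ne (cong proj₂ e)) (AllPairs.map⁻ (edges-unique 0 1 (u ∷ [])))
    path-0 : ∀ {v e} → e ∈ path → (0 , v) ≢ e
    path-0 m refl = 0∉ (proj₁ (pathEdges-∈ (y ∷ ys) m))
    y≢l : y ≢ l
    y≢l = ℕ.<⇒≢ (All.lookup (AllPairs.head sorted) (lastOr-∈ z zs))
    unique-cycle : Unique ((0 , y) ∷ path ++ (0 , l) ∷ [])
    unique-cycle = All.++⁺ (All.tabulate path-0) ((λ e → y≢l (cong proj₂ e)) ∷ []) ∷
      Unique.++⁺ (pathEdges-unique (y ∷ ys) (sorted⇒unique sorted)) ([] ∷ []) (λ { (m , here refl) → path-0 m refl })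
    ends∈ : ∀ {e} → e ∈ (0 , y) ∷ path ++ (0 , l) ∷ [] → (proj₁ e ≡ 0 ⊎ proj₁ e ∈ y ∷ ys) × proj₂ e ∈ y ∷ ys
    ends∈ (here refl) = inj₁ refl , here refl
    ends∈ (there m) with ∈-++⁻ path m
    ... | inj₁ m′ = inj₂ (proj₁ (pathEdges-∈ (y ∷ ys) m′)) , proj₂ (pathEdges-∈ (y ∷ ys) m′)
    ... | inj₂ (here refl) = inj₁ refl , lastOr-∈ y ys
    disjoint : ∀ {e} → e ∈ E × e ∈ (0 , y) ∷ path ++ (0 , l) ∷ [] → ⊥
    disjoint (e∈E , m) with ends∈ m
    ... | inj₁ e≡0 , h = root-child u eq e∈E e≡0 h
    ... | inj₂ h   , _ = All.lookup (parents-off-leaves 0 1 (u ∷ []) ℕ.≤-refl) e∈E (subst (_ ∈_) (sym eq) h)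

-- The 2-colouring of the tree.

mutual
  -- The colour is the parity of the depth; the vertex is located by comparing its label with the
  -- label intervals of the subtrees.
  colourT : Bool → ℕ → Tree → ℕ → Bool
  colourT c k (node f) x with x ℕ.≟ k
  ... | yes _ = c
  ... | no  _ = colourF (not c) (suc k) f x

  colourF : Bool → ℕ → Forest → ℕ → Bool
  colourF c k []      x = c
  colourF c k (t ∷ f) x with x ℕ.<? k ℕ.+ size t
  ... | yes _ = colourT c k t x
  ... | no  _ = colourF c (k ℕ.+ size t) f x

colourT-root : ∀ c k t → colourT c k t k ≡ c
colourT-root c k (node f) with k ℕ.≟ k
... | yes _ = refl
... | no ne = contradiction refl ne

colourT-below : ∀ c k f {x} → k < x → colourT c k (node f) x ≡ colourF (not c) (suc k) f x
colourT-below c k f {x} k<x with x ℕ.≟ k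
... | yes refl = contradiction k<x ℕ.1+n≰n
... | no _     = refl

colourF-first : ∀ c k t f {x} → x < k ℕ.+ size t → colourF c k (t ∷ f) x ≡ colourT c k t x
colourF-first c k t f {x} h with x ℕ.<? k ℕ.+ size t
... | yes _ = refl
... | no n  = contradiction h n

colourF-rest : ∀ c k t f {x} → k ℕ.+ size t ≤ x → colourF c k (t ∷ f) x ≡ colourF c (k ℕ.+ size t) f x
colourF-rest c k t f {x} h with x ℕ.<? k ℕ.+ size t
... | yes y = contradiction y (ℕ.≤⇒≯ h)
... | no _  = refl

module _ (χ : ℕ → Bool) where

  Coloured : Bool → ℕ → Forest → Set
  Coloured c k f = ∀ {x} → k ≤ x → x < k ℕ.+ sizeF f → χ x ≡ colourF c k f x

  colourF-proper : ∀ c p k f → χ p ≡ not c → Coloured c k f → All (Proper χ) (edgesF p k f)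
  colourF-proper c p k [] hp h = []
  colourF-proper c p k (node f′ ∷ f) hp h =
    (hp ∙ cong not (sym root)) ∷
    All.++⁺ (colourF-proper (not c) k (suc k) f′ (root ∙ sym (Bool.not-involutive c)) inner)
            (colourF-proper c p K f hp (λ K≤x x<N → h (ℕ.≤-trans (ℕ.m≤m+n k (size t)) K≤x) (ℕ.<-≤-trans x<N (ℕ.≤-reflexive KN)) ∙ colourF-rest c k t f K≤x))
    where
    t : Tree
    t = node f′
    K = k ℕ.+ size t
    KN : K ℕ.+ sizeF f ≡ k ℕ.+ (size t ℕ.+ sizeF f)
    KN = ℕ.+-assoc k (size t) (sizeF f)
    K≤N : K ≤ k ℕ.+ (size t ℕ.+ sizeF f)
    K≤N = ℕ.+-monoʳ-≤ k (ℕ.m≤m+n (size t) (sizeF f))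
    k<K : k < K
    k<K = ℕ.m<m+n k (s≤s z≤n)
    root : χ k ≡ c
    root = h ℕ.≤-refl (ℕ.<-≤-trans k<K K≤N) ∙ colourF-first c k t f k<K ∙ colourT-root c k t
    inner : Coloured (not c) (suc k) f′
    inner {x} k<x x< = h (ℕ.<⇒≤ k<x) (ℕ.<-≤-trans x<K K≤N) ∙ colourF-first c k t f x<K ∙ colourT-below c k f′ k<x
      where
      x<K : x < K
      x<K = ℕ.<-≤-trans x< (ℕ.≤-reflexive (sym (ℕ.+-suc k (sizeF f′))))

colour-proper : ∀ t → All (Proper (colourT true 0 t)) (treeEdges t)
colour-proper t@(node f) = colourF-proper (colourT true 0 t) false 0 1 f refl (λ 0<x _ → colourT-below true 0 f 0<x)

-- The initial model and the final choice of root.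

-- If `x` were missed, `punchOut` at `x` would inject `suc n` points into `n`.
injective⇒surjective : ∀ {n} (φ : Fin n → ℕ) → Injective _≡_ _≡_ φ → (∀ i → φ i < n) → ∀ {x} → x < n → ∃ λ i → φ i ≡ x
injective⇒surjective {suc n} φ inj bound {x} x<n with Fin.any? (λ i → φ i ℕ.≟ x)
... | yes found = found
... | no none = contradiction (Fin.injective⇒≤ {f = λ i → punchOut (apart i)} (λ {i} {j} eq → inj (
    sym (Fin.toℕ-fromℕ< (bound i)) ∙ cong toℕ (Fin.punchOut-injective (apart i) (apart j) eq) ∙ Fin.toℕ-fromℕ< (bound j)))) ℕ.1+n≰n
  where
  apart : ∀ i → fromℕ< x<n ≢ fromℕ< (bound i)
  apart i eq = none (i , (sym (Fin.toℕ-fromℕ< (bound i)) ∙ cong toℕ (sym eq) ∙ Fin.toℕ-fromℕ< x<n))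

halinEdges-bound : ∀ t {e} → e ∈ halinEdges t → proj₁ e < size t × proj₂ e < size t
halinEdges-bound t@(node f) {e} m with ∈-++⁻ (treeEdges t) m
... | inj₁ m′ = ℕ.<-trans (All.lookup (ascendingF 0 1 f ℕ.≤-refl) m′) below , below
  where
  below : proj₂ e < size t
  below = All.lookup (subst (All (_< size t)) (sym (labelsF 0 1 f)) (range-< 1 (sizeF f))) (∈-map⁺ proj₂ m′)
... | inj₂ m′ = All.lookup (leaves< f) (proj₁ (cycleEdges-∈ (treeLeaves t) m′)) , All.lookup (leaves< f) (proj₂ (cycleEdges-∈ (treeLeaves t) m′))
  where
  leaves< : ∀ f → All (_< size (node f)) (treeLeaves (node f))
  leaves< []          = []
  leaves< (u ∷ [])    = s≤s z≤n ∷ leaves-< 1 (u ∷ [])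
  leaves< (u ∷ v ∷ f) = leaves-< 1 (u ∷ v ∷ f)

initial : ∀ G → IsGenHalin G → ∃ λ t → 3 ≤ length (treeLeaves t) × ∃ λ cs → Model G t cs
initial G (t , 3≤ , φ , n≡ , inj , bound , adj) = t , 3≤ , _ , record
  { φ = φ
  ; φ-injective = inj
  ; into = into
  ; onto = onto
  ; χ = colourT true 0 t
  ; proper = colour-proper t
  ; colours = refl
  }
  where
  into : ∀ e → edgeLabel G φ e ∈ map norm (halinEdges t)
  into e with Equivalence.to (adj _ _) (e , inj₁ (refl , refl))
  ... | inj₁ m = ∈-map⁺ norm m
  ... | inj₂ m = subst (_∈ map norm (halinEdges t)) (norm-swap _ _) (∈-map⁺ norm m)
  surjective : ∀ {x} → x < size t → ∃ λ u → φ u ≡ x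
  surjective x< = injective⇒surjective φ inj (λ u → subst (φ u <_) (sym n≡) (bound u)) (subst (_ <_) (sym n≡) x<)
  onto : ∀ {x} → x ∈ map norm (halinEdges t) → ∃ λ e → edgeLabel G φ e ≡ x
  onto m with (a , b) , h∈ , refl ← ∈-map⁻ norm m with a< , b< ← halinEdges-bound t h∈
    with u , refl ← surjective a< with v , refl ← surjective b< with Equivalence.from (adj u v) (inj₁ h∈)
  ... | e , inj₁ (p , q) = e , cong₂ (λ x y → norm (φ x , φ y)) p q
  ... | e , inj₂ (p , q) = e , (cong₂ (λ x y → norm (φ x , φ y)) p q ∙ norm-swap (φ v) (φ u))

leaf-model : ∀ {G cs} t → 3 ≤ length (treeLeaves t) → Model G t cs → LeafModel G cs
leaf-model (node [])                () M
leaf-model (node (u ∷ []))          _  M = u , M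
leaf-model (node (node f₁ ∷ u ∷ f)) _  M = to-leaf f₁ (u ∷ f) tt M

BalancedColours : List Bool → Set
BalancedColours (c₀ ∷ c₁ ∷ c₂ ∷ []) = c₁ ≡ c₂
BalancedColours _                   = ⊤

finish : ∀ {G cs} → 3 ≤ length cs → BalancedColours cs → LeafModel G cs → HasPNSMatrix 0 2 G
finish {G} 3≤ bal (u , M) = go (leavesF 1 (u ∷ [])) refl colours 3≤ bal
  where
  open Model M
  go : ∀ L {cs} → leavesF 1 (u ∷ []) ≡ L → map χ (0 ∷ leavesF 1 (u ∷ [])) ≡ cs → 3 ≤ length cs → BalancedColours cs → HasPNSMatrix 0 2 G
  go [] eq refl h _ = contradiction (subst (λ L → 3 ≤ length (map χ (0 ∷ L))) eq h) λ { (s≤s ()) }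
  go (y ∷ []) eq refl h _ = contradiction (subst (λ L → 3 ≤ length (map χ (0 ∷ L))) eq h) λ { (s≤s (s≤s ())) }
  go (y ∷ z ∷ zs) eq refl h bal = certificate⇒PNS G φ φ-injective (halin-unique {u} eq)
    (λ e → subst (edgeLabel G φ e ∈_) (normalised {u} eq) (into e))
    (λ {x} m → onto (subst (x ∈_) (sym (normalised {u} eq)) m))
    (halin-certificate u χ proper y (z ∷ zs) eq (s≤s z≤n) (balanced zs (subst (λ L → BalancedColours (map χ (0 ∷ L))) eq bal)))
    where
    balanced : ∀ zs → BalancedColours (map χ (0 ∷ y ∷ z ∷ zs)) → Balanced χ (y ∷ z ∷ zs)
    balanced []       b = b
    balanced (_ ∷ _)  _ = tt

balance : ∀ {G} cs → 3 ≤ length cs → LeafModel G cs → HasPNSMatrix 0 2 G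
balance [] () M
balance (c₀ ∷ []) (s≤s ()) M
balance (c₀ ∷ c₁ ∷ []) (s≤s (s≤s ())) M
balance (c₀ ∷ c₁ ∷ c₂ ∷ c₃ ∷ cs) h M = finish h tt M
balance (c₀ ∷ c₁ ∷ c₂ ∷ []) h M with c₁ Bool.≟ c₂ | c₂ Bool.≟ c₀
... | yes e | _     = finish h e M
... | no _  | yes e = finish h e (rotate M)
-- With two colours, `c₀` and `c₁` both differ from `c₂` and hence agree; two rotations make `c₂`
-- the colour of the root.
... | no p  | no q  = finish h (Bool.¬-not (λ e → q (sym e)) ∙ sym (Bool.¬-not p)) (rotate (rotate M))

theorem1 : (G : Graph) → IsGenHalin G → HasPNSMatrix 0 2 G
theorem1 G halinG with t , 3≤ , cs , M ← initial G halinG =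
  balance cs (subst (3 ≤_) (sym (List.length-map (Model.χ M) (treeLeaves t)) ∙ cong length (Model.colours M)) 3≤) (leaf-model t 3≤ M)
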